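{- Let $n\ge 4$ and $\omega=\frac12(-1+\sqrt3\,i)$. With relations ordered $\mathcal R_0,\dots,\mathcal R_6$ as in the context and a suitable ordering $E_0=\frac1{|\Phi|}J,E_1,\dots,E_6$ of the primitive idempotents, the character table of $\mathcal X(GU(n,2),\Phi(n,2))$ has rows $E_0$: $(1,1,1,2^{2n-3},2^{2n-3},2^{2n-3},2^{2n-3}-(-2)^{n-1}-4)$; $E_1$: $(1,\omega,\bar\omega,-(-2)^{n-1},-(-2)^{n-1}\bar\omega,-(-2)^{n-1}\omega,0)$; $E_2$: $(1,\bar\omega,\omega,-(-2)^{n-1},-(-2)^{n-1}\omega,-(-2)^{n-1}\bar\omega,0)$; $E_3$: $(1,1,1,-(-2)^{n-2},-(-2)^{n-2},-(-2)^{n-2},3(-2)^{n-2}-3)$; $E_4$: $(1,\omega,\bar\omega,-(-2)^{n-2},-(-2)^{n-2}\bar\omega,-(-2)^{n-2}\omega,0)$; $E_5$: $(1,\bar\omega,\omega,-(-2)^{n-2},-(-2)^{n-2}\omega,-(-2)^{n-2}\bar\omega,0)$; $E_6$: $(1,1,1,-(-2)^{n-3},-(-2)^{n-3},-(-2)^{n-3},3(-2)^{n-3}-3)$.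
   Context: Let $\Phi=\Phi(n,2)=\{x\in\mathbb{F}_4^n\setminus\{0\}:\langle x,x\rangle=0\}$ with $\langle x,y\rangle=\sum_k x_ky_k^{2}$, and let $\mathcal X(GU(n,2),\Phi(n,2))$ be the (commutative) association scheme of orbitals of $GU(n,2)$ acting on $\Phi$ by $x\mapsto xU$. Fix a primitive element $\alpha$ of $\mathbb{F}_4$. For $n\ge4$ the relations are $\mathcal R_l=\{(x,y)\in\Phi^2:y=\alpha^lx\}$ for $l=0,1,2$, $\mathcal R_l=\{(x,y)\in\Phi^2:\langle x,y\rangle=\alpha^{l}\}$ for $l=3,4,5$, and $\mathcal R_6=\{(x,y)\in\Phi^2:\langle x,y\rangle=0,\ y\notin\mathrm{Span}\{x\}\}$. The character table is $P=[p_j(i)]$ with $A_j=\sum_i p_j(i)E_i$, where $A_j$ is the adjacency matrix of $\mathcal R_j$ and $E_i$ are the primitive idempotents of the Bose–Mesner algebra. -}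

module Defs where

open import Data.Bool.Base using (if_then_else_)
open import Data.Fin.Base using (Fin)
open import Data.Fin.Patterns using (0F; 1F; 2F; 3F; 4F; 5F; 6F)
import Data.Fin.Properties as Fin
open import Data.Integer.Base as ℤ using (ℤ; +_)
import Data.Integer.Properties as ℤₚ
open import Data.List.Base as List using (List; length; allFin; cartesianProductWith; mapMaybe)
open import Data.Maybe.Base using (Maybe; just; nothing)
open import Data.Nat.Base as ℕ using (ℕ; zero; suc)
import Data.Nat.Properties as ℕₚ
open import Data.Nat.Tactic.RingSolver using (solve-∀)
open import Data.Product using (∃; ∃!; ∃₂; _×_; _,_; proj₁; proj₂)
open import Data.Rational.Base as ℚ using (ℚ; mkℚ; 0ℚ; 1ℚ; ½)
import Data.Rational.Properties as ℚₚ
open import Algebra.Properties.Ring ℚₚ.+-*-ring using (x[y-z]≈xy-xz)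
open import Data.Rational.Solver using (module +-*-Solver)
import Data.Rational.Unnormalised.Base as ℚᵘ
import Data.Rational.Unnormalised.Properties as ℚᵘₚ
open import Data.Sum.Base using (_⊎_; inj₁; inj₂)
open import Data.Vec.Base as Vec using (Vec; []; _∷_; lookup; replicate; zipWith; foldr′)
import Data.Vec.Properties as Vecₚ
open import Function.Bundles using (_⇔_)
open import Relation.Binary.Definitions using (DecidableEquality)
open import Relation.Binary.PropositionalEquality using (_≡_; refl; sym; trans; cong; cong₂; subst; subst₂)
open import Relation.Nullary using (¬_; Dec; yes; no; does; ¬?; _×-dec_; _⊎-dec_; contradiction)
import Relation.Nullary.Decidable as Dec

-- ℝ is represented by Cauchy sequences of rationals, taken up to _≈ℝ_.

IsCauchy : (ℕ → ℚ) → Set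
IsCauchy u = ∀ ε → 0ℚ ℚ.< ε →
  ∃ λ N → ∀ m n → N ℕ.≤ m → N ℕ.≤ n → ℚ.∣ u m ℚ.- u n ∣ ℚ.< ε

record ℝ : Set where
  constructor mkℝ
  field
    seq    : ℕ → ℚ
    cauchy : IsCauchy seq

open ℝ public

infix 4 _≈ℝ_

_≈ℝ_ : ℝ → ℝ → Set
x ≈ℝ y = ∀ ε → 0ℚ ℚ.< ε → ∃ λ N → ∀ n → N ℕ.≤ n → ℚ.∣ seq x n ℚ.- seq y n ∣ ℚ.< ε

halve : ∀ ε → 0ℚ ℚ.< ε → 0ℚ ℚ.< ½ ℚ.* ε
halve ε 0<ε =
  ℚₚ.positive⁻¹ (½ ℚ.* ε) {{ℚₚ.pos*pos⇒pos ½ ε {{ℚ.positive 0<ε}}}}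

halves : ∀ ε → ½ ℚ.* ε ℚ.+ ½ ℚ.* ε ≡ ε
halves ε = trans (sym (ℚₚ.*-distribʳ-+ ε ½ ½)) (ℚₚ.*-identityˡ ε)

eventually-bounded : (x : ℝ) → ∃₂ λ N B → 0ℚ ℚ.< B × (∀ n → N ℕ.≤ n → ℚ.∣ seq x n ∣ ℚ.≤ B)
eventually-bounded x with cauchy x 1ℚ (ℚₚ.positive⁻¹ 1ℚ)
... | N , close = N , 1ℚ ℚ.+ ℚ.∣ seq x N ∣ ,
    ℚₚ.positive⁻¹ (1ℚ ℚ.+ ℚ.∣ seq x N ∣) {{ℚₚ.pos+nonNeg⇒pos 1ℚ ℚ.∣ seq x N ∣ {{ℚₚ.∣-∣-nonNeg (seq x N)}}}} ,
    λ n N≤n → begin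
      ℚ.∣ seq x n ∣                                  ≡⟨ cong ℚ.∣_∣ (split (seq x n) (seq x N)) ⟩
      ℚ.∣ (seq x n ℚ.- seq x N) ℚ.+ seq x N ∣        ≤⟨ ℚₚ.∣p+q∣≤∣p∣+∣q∣ (seq x n ℚ.- seq x N) (seq x N) ⟩
      ℚ.∣ seq x n ℚ.- seq x N ∣ ℚ.+ ℚ.∣ seq x N ∣    ≤⟨ ℚₚ.+-monoˡ-≤ ℚ.∣ seq x N ∣ (ℚₚ.<⇒≤ (close n N N≤n ℕₚ.≤-refl)) ⟩
      1ℚ ℚ.+ ℚ.∣ seq x N ∣                           ∎
  where
  open ℚₚ.≤-Reasoning
  open +-*-Solver
  split : ∀ p q → p ≡ (p ℚ.- q) ℚ.+ q
  split = solve 2 (λ p q → p := (p :- q) :+ q) refl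

abstract
  const-cauchy : ∀ q → IsCauchy (λ _ → q)
  const-cauchy q ε 0<ε = 0 , λ _ _ _ _ →
    subst (ℚ._< ε) (sym (cong ℚ.∣_∣ (ℚₚ.+-inverseʳ q))) 0<ε

  +-cauchy : ∀ x y → IsCauchy (λ n → seq x n ℚ.+ seq y n)
  +-cauchy x y = close
    where
    open +-*-Solver
    open ℚₚ.≤-Reasoning
    rearrange : ∀ a b c d → (a ℚ.+ b) ℚ.- (c ℚ.+ d) ≡ (a ℚ.- c) ℚ.+ (b ℚ.- d)
    rearrange = solve 4 (λ a b c d → (a :+ b) :- (c :+ d) := (a :- c) :+ (b :- d)) refl
    close : ∀ ε → 0ℚ ℚ.< ε → ∃ λ N → ∀ m n → N ℕ.≤ m → N ℕ.≤ n →
            ℚ.∣ (seq x m ℚ.+ seq y m) ℚ.- (seq x n ℚ.+ seq y n) ∣ ℚ.< ε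
    close ε 0<ε with cauchy x (½ ℚ.* ε) (halve ε 0<ε) | cauchy y (½ ℚ.* ε) (halve ε 0<ε)
    ... | M , cx | N , cy = M ℕ.⊔ N , λ m n m≥ n≥ → begin-strict
      ℚ.∣ (seq x m ℚ.+ seq y m) ℚ.- (seq x n ℚ.+ seq y n) ∣            ≡⟨ cong ℚ.∣_∣ (rearrange (seq x m) (seq y m) (seq x n) (seq y n)) ⟩
      ℚ.∣ (seq x m ℚ.- seq x n) ℚ.+ (seq y m ℚ.- seq y n) ∣            ≤⟨ ℚₚ.∣p+q∣≤∣p∣+∣q∣ (seq x m ℚ.- seq x n) (seq y m ℚ.- seq y n) ⟩
      ℚ.∣ seq x m ℚ.- seq x n ∣ ℚ.+ ℚ.∣ seq y m ℚ.- seq y n ∣          <⟨ ℚₚ.+-mono-<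
          (cx m n (ℕₚ.≤-trans (ℕₚ.m≤m⊔n M N) m≥) (ℕₚ.≤-trans (ℕₚ.m≤m⊔n M N) n≥))
          (cy m n (ℕₚ.≤-trans (ℕₚ.m≤n⊔m M N) m≥) (ℕₚ.≤-trans (ℕₚ.m≤n⊔m M N) n≥)) ⟩
      ½ ℚ.* ε ℚ.+ ½ ℚ.* ε                                              ≡⟨ halves ε ⟩
      ε                                                                ∎

  neg-cauchy : ∀ x → IsCauchy (λ n → ℚ.- seq x n)
  neg-cauchy x ε 0<ε = proj₁ (cauchy x ε 0<ε) , λ m n m≥ n≥ →
    subst (ℚ._< ε) (sym (flip (seq x m) (seq x n))) (proj₂ (cauchy x ε 0<ε) m n m≥ n≥)
    where
    open +-*-Solver
    flip : ∀ p q → ℚ.∣ ℚ.- p ℚ.- ℚ.- q ∣ ≡ ℚ.∣ p ℚ.- q ∣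
    flip p q = trans (cong ℚ.∣_∣ (solve 2 (λ p q → :- p :- :- q := :- (p :- q)) refl p q))
                     (ℚₚ.∣-p∣≡∣p∣ (p ℚ.- q))

  *-cauchy : ∀ x y → IsCauchy (λ n → seq x n ℚ.* seq y n)
  *-cauchy x y = close
    where
    open +-*-Solver
    open ℚₚ.≤-Reasoning
    rearrange : ∀ a b c d → a ℚ.* b ℚ.- c ℚ.* d ≡ a ℚ.* (b ℚ.- d) ℚ.+ d ℚ.* (a ℚ.- c)
    rearrange a b c d = trans (telescope (a ℚ.* b) (a ℚ.* d) (c ℚ.* d))
      (cong₂ ℚ._+_ (sym (x[y-z]≈xy-xz a b d))
        (trans (cong₂ ℚ._-_ (ℚₚ.*-comm a d) (ℚₚ.*-comm c d)) (sym (x[y-z]≈xy-xz d a c))))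
      where
      telescope : ∀ p q r → p ℚ.- r ≡ (p ℚ.- q) ℚ.+ (q ℚ.- r)
      telescope = solve 3 (λ p q r → p :- r := (p :- q) :+ (q :- r)) refl
    quot : ∀ B → 0ℚ ℚ.< B → ℚ → ℚ
    quot B 0<B δ = (ℚ.1/ B) {{ℚₚ.pos⇒nonZero B {{ℚ.positive 0<B}}}} ℚ.* δ
    -- |p| ≤ B and |q| < δ/B give |pq| < δ
    bound : ∀ B (0<B : 0ℚ ℚ.< B) δ p q → ℚ.∣ p ∣ ℚ.≤ B →
            ℚ.∣ q ∣ ℚ.< quot B 0<B δ →
            ℚ.∣ p ℚ.* q ∣ ℚ.< δ
    bound B 0<B δ p q p≤ q< = begin-strict
      ℚ.∣ p ℚ.* q ∣            ≡⟨ ℚₚ.∣p*q∣≡∣p∣*∣q∣ p q ⟩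
      ℚ.∣ p ∣ ℚ.* ℚ.∣ q ∣      ≤⟨ ℚₚ.*-monoʳ-≤-nonNeg ℚ.∣ q ∣ {{ℚₚ.∣-∣-nonNeg q}} p≤ ⟩
      B ℚ.* ℚ.∣ q ∣            <⟨ ℚₚ.*-monoʳ-<-pos B {{ℚ.positive 0<B}} q< ⟩
      B ℚ.* (B⁻¹ ℚ.* δ)        ≡⟨ ℚₚ.*-assoc B B⁻¹ δ ⟨
      B ℚ.* B⁻¹ ℚ.* δ          ≡⟨ cong (ℚ._* δ) (ℚₚ.*-inverseʳ B {{ℚₚ.pos⇒nonZero B {{ℚ.positive 0<B}}}}) ⟩
      1ℚ ℚ.* δ                 ≡⟨ ℚₚ.*-identityˡ δ ⟩
      δ                        ∎
      where
      B⁻¹ : ℚ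
      B⁻¹ = (ℚ.1/ B) {{ℚₚ.pos⇒nonZero B {{ℚ.positive 0<B}}}}
    shrink : ∀ B (0<B : 0ℚ ℚ.< B) δ → 0ℚ ℚ.< δ →
             0ℚ ℚ.< quot B 0<B δ
    shrink B 0<B δ 0<δ = ℚₚ.positive⁻¹ (quot B 0<B δ)
      {{ℚₚ.pos*pos⇒pos ((ℚ.1/ B) {{ℚₚ.pos⇒nonZero B {{ℚ.positive 0<B}}}}) {{ℚₚ.1/pos⇒pos B {{ℚ.positive 0<B}}}} δ {{ℚ.positive 0<δ}}}}
    close : ∀ ε → 0ℚ ℚ.< ε → ∃ λ N → ∀ m n → N ℕ.≤ m → N ℕ.≤ n →
            ℚ.∣ seq x m ℚ.* seq y m ℚ.- seq x n ℚ.* seq y n ∣ ℚ.< ε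
    close ε 0<ε = (K ℕ.⊔ L) ℕ.⊔ (M ℕ.⊔ N) , λ m n m≥ n≥ → begin-strict
      ℚ.∣ seq x m ℚ.* seq y m ℚ.- seq x n ℚ.* seq y n ∣
        ≡⟨ cong ℚ.∣_∣ (rearrange (seq x m) (seq y m) (seq x n) (seq y n)) ⟩
      ℚ.∣ seq x m ℚ.* (seq y m ℚ.- seq y n) ℚ.+ seq y n ℚ.* (seq x m ℚ.- seq x n) ∣
        ≤⟨ ℚₚ.∣p+q∣≤∣p∣+∣q∣ (seq x m ℚ.* (seq y m ℚ.- seq y n)) (seq y n ℚ.* (seq x m ℚ.- seq x n)) ⟩
      ℚ.∣ seq x m ℚ.* (seq y m ℚ.- seq y n) ∣ ℚ.+ ℚ.∣ seq y n ℚ.* (seq x m ℚ.- seq x n) ∣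
        <⟨ ℚₚ.+-mono-<
             (bound B 0<B (½ ℚ.* ε) (seq x m) (seq y m ℚ.- seq y n) (x≤B m (≥K m≥)) (cy m n (≥M m≥) (≥M n≥)))
             (bound C 0<C (½ ℚ.* ε) (seq y n) (seq x m ℚ.- seq x n) (y≤C n (≥L n≥)) (cx m n (≥N m≥) (≥N n≥))) ⟩
      ½ ℚ.* ε ℚ.+ ½ ℚ.* ε
        ≡⟨ halves ε ⟩
      ε ∎
      where
      bx : ∃₂ λ K B → 0ℚ ℚ.< B × (∀ n → K ℕ.≤ n → ℚ.∣ seq x n ∣ ℚ.≤ B)
      bx = eventually-bounded x
      by : ∃₂ λ L C → 0ℚ ℚ.< C × (∀ n → L ℕ.≤ n → ℚ.∣ seq y n ∣ ℚ.≤ C)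
      by = eventually-bounded y
      K L M N : ℕ
      B C : ℚ
      K   = proj₁ bx
      B   = proj₁ (proj₂ bx)
      0<B : 0ℚ ℚ.< B
      0<B = proj₁ (proj₂ (proj₂ bx))
      x≤B : ∀ n → K ℕ.≤ n → ℚ.∣ seq x n ∣ ℚ.≤ B
      x≤B = proj₂ (proj₂ (proj₂ bx))
      L   = proj₁ by
      C   = proj₁ (proj₂ by)
      0<C : 0ℚ ℚ.< C
      0<C = proj₁ (proj₂ (proj₂ by))
      y≤C : ∀ n → L ℕ.≤ n → ℚ.∣ seq y n ∣ ℚ.≤ C
      y≤C = proj₂ (proj₂ (proj₂ by))
      M   = proj₁ (cauchy y (quot B 0<B (½ ℚ.* ε)) (shrink B 0<B (½ ℚ.* ε) (halve ε 0<ε)))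
      cy : ∀ m n → M ℕ.≤ m → M ℕ.≤ n → ℚ.∣ seq y m ℚ.- seq y n ∣ ℚ.< quot B 0<B (½ ℚ.* ε)
      cy  = proj₂ (cauchy y (quot B 0<B (½ ℚ.* ε)) (shrink B 0<B (½ ℚ.* ε) (halve ε 0<ε)))
      N   = proj₁ (cauchy x (quot C 0<C (½ ℚ.* ε)) (shrink C 0<C (½ ℚ.* ε) (halve ε 0<ε)))
      cx : ∀ m n → N ℕ.≤ m → N ℕ.≤ n → ℚ.∣ seq x m ℚ.- seq x n ∣ ℚ.< quot C 0<C (½ ℚ.* ε)
      cx  = proj₂ (cauchy x (quot C 0<C (½ ℚ.* ε)) (shrink C 0<C (½ ℚ.* ε) (halve ε 0<ε)))
      ≥K : ∀ {k} → (K ℕ.⊔ L) ℕ.⊔ (M ℕ.⊔ N) ℕ.≤ k → K ℕ.≤ k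
      ≥K p = ℕₚ.m⊔n≤o⇒m≤o K L (ℕₚ.m⊔n≤o⇒m≤o (K ℕ.⊔ L) (M ℕ.⊔ N) p)
      ≥L : ∀ {k} → (K ℕ.⊔ L) ℕ.⊔ (M ℕ.⊔ N) ℕ.≤ k → L ℕ.≤ k
      ≥L p = ℕₚ.m⊔n≤o⇒n≤o K L (ℕₚ.m⊔n≤o⇒m≤o (K ℕ.⊔ L) (M ℕ.⊔ N) p)
      ≥M : ∀ {k} → (K ℕ.⊔ L) ℕ.⊔ (M ℕ.⊔ N) ℕ.≤ k → M ℕ.≤ k
      ≥M p = ℕₚ.m⊔n≤o⇒m≤o M N (ℕₚ.m⊔n≤o⇒n≤o (K ℕ.⊔ L) (M ℕ.⊔ N) p)
      ≥N : ∀ {k} → (K ℕ.⊔ L) ℕ.⊔ (M ℕ.⊔ N) ℕ.≤ k → N ℕ.≤ k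
      ≥N p = ℕₚ.m⊔n≤o⇒n≤o M N (ℕₚ.m⊔n≤o⇒n≤o (K ℕ.⊔ L) (M ℕ.⊔ N) p)

fromℚ : ℚ → ℝ
fromℚ q = mkℝ (λ _ → q) (const-cauchy q)

infix  8 -ℝ_
infixl 7 _*ℝ_
infixl 6 _+ℝ_

_+ℝ_ : ℝ → ℝ → ℝ
x +ℝ y = mkℝ (λ n → seq x n ℚ.+ seq y n) (+-cauchy x y)

-ℝ_ : ℝ → ℝ
-ℝ x = mkℝ (λ n → ℚ.- seq x n) (neg-cauchy x)

_*ℝ_ : ℝ → ℝ → ℝ
x *ℝ y = mkℝ (λ n → seq x n ℚ.* seq y n) (*-cauchy x y)

⌊√_⌋ : ℕ → ℕ
⌊√ zero ⌋  = 0
⌊√ suc m ⌋ with suc ⌊√ m ⌋ ℕ.* suc ⌊√ m ⌋ ℕₚ.≤? suc m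
... | yes _ = suc ⌊√ m ⌋
... | no _  = ⌊√ m ⌋

⌊√⌋-lower : ∀ m → ⌊√ m ⌋ ℕ.* ⌊√ m ⌋ ℕ.≤ m
⌊√⌋-lower zero = ℕ.z≤n
⌊√⌋-lower (suc m) with suc ⌊√ m ⌋ ℕ.* suc ⌊√ m ⌋ ℕₚ.≤? suc m
... | yes p = p
... | no _  = ℕₚ.m≤n⇒m≤1+n (⌊√⌋-lower m)

⌊√⌋-upper : ∀ m → m ℕ.< suc ⌊√ m ⌋ ℕ.* suc ⌊√ m ⌋
⌊√⌋-upper zero = ℕ.s≤s ℕ.z≤n
⌊√⌋-upper (suc m) with suc ⌊√ m ⌋ ℕ.* suc ⌊√ m ⌋ ℕₚ.≤? suc m
... | yes _ = ℕₚ.<-≤-trans (ℕ.s≤s (⌊√⌋-upper m)) (grow (suc ⌊√ m ⌋))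
  where
  grow : ∀ j → suc (j ℕ.* j) ℕ.≤ suc j ℕ.* suc j
  grow j = subst (suc (j ℕ.* j) ℕ.≤_) (expand j) (ℕₚ.m≤m+n (suc (j ℕ.* j)) (j ℕ.+ j))
    where
    expand : ∀ j → suc (j ℕ.* j) ℕ.+ (j ℕ.+ j) ≡ suc j ℕ.* suc j
    expand = solve-∀
... | no ¬p = ℕₚ.≰⇒> ¬p

√-approx : ℕ → ℕ → ℚ
√-approx a k = + ⌊√ a ℕ.* (suc k ℕ.* suc k) ⌋ ℚ./ suc k

abstract
  √-cauchy : ∀ a → IsCauchy (√-approx a)
  √-cauchy a = close
    where
    root : ℕ → ℕ
    root k = ⌊√ a ℕ.* (suc k ℕ.* suc k) ⌋

    approx : ℕ → ℚ
    approx = √-approx a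

    square-cancel-< : ∀ p q → p ℕ.* p ℕ.< q ℕ.* q → p ℕ.< q
    square-cancel-< p q pp<qq with p ℕₚ.<? q
    ... | yes p<q = p<q
    ... | no p≮q  = contradiction pp<qq
      (ℕₚ.≤⇒≯ (ℕₚ.*-mono-≤ (ℕₚ.≮⇒≥ p≮q) (ℕₚ.≮⇒≥ p≮q)))

    cross : ∀ m n → root m ℕ.* suc n ℕ.< suc (root n) ℕ.* suc m
    cross m n = square-cancel-< (root m ℕ.* suc n) (suc (root n) ℕ.* suc m) (begin-strict
      (root m ℕ.* suc n) ℕ.* (root m ℕ.* suc n)             ≡⟨ interchange (root m) (suc n) ⟩
      (root m ℕ.* root m) ℕ.* (suc n ℕ.* suc n)             ≤⟨ ℕₚ.*-monoˡ-≤ (suc n ℕ.* suc n) (⌊√⌋-lower (a ℕ.* (suc m ℕ.* suc m))) ⟩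
      a ℕ.* (suc m ℕ.* suc m) ℕ.* (suc n ℕ.* suc n)         ≡⟨ swap a (suc m ℕ.* suc m) (suc n ℕ.* suc n) ⟩
      a ℕ.* (suc n ℕ.* suc n) ℕ.* (suc m ℕ.* suc m)         <⟨ ℕₚ.*-monoˡ-< (suc m ℕ.* suc m) (⌊√⌋-upper (a ℕ.* (suc n ℕ.* suc n))) ⟩
      (suc (root n) ℕ.* suc (root n)) ℕ.* (suc m ℕ.* suc m) ≡⟨ interchange (suc (root n)) (suc m) ⟨
      (suc (root n) ℕ.* suc m) ℕ.* (suc (root n) ℕ.* suc m) ∎)
      where
      open ℕₚ.≤-Reasoning
      interchange : ∀ p q → (p ℕ.* q) ℕ.* (p ℕ.* q) ≡ (p ℕ.* p) ℕ.* (q ℕ.* q)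
      interchange = solve-∀
      swap : ∀ p q r → p ℕ.* q ℕ.* r ≡ p ℕ.* r ℕ.* q
      swap = solve-∀

    /-≤ : ∀ p q m n → p ℕ.* suc n ℕ.≤ q ℕ.* suc m → + p ℚ./ suc m ℚ.≤ + q ℚ./ suc n
    /-≤ p q m n le = ℚₚ.toℚᵘ-cancel-≤
      (ℚᵘₚ.≤-respˡ-≃ (ℚᵘₚ.≃-sym (ℚₚ.toℚᵘ-fromℚᵘ (ℚᵘ.mkℚᵘ (+ p) m)))
      (ℚᵘₚ.≤-respʳ-≃ (ℚᵘₚ.≃-sym (ℚₚ.toℚᵘ-fromℚᵘ (ℚᵘ.mkℚᵘ (+ q) n)))
        (ℚᵘ.*≤* (subst₂ ℤ._≤_ (ℤₚ.pos-* p (suc n)) (ℤₚ.pos-* q (suc m)) (ℤ.+≤+ le)))))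

    /-suc : ∀ p n → + suc p ℚ./ suc n ≡ + p ℚ./ suc n ℚ.+ + 1 ℚ./ suc n
    /-suc p n = ℚₚ.toℚᵘ-injective
      (ℚᵘₚ.≃-trans (ℚₚ.toℚᵘ-fromℚᵘ (ℚᵘ.mkℚᵘ (+ suc p) n))
      (ℚᵘₚ.≃-trans (ℚᵘ.*≡* add)
      (ℚᵘₚ.≃-trans (ℚᵘₚ.+-cong (ℚᵘₚ.≃-sym (ℚₚ.toℚᵘ-fromℚᵘ (ℚᵘ.mkℚᵘ (+ p) n)))
                               (ℚᵘₚ.≃-sym (ℚₚ.toℚᵘ-fromℚᵘ (ℚᵘ.mkℚᵘ (+ 1) n))))
                   (ℚᵘₚ.≃-sym (ℚₚ.toℚᵘ-homo-+ (+ p ℚ./ suc n) (+ 1 ℚ./ suc n))))))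
      where
      add : + suc p ℤ.* + (suc n ℕ.* suc n) ≡ (+ p ℤ.* + suc n ℤ.+ + 1 ℤ.* + suc n) ℤ.* + suc n
      add = trans (cong (+ suc p ℤ.*_) (ℤₚ.pos-* (suc n) (suc n)))
           (trans (sym (ℤₚ.*-assoc (+ suc p) (+ suc n) (+ suc n)))
                  (cong (ℤ._* + suc n)
                    (trans (cong (ℤ._* + suc n) (cong +_ (ℕₚ.+-comm 1 p)))
                           (ℤₚ.*-distribʳ-+ (+ suc n) (+ p) (+ 1)))))

    archimedean : ∀ ε → 0ℚ ℚ.< ε → ∃ λ N → + 1 ℚ./ suc N ℚ.< ε
    archimedean ε@(mkℚ (+ suc p) d _) _ = suc d , ℚₚ.toℚᵘ-cancel-<
      (ℚᵘₚ.<-respˡ-≃ (ℚᵘₚ.≃-sym (ℚₚ.toℚᵘ-fromℚᵘ (ℚᵘ.mkℚᵘ (+ 1) (suc d))))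
        (ℚᵘ.*<* (subst₂ ℤ._<_ (ℤₚ.pos-* 1 (suc d)) (ℤₚ.pos-* (suc p) (suc (suc d)))
          (ℤ.+<+ (ℕₚ.<-≤-trans (subst (ℕ._< suc (suc d)) (sym (ℕₚ.*-identityˡ (suc d))) (ℕₚ.n<1+n (suc d)))
                               (ℕₚ.m≤m+n (suc (suc d)) (p ℕ.* suc (suc d))))))))
    archimedean (mkℚ (+ zero) d _) (ℚ.*<* (ℤ.+<+ ()))
    archimedean (mkℚ ℤ.-[1+ p ] d _) (ℚ.*<* ())

    close : ∀ ε → 0ℚ ℚ.< ε → ∃ λ N → ∀ m n → N ℕ.≤ m → N ℕ.≤ n →
            ℚ.∣ approx m ℚ.- approx n ∣ ℚ.< ε
    close ε 0<ε with archimedean ε 0<ε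
    ... | N , 1/N<ε = N , λ m n N≤m N≤n → ℚₚ.≤-<-trans (abs m n N≤m N≤n) 1/N<ε
      where
      open ℚₚ.≤-Reasoning
      open +-*-Solver
      oneSided : ∀ m n → N ℕ.≤ n → approx m ℚ.- approx n ℚ.≤ + 1 ℚ./ suc N
      oneSided m n N≤n = begin
        approx m ℚ.- approx n                             ≤⟨ ℚₚ.+-monoˡ-≤ (ℚ.- approx n) (/-≤ (root m) (suc (root n)) m n (ℕₚ.<⇒≤ (cross m n))) ⟩
        + suc (root n) ℚ./ suc n ℚ.- approx n             ≡⟨ cong (ℚ._- approx n) (/-suc (root n) n) ⟩
        approx n ℚ.+ + 1 ℚ./ suc n ℚ.- approx n           ≡⟨ solve 2 (λ p q → p :+ q :- p := q) refl (approx n) (+ 1 ℚ./ suc n) ⟩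
        + 1 ℚ./ suc n                                     ≤⟨ /-≤ 1 1 n N (ℕₚ.*-monoʳ-≤ 1 (ℕ.s≤s N≤n)) ⟩
        + 1 ℚ./ suc N                                     ∎
      negate : ∀ p q → ℚ.- (p ℚ.- q) ≡ q ℚ.- p
      negate = solve 2 (λ p q → :- (p :- q) := q :- p) refl
      abs : ∀ m n → N ℕ.≤ m → N ℕ.≤ n → ℚ.∣ approx m ℚ.- approx n ∣ ℚ.≤ + 1 ℚ./ suc N
      abs m n N≤m N≤n = cases (ℚₚ.∣p∣≡p∨∣p∣≡-p (approx m ℚ.- approx n))
        where
        cases : ℚ.∣ approx m ℚ.- approx n ∣ ≡ approx m ℚ.- approx n ⊎
                ℚ.∣ approx m ℚ.- approx n ∣ ≡ ℚ.- (approx m ℚ.- approx n) →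
                ℚ.∣ approx m ℚ.- approx n ∣ ℚ.≤ + 1 ℚ./ suc N
        cases (inj₁ eq) = subst (ℚ._≤ + 1 ℚ./ suc N) (sym eq) (oneSided m n N≤n)
        cases (inj₂ eq) = subst (ℚ._≤ + 1 ℚ./ suc N) (sym (trans eq (negate (approx m) (approx n)))) (oneSided n m N≤m)

-- The k-th approximation of √a is ⌊(k+1)√a⌋ / (k+1).
√_ : ℕ → ℝ
√ a = mkℝ (√-approx a) (√-cauchy a)


record ℂ : Set where
  constructor mkℂ
  field
    re im : ℝ

open ℂ public

infix  4 _≈_
infix  8 -_
infixl 7 _*_
infixl 6 _+_

_≈_ : ℂ → ℂ → Set
z ≈ w = (re z ≈ℝ re w) × (im z ≈ℝ im w)

_+_ : ℂ → ℂ → ℂ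
z + w = mkℂ (re z +ℝ re w) (im z +ℝ im w)

-_ : ℂ → ℂ
- z = mkℂ (-ℝ re z) (-ℝ im z)

_*_ : ℂ → ℂ → ℂ
z * w = mkℂ (re z *ℝ re w +ℝ -ℝ (im z *ℝ im w)) (re z *ℝ im w +ℝ im z *ℝ re w)

conj : ℂ → ℂ
conj z = mkℂ (re z) (-ℝ im z)

real : ℝ → ℂ
real x = mkℂ x (fromℚ 0ℚ)

rational : ℚ → ℂ
rational q = real (fromℚ q)

integer : ℤ → ℂ
integer k = rational (k ℚ./ 1)

0ᶜ 1ᶜ i ω ω̄ : ℂ
0ᶜ = integer (+ 0)
1ᶜ = integer (+ 1)
i  = mkℂ (fromℚ 0ℚ) (fromℚ 1ℚ)
ω  = rational ½ * (- 1ᶜ + real (√ 3) * i)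
ω̄  = conj ω

-- 1/0 is set to 0; it is only used at the nonzero number |Φ|.
reciprocal : ℕ → ℂ
reciprocal zero    = 0ᶜ
reciprocal (suc k) = rational (+ 1 ℚ./ suc k)

∑ : {A : Set} → List A → (A → ℂ) → ℂ
∑ as f = List.foldr (λ a s → f a + s) 0ᶜ as

Matrix : Set → Set
Matrix X = X → X → ℂ

-- `elems` is meant to list every element of X exactly once.
module _ {X : Set} (elems : List X) where

  infix 4 _≋_

  _≋_ : Matrix X → Matrix X → Set
  M ≋ N = ∀ x y → M x y ≈ N x y

  𝟎 : Matrix X
  𝟎 _ _ = 0ᶜ

  J/∣X∣ : Matrix X
  J/∣X∣ _ _ = reciprocal (length elems)

  infixl 6 _⊞_
  infixl 7 _⊡_

  _⊞_ : Matrix X → Matrix X → Matrix X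
  (M ⊞ N) x y = M x y + N x y

  _⊡_ : Matrix X → Matrix X → Matrix X
  (M ⊡ N) x y = ∑ elems λ z → M x z * N z y

  linComb : ∀ {m} → (Fin m → ℂ) → (Fin m → Matrix X) → Matrix X
  linComb {m} c M x y = ∑ (allFin m) λ j → c j * M j x y

  record IsPrimitiveIdempotent (𝒜 : Matrix X → Set) (E : Matrix X) : Set where
    field
      member         : 𝒜 E
      idempotent     : E ⊡ E ≋ E
      nonzero        : ¬ (E ≋ 𝟎)
      indecomposable : ∀ F G → 𝒜 F → 𝒜 G → F ⊡ F ≋ F → G ⊡ G ≋ G →
                       F ⊡ G ≋ 𝟎 → G ⊡ F ≋ 𝟎 → E ≋ F ⊞ G → F ≋ 𝟎 ⊎ G ≋ 𝟎

  module _ {d : ℕ} {R : Fin (suc d) → X → X → Set} (R? : ∀ j x y → Dec (R j x y)) where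

    adjacency : Fin (suc d) → Matrix X
    adjacency j x y = if does (R? j x y) then 1ᶜ else 0ᶜ

    BoseMesner : Matrix X → Set
    BoseMesner M = ∃ λ (c : Fin (suc d) → ℂ) → M ≋ linComb c adjacency

    -- P i j is p_j(i): rows are indexed by idempotents, columns by relations.
    record IsCharacterTable (P : Fin (suc d) → Fin (suc d) → ℂ) : Set where
      field
        E          : Fin (suc d) → Matrix X
        primitives : ∀ k → IsPrimitiveIdempotent BoseMesner (E k)
        distinct   : ∀ k l → E k ≋ E l → k ≡ l
        exhaustive : ∀ F → IsPrimitiveIdempotent BoseMesner F → ∃ λ k → F ≋ E k
        E₀         : E 0F ≋ J/∣X∣
        expansion  : ∀ j → adjacency j ≋ linComb (λ k → P k j) E

-- 𝔽₂[ζ] with ζ² = ζ + 1.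
data 𝔽₄ : Set where
  𝟘 𝟙 ζ ζ² : 𝔽₄

infixl 6 _⊕_
infixl 7 _⊗_
infixr 8 _↑_

_⊕_ : 𝔽₄ → 𝔽₄ → 𝔽₄
𝟘  ⊕ b  = b
𝟙  ⊕ 𝟘  = 𝟙
𝟙  ⊕ 𝟙  = 𝟘
𝟙  ⊕ ζ  = ζ²
𝟙  ⊕ ζ² = ζ
ζ  ⊕ 𝟘  = ζ
ζ  ⊕ 𝟙  = ζ²
ζ  ⊕ ζ  = 𝟘
ζ  ⊕ ζ² = 𝟙
ζ² ⊕ 𝟘  = ζ²
ζ² ⊕ 𝟙  = ζ
ζ² ⊕ ζ  = 𝟙
ζ² ⊕ ζ² = 𝟘

_⊗_ : 𝔽₄ → 𝔽₄ → 𝔽₄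
𝟘  ⊗ b  = 𝟘
𝟙  ⊗ b  = b
ζ  ⊗ 𝟘  = 𝟘
ζ  ⊗ 𝟙  = ζ
ζ  ⊗ ζ  = ζ²
ζ  ⊗ ζ² = 𝟙
ζ² ⊗ 𝟘  = 𝟘
ζ² ⊗ 𝟙  = ζ²
ζ² ⊗ ζ  = 𝟙
ζ² ⊗ ζ² = ζ

_↑_ : 𝔽₄ → ℕ → 𝔽₄
a ↑ zero  = 𝟙
a ↑ suc k = a ⊗ a ↑ k

IsPrimitive : 𝔽₄ → Set
IsPrimitive α = ∀ b → ¬ (b ≡ 𝟘) → ∃ λ k → b ≡ α ↑ k

𝔽₄-elements : List 𝔽₄
𝔽₄-elements = 𝟘 List.∷ 𝟙 List.∷ ζ List.∷ ζ² List.∷ List.[]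

_≟_ : DecidableEquality 𝔽₄
𝟘  ≟ 𝟘  = yes refl
𝟘  ≟ 𝟙  = no λ ()
𝟘  ≟ ζ  = no λ ()
𝟘  ≟ ζ² = no λ ()
𝟙  ≟ 𝟘  = no λ ()
𝟙  ≟ 𝟙  = yes refl
𝟙  ≟ ζ  = no λ ()
𝟙  ≟ ζ² = no λ ()
ζ  ≟ 𝟘  = no λ ()
ζ  ≟ 𝟙  = no λ ()
ζ  ≟ ζ  = yes refl
ζ  ≟ ζ² = no λ ()
ζ² ≟ 𝟘  = no λ ()
ζ² ≟ 𝟙  = no λ ()
ζ² ≟ ζ  = no λ ()
ζ² ≟ ζ² = yes refl

𝔽₄^ : ℕ → Set
𝔽₄^ n = Vec 𝔽₄ n

0⃗ : ∀ {n} → 𝔽₄^ n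
0⃗ = replicate _ 𝟘

infixl 6 _⊹_
infixr 7 _•_

_⊹_ : ∀ {n} → 𝔽₄^ n → 𝔽₄^ n → 𝔽₄^ n
_⊹_ = zipWith _⊕_

_•_ : ∀ {n} → 𝔽₄ → 𝔽₄^ n → 𝔽₄^ n
c • x = Vec.map (c ⊗_) x

⟨_,_⟩ : ∀ {n} → 𝔽₄^ n → 𝔽₄^ n → 𝔽₄
⟨ x , y ⟩ = foldr′ _⊕_ 𝟘 (zipWith (λ a b → a ⊗ b ↑ 2) x y)

_≟ᵛ_ : ∀ {n} → DecidableEquality (𝔽₄^ n)
_≟ᵛ_ = Vecₚ.≡-dec _≟_

record Φ (n : ℕ) : Set where
  constructor mkΦ
  field
    vec        : 𝔽₄^ n
    .nonzero   : ¬ (vec ≡ 0⃗)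
    .isotropic : ⟨ vec , vec ⟩ ≡ 𝟘

open Φ public using (vec)

vectors : ∀ n → List (𝔽₄^ n)
vectors zero    = [] List.∷ List.[]
vectors (suc n) = cartesianProductWith _∷_ 𝔽₄-elements (vectors n)

toΦ : ∀ {n} → 𝔽₄^ n → Maybe (Φ n)
toΦ x with x ≟ᵛ 0⃗ | ⟨ x , x ⟩ ≟ 𝟘
... | no x≢0 | yes xx≡0 = just (mkΦ x x≢0 xx≡0)
... | _      | _        = nothing

Φ-elements : ∀ n → List (Φ n)
Φ-elements n = mapMaybe toΦ (vectors n)

-- A matrix is the vector of its rows.
𝔽₄^[_×_] : ℕ → ℕ → Set
𝔽₄^[ m × n ] = Vec (𝔽₄^ n) m

infixl 7 _·_

_·_ : ∀ {m n} → 𝔽₄^ m → 𝔽₄^[ m × n ] → 𝔽₄^ n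
x · U = foldr′ _⊹_ 0⃗ (zipWith _•_ x U)

δ : ∀ {n} → Fin n → Fin n → 𝔽₄
δ k l = if does (k Fin.≟ l) then 𝟙 else 𝟘

-- U U* = I; the (k, l) entry of U U* is ∑ⱼ Uₖⱼ Uₗⱼ².
InGU : ∀ {n} → 𝔽₄^[ n × n ] → Set
InGU U = ∀ k l → ⟨ lookup U k , lookup U l ⟩ ≡ δ k l

-- (x′ , y′) lies in the orbital of (x , y).
InOrbital : ∀ {n} → Φ n → Φ n → Φ n → Φ n → Set
InOrbital {n} x y x′ y′ = ∃ λ (U : 𝔽₄^[ n × n ]) →
  InGU U × vec x · U ≡ vec x′ × vec y · U ≡ vec y′

record AreTheOrbitals {n m : ℕ} (R : Fin m → Φ n → Φ n → Set) : Set where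
  field
    partition : ∀ x y → ∃! _≡_ λ l → R l x y
    orbital   : ∀ l → ∃₂ λ x y → ∀ x′ y′ → R l x′ y′ ⇔ InOrbital x y x′ y′

module _ {n : ℕ} (α : 𝔽₄) where

  ℛ : Fin 7 → Φ n → Φ n → Set
  ℛ 0F x y = vec y ≡ α ↑ 0 • vec x
  ℛ 1F x y = vec y ≡ α ↑ 1 • vec x
  ℛ 2F x y = vec y ≡ α ↑ 2 • vec x
  ℛ 3F x y = ⟨ vec x , vec y ⟩ ≡ α ↑ 3
  ℛ 4F x y = ⟨ vec x , vec y ⟩ ≡ α ↑ 4
  ℛ 5F x y = ⟨ vec x , vec y ⟩ ≡ α ↑ 5
  ℛ 6F x y = ⟨ vec x , vec y ⟩ ≡ 𝟘 × ¬ (∃ λ c → vec y ≡ c • vec x)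

  ℛ? : ∀ l x y → Dec (ℛ l x y)
  ℛ? 0F x y = vec y ≟ᵛ (α ↑ 0 • vec x)
  ℛ? 1F x y = vec y ≟ᵛ (α ↑ 1 • vec x)
  ℛ? 2F x y = vec y ≟ᵛ (α ↑ 2 • vec x)
  ℛ? 3F x y = ⟨ vec x , vec y ⟩ ≟ (α ↑ 3)
  ℛ? 4F x y = ⟨ vec x , vec y ⟩ ≟ (α ↑ 4)
  ℛ? 5F x y = ⟨ vec x , vec y ⟩ ≟ (α ↑ 5)
  ℛ? 6F x y = (⟨ vec x , vec y ⟩ ≟ 𝟘) ×-dec ¬? (any? λ c → vec y ≟ᵛ (c • vec x))
    where
    any? : {Q : 𝔽₄ → Set} → (∀ c → Dec (Q c)) → Dec (∃ Q)
    any? {Q} Q? = Dec.map′ (λ { (inj₁ q) → 𝟘 , q ; (inj₂ (inj₁ q)) → 𝟙 , q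
                              ; (inj₂ (inj₂ (inj₁ q))) → ζ , q ; (inj₂ (inj₂ (inj₂ q))) → ζ² , q })
                           (λ { (𝟘 , q) → inj₁ q ; (𝟙 , q) → inj₂ (inj₁ q)
                              ; (ζ , q) → inj₂ (inj₂ (inj₁ q)) ; (ζ² , q) → inj₂ (inj₂ (inj₂ q)) })
                           (Q? 𝟘 ⊎-dec (Q? 𝟙 ⊎-dec (Q? ζ ⊎-dec Q? ζ²)))

-2^_ : ℕ → ℤ
-2^ k = (ℤ.- + 2) ℤ.^ k

-- The exponents n ∸ 1, n ∸ 2, n ∸ 3 and 2n ∸ 3 are true differences for n ≥ 4.
table : ℕ → Fin 7 → Fin 7 → ℂ
table n k j = lookup (lookup rows k) j
  where
  a b c q : ℤ
  a = -2^ (n ℕ.∸ 1)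
  b = -2^ (n ℕ.∸ 2)
  c = -2^ (n ℕ.∸ 3)
  q = + (2 ℕ.^ (2 ℕ.* n ℕ.∸ 3))

  z : ℤ → ℂ
  z = integer

  rows : Vec (Vec ℂ 7) 7
  rows =
    (1ᶜ ∷ 1ᶜ ∷ 1ᶜ ∷ z q           ∷ z q               ∷ z q               ∷ z (q ℤ.- a ℤ.- + 4)         ∷ []) ∷
    (1ᶜ ∷ ω  ∷ ω̄  ∷ z (ℤ.- a)     ∷ z (ℤ.- a) * ω̄     ∷ z (ℤ.- a) * ω     ∷ 0ᶜ                          ∷ []) ∷
    (1ᶜ ∷ ω̄  ∷ ω  ∷ z (ℤ.- a)     ∷ z (ℤ.- a) * ω     ∷ z (ℤ.- a) * ω̄     ∷ 0ᶜ                          ∷ []) ∷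
    (1ᶜ ∷ 1ᶜ ∷ 1ᶜ ∷ z (ℤ.- b)     ∷ z (ℤ.- b)         ∷ z (ℤ.- b)         ∷ z (+ 3 ℤ.* b ℤ.- + 3)       ∷ []) ∷
    (1ᶜ ∷ ω  ∷ ω̄  ∷ z (ℤ.- b)     ∷ z (ℤ.- b) * ω̄     ∷ z (ℤ.- b) * ω     ∷ 0ᶜ                          ∷ []) ∷
    (1ᶜ ∷ ω̄  ∷ ω  ∷ z (ℤ.- b)     ∷ z (ℤ.- b) * ω     ∷ z (ℤ.- b) * ω̄     ∷ 0ᶜ                          ∷ []) ∷
    (1ᶜ ∷ 1ᶜ ∷ 1ᶜ ∷ z (ℤ.- c)     ∷ z (ℤ.- c)         ∷ z (ℤ.- c)         ∷ z (+ 3 ℤ.* c ℤ.- + 3)       ∷ []) ∷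
    []

{-# OPTIONS --safe #-}

-- Let ψ = (-1)^Tr be the additive character of 𝔽₄, F the matrix (ψ⟨x,y⟩) on Φ, T the matrix of the scalar α and J the
-- all-one matrix.  Completing the square, ∑ ψ(ζ⟨v,v⟩ + ⟨v,w⟩) over all v is (-2)ⁿ ψ(ζ⟨w,w⟩), and ½(1 + ψ(ζ⟨v,v⟩)) is
-- the indicator of isotropy; hence, with a = (-2)ⁿ⁻¹,
--   F² = 2a² I - a F - J,   J F = -(a + 1) J,   |Φ| = 2a² - a - 1,   T³ = I,   T F = F T,   T J = J.
-- So I, T, T², F, TF, T²F, J span a commutative algebra in which T has eigenvalues 1, ω, ω̄ and, away from J, F has
-- eigenvalues a and -2a; this gives seven idempotents.  The adjacency matrices are combinations of the same basis,
-- e.g. A₃ = ¼(J + F - TF - T²F), and the character table lists their eigenvalues.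
--
-- The relations are orbitals because reflections x ↦ x + c⟨x,v⟩v map e₁ to every unit vector, hence orthonormal pairs
-- to orthonormal pairs, hence hyperbolic pairs to hyperbolic pairs; the other pairs are extended by hyperbolic partners.
module Submission where

import Algebra.Morphism.Construct.Identity as Identity
open import Algebra.Bundles using (CommutativeRing; RawRing)
open import Algebra.Morphism.Structures using (IsRingHomomorphism)
import Algebra.Solver.Ring as Solver
open import Algebra.Solver.Ring.AlmostCommutativeRing using (_-Raw-AlmostCommutative⟶_; Induced-equivalence; fromCommutativeRing)
open import Algebra.Structures using (IsCommutativeRing)
open import Data.Bool.Base using (if_then_else_)
open import Data.Fin.Base using (Fin; zero; suc)
open import Data.Fin.Patterns using (0F; 1F; 2F; 3F; 4F; 5F; 6F)
import Data.Fin.Properties as Fin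
open import Data.Integer.Base as ℤ using (ℤ; +_)
import Data.Integer.Properties as ℤₚ
open import Data.Integer.Tactic.RingSolver using () renaming (solve-∀ to ℤ-solve-∀)
open import Data.List.Base as List using (List; []; _∷_; length; allFin)
open import Data.Maybe.Base using (Maybe; just; nothing; maybe)
open import Data.Nat.Base as ℕ using (ℕ; zero; suc; _≤_)
import Data.Nat.Coprimality as Coprimality
import Data.Nat.Properties as ℕₚ
open import Data.Nat.Tactic.RingSolver using (solve-∀)
open import Data.Product using (∃; ∃₂; _×_; _,_; proj₁; proj₂)
import Data.Product.Properties as Product
open import Data.Rational.Base as ℚ using (ℚ; mkℚ; 0ℚ; 1ℚ; ½)
import Data.Rational.Properties as ℚₚ
import Data.Rational.Unnormalised.Base as ℚᵘ
import Data.Rational.Unnormalised.Properties as ℚᵘₚ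
open import Data.Sum.Base using (_⊎_; inj₁; inj₂)
open import Data.Vec.Base as Vec using (Vec; []; _∷_; lookup; tabulate)
import Data.Vec.Properties as Vecₚ
open import Function.Base using (_∘_)
open import Function.Bundles using (_⇔_; mk⇔; module Equivalence)
open import Level using (0ℓ)
open import Relation.Binary.Definitions using (DecidableEquality; WeaklyDecidable)
open import Relation.Binary.PropositionalEquality using (_≡_; _≢_; refl; sym; trans; cong; cong₂; subst; subst₂; module ≡-Reasoning)
import Relation.Binary.Reasoning.Setoid as SetoidReasoning
open import Relation.Nullary using (¬_; Dec; yes; no; does; contradiction; ¬?; _×-dec_; _→-dec_; from-yes; recompute)
open import Relation.Nullary.Decidable as Dec using (dec-true; dec-false; does-⇔)
open import Defs hiding (_+_; _*_; -_; _≈_; ∑; Matrix; _≋_; _⊡_; linComb)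
import Defs as ℂ

-- Field with four elements

-- Two obstacles shape the proof. Equality in `ℂ` compares limits and cannot be decided, while
-- primitivity and exhaustiveness ask which coefficients of an idempotent vanish. Such coefficients
-- satisfy z² = z, and for these numbers 0 and 1 can be told apart (`ℂ-idempotent`). Likewise each
-- idempotent E is shown nonzero in the strong form that cE = 0 forces c = 0. The constants,
-- however, all lie in ℚ(ω), where equality is decidable. So the algebra is done over an arbitrary
-- commutative ring receiving ℚ(ω), finite identities are checked by evaluation, and `ℂ` is
-- substituted at the end. The eigenvalues a and -2a of F are the roots of X² + aX - 2a². The
-- idempotent for the pair (s, f), with f′ the other root, is a multiple of (I + s²T + sT²)(F - f′)
-- minus its component along J, which vanishes unless s = 1; J/|Φ| is the seventh. The bound n ≥ 4
-- leaves room for two orthogonal hyperbolic planes, so that independent orthogonal isotropic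
-- vectors exist and can be moved separately.

∀? : {P : 𝔽₄ → Set} → (∀ a → Dec (P a)) → Dec (∀ a → P a)
∀? P? = Dec.map′ (λ { (p , q , r , s) → λ { 𝟘 → p ; 𝟙 → q ; ζ → r ; ζ² → s } })
                 (λ f → f 𝟘 , f 𝟙 , f ζ , f ζ²)
                 (P? 𝟘 ×-dec (P? 𝟙 ×-dec (P? ζ ×-dec P? ζ²)))

-- Quantification over 𝔽₄ being decidable, this and every later polynomial identity over the field
-- is proved by evaluating all cases.
⊕-assoc : ∀ a b c → (a ⊕ b) ⊕ c ≡ a ⊕ (b ⊕ c)
⊕-assoc = from-yes (∀? λ a → ∀? λ b → ∀? λ c → ((a ⊕ b) ⊕ c) ≟ (a ⊕ (b ⊕ c)))

⊕-comm : ∀ a b → a ⊕ b ≡ b ⊕ a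
⊕-comm = from-yes (∀? λ a → ∀? λ b → (a ⊕ b) ≟ (b ⊕ a))

⊕-identityʳ : ∀ a → a ⊕ 𝟘 ≡ a
⊕-identityʳ = from-yes (∀? λ a → (a ⊕ 𝟘) ≟ a)

⊕-self : ∀ a → a ⊕ a ≡ 𝟘
⊕-self = from-yes (∀? λ a → (a ⊕ a) ≟ 𝟘)

⊕-interchange : ∀ a b c d → (a ⊕ b) ⊕ (c ⊕ d) ≡ (a ⊕ c) ⊕ (b ⊕ d)
⊕-interchange = from-yes (∀? λ a → ∀? λ b → ∀? λ c → ∀? λ d → ((a ⊕ b) ⊕ (c ⊕ d)) ≟ ((a ⊕ c) ⊕ (b ⊕ d)))

⊗-assoc : ∀ a b c → (a ⊗ b) ⊗ c ≡ a ⊗ (b ⊗ c)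
⊗-assoc = from-yes (∀? λ a → ∀? λ b → ∀? λ c → ((a ⊗ b) ⊗ c) ≟ (a ⊗ (b ⊗ c)))

⊗-comm : ∀ a b → a ⊗ b ≡ b ⊗ a
⊗-comm = from-yes (∀? λ a → ∀? λ b → (a ⊗ b) ≟ (b ⊗ a))

⊗-zeroʳ : ∀ a → a ⊗ 𝟘 ≡ 𝟘
⊗-zeroʳ = from-yes (∀? λ a → (a ⊗ 𝟘) ≟ 𝟘)

⊗-distribˡ : ∀ a b c → a ⊗ (b ⊕ c) ≡ (a ⊗ b) ⊕ (a ⊗ c)
⊗-distribˡ = from-yes (∀? λ a → ∀? λ b → ∀? λ c → (a ⊗ (b ⊕ c)) ≟ ((a ⊗ b) ⊕ (a ⊗ c)))

⊗-distribʳ : ∀ a b c → (b ⊕ c) ⊗ a ≡ (b ⊗ a) ⊕ (c ⊗ a)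
⊗-distribʳ = from-yes (∀? λ a → ∀? λ b → ∀? λ c → ((b ⊕ c) ⊗ a) ≟ ((b ⊗ a) ⊕ (c ⊗ a)))

↑2-⊕ : ∀ a b → (a ⊕ b) ↑ 2 ≡ (a ↑ 2) ⊕ (b ↑ 2)
↑2-⊕ = from-yes (∀? λ a → ∀? λ b → ((a ⊕ b) ↑ 2) ≟ ((a ↑ 2) ⊕ (b ↑ 2)))

↑2-⊗ : ∀ a b → (a ⊗ b) ↑ 2 ≡ (a ↑ 2) ⊗ (b ↑ 2)
↑2-⊗ = from-yes (∀? λ a → ∀? λ b → ((a ⊗ b) ↑ 2) ≟ ((a ↑ 2) ⊗ (b ↑ 2)))

↑2-involutive : ∀ a → (a ↑ 2) ↑ 2 ≡ a
↑2-involutive = from-yes (∀? λ a → ((a ↑ 2) ↑ 2) ≟ a)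

-- The nonzero elements form a group of order three. Squaring is therefore inversion there, besides
-- being the conjugation of 𝔽₄ over 𝔽₂; both roles recur throughout.
↑2-inverse : ∀ a → a ≢ 𝟘 → a ↑ 2 ⊗ a ≡ 𝟙
↑2-inverse = from-yes (∀? λ a → ¬? (a ≟ 𝟘) →-dec ((a ↑ 2 ⊗ a) ≟ 𝟙))

-- No power of 𝟘 or of 𝟙 equals ζ, which refutes these two cases.
primitive-cases : ∀ α → IsPrimitive α → α ≡ ζ ⊎ α ≡ ζ²
primitive-cases ζ  _ = inj₁ refl
primitive-cases ζ² _ = inj₂ refl
primitive-cases 𝟙 prim with prim ζ (λ ())
... | k , eq with trans eq (1↑ k)
  where
  1↑ : ∀ k → 𝟙 ↑ k ≡ 𝟙
  1↑ zero    = refl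
  1↑ (suc k) = 1↑ k
... | ()
primitive-cases 𝟘 prim with prim ζ (λ ())
... | zero  , ()
... | suc k , ()

-- Hermitian space

∷-cong : ∀ {A : Set} {n} {a b : A} {x y : Vec A n} → a ≡ b → x ≡ y → a ∷ x ≡ b ∷ y
∷-cong = cong₂ _∷_

⊹-assoc : ∀ {n} (x y z : 𝔽₄^ n) → (x ⊹ y) ⊹ z ≡ x ⊹ (y ⊹ z)
⊹-assoc = Vecₚ.zipWith-assoc ⊕-assoc

⊹-identityˡ : ∀ {n} (x : 𝔽₄^ n) → 0⃗ ⊹ x ≡ x
⊹-identityˡ = Vecₚ.zipWith-identityˡ λ _ → refl

⊹-identityʳ : ∀ {n} (x : 𝔽₄^ n) → x ⊹ 0⃗ ≡ x
⊹-identityʳ = Vecₚ.zipWith-identityʳ ⊕-identityʳ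

⊹-self : ∀ {n} (x : 𝔽₄^ n) → x ⊹ x ≡ 0⃗
⊹-self []      = refl
⊹-self (a ∷ x) = ∷-cong (⊕-self a) (⊹-self x)

⊹-cancel : ∀ {n} (x y : 𝔽₄^ n) → x ⊹ (x ⊹ y) ≡ y
⊹-cancel x y = trans (sym (⊹-assoc x x y)) (trans (cong (_⊹ y) (⊹-self x)) (⊹-identityˡ y))

⊹≡0⇒≡ : ∀ {n} (x y : 𝔽₄^ n) → x ⊹ y ≡ 0⃗ → x ≡ y
⊹≡0⇒≡ x y eq = trans (sym (⊹-identityʳ x)) (trans (cong (x ⊹_) (sym eq)) (⊹-cancel x y))

⊹-interchange : ∀ {n} (x y z w : 𝔽₄^ n) → (x ⊹ y) ⊹ (z ⊹ w) ≡ (x ⊹ z) ⊹ (y ⊹ w)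
⊹-interchange [] [] [] [] = refl
⊹-interchange (a ∷ x) (b ∷ y) (c ∷ z) (d ∷ w) = ∷-cong (⊕-interchange a b c d) (⊹-interchange x y z w)

•-distribˡ : ∀ {n} c (x y : 𝔽₄^ n) → c • (x ⊹ y) ≡ (c • x) ⊹ (c • y)
•-distribˡ c [] []           = refl
•-distribˡ c (a ∷ x) (b ∷ y) = ∷-cong (⊗-distribˡ c a b) (•-distribˡ c x y)

•-distribʳ : ∀ {n} (x : 𝔽₄^ n) c d → (c ⊕ d) • x ≡ (c • x) ⊹ (d • x)
•-distribʳ [] c d      = refl
•-distribʳ (a ∷ x) c d = ∷-cong (⊗-distribʳ a c d) (•-distribʳ x c d)

•-assoc : ∀ {n} c d (x : 𝔽₄^ n) → (c ⊗ d) • x ≡ c • (d • x)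
•-assoc c d []      = refl
•-assoc c d (a ∷ x) = ∷-cong (⊗-assoc c d a) (•-assoc c d x)

•-identity : ∀ {n} (x : 𝔽₄^ n) → 𝟙 • x ≡ x
•-identity = Vecₚ.map-id

•-zeroˡ : ∀ {n} (x : 𝔽₄^ n) → 𝟘 • x ≡ 0⃗
•-zeroˡ []      = refl
•-zeroˡ (a ∷ x) = ∷-cong refl (•-zeroˡ x)

•-zeroʳ : ∀ {n} c → c • 0⃗ {n} ≡ 0⃗
•-zeroʳ {zero}  c = refl
•-zeroʳ {suc n} c = ∷-cong (⊗-zeroʳ c) (•-zeroʳ c)

⟨⟩-⊹ˡ : ∀ {n} (x y z : 𝔽₄^ n) → ⟨ x ⊹ y , z ⟩ ≡ ⟨ x , z ⟩ ⊕ ⟨ y , z ⟩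
⟨⟩-⊹ˡ [] [] [] = refl
⟨⟩-⊹ˡ (a ∷ x) (b ∷ y) (c ∷ z) =
  trans (cong₂ _⊕_ (⊗-distribʳ (c ↑ 2) a b) (⟨⟩-⊹ˡ x y z))
        (⊕-interchange (a ⊗ c ↑ 2) (b ⊗ c ↑ 2) ⟨ x , z ⟩ ⟨ y , z ⟩)

⟨⟩-•ˡ : ∀ {n} c (x y : 𝔽₄^ n) → ⟨ c • x , y ⟩ ≡ c ⊗ ⟨ x , y ⟩
⟨⟩-•ˡ c [] [] = sym (⊗-zeroʳ c)
⟨⟩-•ˡ c (a ∷ x) (b ∷ y) =
  trans (cong₂ _⊕_ (⊗-assoc c a (b ↑ 2)) (⟨⟩-•ˡ c x y)) (sym (⊗-distribˡ c (a ⊗ b ↑ 2) ⟨ x , y ⟩))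

-- Hermitian symmetry, squaring being the field conjugation; it transports linearity in the first
-- argument to semilinearity in the second.
⟨⟩-swap : ∀ {n} (x y : 𝔽₄^ n) → ⟨ y , x ⟩ ≡ ⟨ x , y ⟩ ↑ 2
⟨⟩-swap [] [] = refl
⟨⟩-swap (a ∷ x) (b ∷ y) = trans (cong₂ _⊕_ (lemma a b) (⟨⟩-swap x y)) (sym (↑2-⊕ (a ⊗ b ↑ 2) ⟨ x , y ⟩))
  where
  lemma : ∀ a b → b ⊗ a ↑ 2 ≡ (a ⊗ b ↑ 2) ↑ 2
  lemma = from-yes (∀? λ a → ∀? λ b → (b ⊗ a ↑ 2) ≟ ((a ⊗ b ↑ 2) ↑ 2))

⟨⟩-⊹ʳ : ∀ {n} (x y z : 𝔽₄^ n) → ⟨ x , y ⊹ z ⟩ ≡ ⟨ x , y ⟩ ⊕ ⟨ x , z ⟩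
⟨⟩-⊹ʳ x y z = begin
  ⟨ x , y ⊹ z ⟩                      ≡⟨ ⟨⟩-swap (y ⊹ z) x ⟩
  ⟨ y ⊹ z , x ⟩ ↑ 2                  ≡⟨ cong (_↑ 2) (⟨⟩-⊹ˡ y z x) ⟩
  (⟨ y , x ⟩ ⊕ ⟨ z , x ⟩) ↑ 2        ≡⟨ ↑2-⊕ ⟨ y , x ⟩ ⟨ z , x ⟩ ⟩
  (⟨ y , x ⟩ ↑ 2) ⊕ (⟨ z , x ⟩ ↑ 2)  ≡⟨ cong₂ _⊕_ (⟨⟩-swap y x) (⟨⟩-swap z x) ⟨
  ⟨ x , y ⟩ ⊕ ⟨ x , z ⟩              ∎
  where open ≡-Reasoning

⟨⟩-•ʳ : ∀ {n} c (x y : 𝔽₄^ n) → ⟨ x , c • y ⟩ ≡ c ↑ 2 ⊗ ⟨ x , y ⟩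
⟨⟩-•ʳ c x y = begin
  ⟨ x , c • y ⟩            ≡⟨ ⟨⟩-swap (c • y) x ⟩
  ⟨ c • y , x ⟩ ↑ 2        ≡⟨ cong (_↑ 2) (⟨⟩-•ˡ c y x) ⟩
  (c ⊗ ⟨ y , x ⟩) ↑ 2      ≡⟨ ↑2-⊗ c ⟨ y , x ⟩ ⟩
  c ↑ 2 ⊗ ⟨ y , x ⟩ ↑ 2    ≡⟨ cong (c ↑ 2 ⊗_) (⟨⟩-swap y x) ⟨
  c ↑ 2 ⊗ ⟨ x , y ⟩        ∎
  where open ≡-Reasoning

⟨⟩-zeroˡ : ∀ {n} (x : 𝔽₄^ n) → ⟨ 0⃗ , x ⟩ ≡ 𝟘
⟨⟩-zeroˡ []      = refl
⟨⟩-zeroˡ (a ∷ x) = ⟨⟩-zeroˡ x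

⟨⟩-zeroʳ : ∀ {n} (x : 𝔽₄^ n) → ⟨ x , 0⃗ ⟩ ≡ 𝟘
⟨⟩-zeroʳ x = trans (⟨⟩-swap 0⃗ x) (cong (_↑ 2) (⟨⟩-zeroˡ x))

-- A norm is fixed by the conjugation, hence lies in the prime field.
norm-cases : ∀ {n} (x : 𝔽₄^ n) → ⟨ x , x ⟩ ≡ 𝟘 ⊎ ⟨ x , x ⟩ ≡ 𝟙
norm-cases x = fixed ⟨ x , x ⟩ (⟨⟩-swap x x)
  where
  fixed : ∀ a → a ≡ a ↑ 2 → a ≡ 𝟘 ⊎ a ≡ 𝟙
  fixed 𝟘  _  = inj₁ refl
  fixed 𝟙  _  = inj₂ refl
  fixed ζ  ()
  fixed ζ² ()

-- Polarisation: the two cross terms are conjugate, so together they are the trace of ⟨x,y⟩.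
norm-⊹ : ∀ {n} (x y : 𝔽₄^ n) → ⟨ x ⊹ y , x ⊹ y ⟩ ≡ (⟨ x , x ⟩ ⊕ ⟨ y , y ⟩) ⊕ (⟨ x , y ⟩ ⊕ ⟨ x , y ⟩ ↑ 2)
norm-⊹ x y = begin
  ⟨ x ⊹ y , x ⊹ y ⟩                                          ≡⟨ ⟨⟩-⊹ˡ x y (x ⊹ y) ⟩
  ⟨ x , x ⊹ y ⟩ ⊕ ⟨ y , x ⊹ y ⟩                              ≡⟨ cong₂ _⊕_ (⟨⟩-⊹ʳ x x y) (⟨⟩-⊹ʳ y x y) ⟩
  (⟨ x , x ⟩ ⊕ ⟨ x , y ⟩) ⊕ (⟨ y , x ⟩ ⊕ ⟨ y , y ⟩)
    ≡⟨ cong (λ a → (⟨ x , x ⟩ ⊕ ⟨ x , y ⟩) ⊕ (a ⊕ ⟨ y , y ⟩)) (⟨⟩-swap x y) ⟩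
  (⟨ x , x ⟩ ⊕ ⟨ x , y ⟩) ⊕ (⟨ x , y ⟩ ↑ 2 ⊕ ⟨ y , y ⟩)
    ≡⟨ cong ((⟨ x , x ⟩ ⊕ ⟨ x , y ⟩) ⊕_) (⊕-comm (⟨ x , y ⟩ ↑ 2) ⟨ y , y ⟩) ⟩
  (⟨ x , x ⟩ ⊕ ⟨ x , y ⟩) ⊕ (⟨ y , y ⟩ ⊕ ⟨ x , y ⟩ ↑ 2)
    ≡⟨ ⊕-interchange ⟨ x , x ⟩ ⟨ x , y ⟩ ⟨ y , y ⟩ (⟨ x , y ⟩ ↑ 2) ⟩
  (⟨ x , x ⟩ ⊕ ⟨ y , y ⟩) ⊕ (⟨ x , y ⟩ ⊕ ⟨ x , y ⟩ ↑ 2)      ∎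
  where open ≡-Reasoning

unit : ∀ {n} → Fin n → 𝔽₄^ n
unit zero    = 𝟙 ∷ 0⃗
unit (suc k) = 𝟘 ∷ unit k

⟨⟩-unitʳ : ∀ {n} (x : 𝔽₄^ n) k → ⟨ x , unit k ⟩ ≡ lookup x k
⟨⟩-unitʳ (a ∷ x) zero    = trans (cong₂ _⊕_ (⊗-comm a 𝟙) (⟨⟩-zeroʳ x)) (⊕-identityʳ a)
⟨⟩-unitʳ (a ∷ x) (suc k) = trans (cong₂ _⊕_ (⊗-zeroʳ a) (⟨⟩-unitʳ x k)) refl

lookup-unit : ∀ {n} (k l : Fin n) → lookup (unit k) l ≡ δ k l
lookup-unit zero    zero    = refl
lookup-unit zero    (suc l) = Vecₚ.lookup-replicate l 𝟘
lookup-unit (suc k) zero    = refl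
lookup-unit (suc k) (suc l) = lookup-unit k l

-- Isometries

-- Group elements are handled as functions and become matrices only in `matrix`. The map `from`
-- pulls a target vector back into a subspace on which a smaller isometry can move it.
record Isometry (n : ℕ) : Set where
  field
    to from : 𝔽₄^ n → 𝔽₄^ n
    to-⊹    : ∀ x y → to (x ⊹ y) ≡ to x ⊹ to y
    to-•    : ∀ c x → to (c • x) ≡ c • to x
    to-⟨⟩   : ∀ x y → ⟨ to x , to y ⟩ ≡ ⟨ x , y ⟩
    to-from : ∀ x → to (from x) ≡ x

  from-⟨⟩ : ∀ x y → ⟨ from x , from y ⟩ ≡ ⟨ x , y ⟩
  from-⟨⟩ x y = trans (sym (to-⟨⟩ (from x) (from y))) (cong₂ ⟨_,_⟩ (to-from x) (to-from y))

open Isometry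

infixr 9 _⊚_

_⊚_ : ∀ {n} → Isometry n → Isometry n → Isometry n
f ⊚ g = record
  { to      = λ x → to f (to g x)
  ; from    = λ x → from g (from f x)
  ; to-⊹    = λ x y → trans (cong (to f) (to-⊹ g x y)) (to-⊹ f (to g x) (to g y))
  ; to-•    = λ c x → trans (cong (to f) (to-• g c x)) (to-• f c (to g x))
  ; to-⟨⟩   = λ x y → trans (to-⟨⟩ f (to g x) (to g y)) (to-⟨⟩ g x y)
  ; to-from = λ x → trans (cong (to f) (to-from g (from f x))) (to-from f x)
  }

-- Fixes the first unit vector and acts on its orthogonal complement, which makes induction on the
-- dimension possible.
lift : ∀ {n} → Isometry n → Isometry (suc n)
lift f = record
  { to      = λ { (a ∷ x) → a ∷ to f x }
  ; from    = λ { (a ∷ x) → a ∷ from f x }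
  ; to-⊹    = λ { (a ∷ x) (b ∷ y) → ∷-cong refl (to-⊹ f x y) }
  ; to-•    = λ { c (a ∷ x) → ∷-cong refl (to-• f c x) }
  ; to-⟨⟩   = λ { (a ∷ x) (b ∷ y) → cong (a ⊗ b ↑ 2 ⊕_) (to-⟨⟩ f x y) }
  ; to-from = λ { (a ∷ x) → ∷-cong refl (to-from f x) }
  }

scaling-ζ : ∀ {n} → Isometry n
scaling-ζ = record
  { to      = ζ •_
  ; from    = ζ² •_
  ; to-⊹    = •-distribˡ ζ
  ; to-•    = λ c x → trans (sym (•-assoc ζ c x)) (trans (cong (_• x) (⊗-comm ζ c)) (•-assoc c ζ x))
  ; to-⟨⟩   = λ x y → trans (⟨⟩-•ˡ ζ x (ζ • y)) (trans (cong (ζ ⊗_) (⟨⟩-•ʳ ζ x y)) (sym (⊗-assoc ζ ζ² ⟨ x , y ⟩)))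
  ; to-from = λ x → trans (sym (•-assoc ζ ζ² x)) (•-identity x)
  }

-- x ↦ x + c⟨x,v⟩v preserves the form exactly when c + c² + c³⟨v,v⟩ = 0.
reflection : ∀ {n} (v : 𝔽₄^ n) c → (c ⊕ c ↑ 2) ⊕ (c ↑ 3 ⊗ ⟨ v , v ⟩) ≡ 𝟘 → Isometry n
reflection {n} v c eq = record
  { to      = r c
  -- Composing the maps with coefficients c and d gives the map with coefficient c + d + cd⟨v,v⟩; at
  -- d = c² this is the expression assumed to vanish.
  ; from    = r (c ↑ 2)
  ; to-⊹    = λ x y → begin
      (x ⊹ y) ⊹ ((c ⊗ ⟨ x ⊹ y , v ⟩) • v)
        ≡⟨ cong (λ a → (x ⊹ y) ⊹ ((c ⊗ a) • v)) (⟨⟩-⊹ˡ x y v) ⟩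
      (x ⊹ y) ⊹ ((c ⊗ (⟨ x , v ⟩ ⊕ ⟨ y , v ⟩)) • v)
        ≡⟨ cong (λ a → (x ⊹ y) ⊹ (a • v)) (⊗-distribˡ c ⟨ x , v ⟩ ⟨ y , v ⟩) ⟩
      (x ⊹ y) ⊹ (((c ⊗ ⟨ x , v ⟩) ⊕ (c ⊗ ⟨ y , v ⟩)) • v)
        ≡⟨ cong ((x ⊹ y) ⊹_) (•-distribʳ v (c ⊗ ⟨ x , v ⟩) (c ⊗ ⟨ y , v ⟩)) ⟩
      (x ⊹ y) ⊹ (((c ⊗ ⟨ x , v ⟩) • v) ⊹ ((c ⊗ ⟨ y , v ⟩) • v))      ≡⟨ ⊹-interchange x y _ _ ⟩
      r c x ⊹ r c y                                                  ∎
  ; to-•    = λ d x → begin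
      (d • x) ⊹ ((c ⊗ ⟨ d • x , v ⟩) • v)          ≡⟨ cong (λ a → (d • x) ⊹ ((c ⊗ a) • v)) (⟨⟩-•ˡ d x v) ⟩
      (d • x) ⊹ ((c ⊗ (d ⊗ ⟨ x , v ⟩)) • v)        ≡⟨ cong (λ a → (d • x) ⊹ (a • v)) (⊗-left-comm c d ⟨ x , v ⟩) ⟩
      (d • x) ⊹ ((d ⊗ (c ⊗ ⟨ x , v ⟩)) • v)        ≡⟨ cong ((d • x) ⊹_) (•-assoc d (c ⊗ ⟨ x , v ⟩) v) ⟩
      (d • x) ⊹ (d • ((c ⊗ ⟨ x , v ⟩) • v))        ≡⟨ •-distribˡ d x _ ⟨
      d • r c x                                    ∎
  ; to-⟨⟩   = λ x y → begin
      ⟨ r c x , r c y ⟩                                                               ≡⟨ ⟨⟩-⊹ˡ x _ (r c y) ⟩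
      ⟨ x , r c y ⟩ ⊕ ⟨ (c ⊗ ⟨ x , v ⟩) • v , r c y ⟩
        ≡⟨ cong₂ _⊕_ (⟨⟩r x y) (trans (⟨⟩-•ˡ (c ⊗ ⟨ x , v ⟩) v (r c y)) (cong ((c ⊗ ⟨ x , v ⟩) ⊗_) (⟨⟩r v y))) ⟩
      (⟨ x , y ⟩ ⊕ ((c ⊗ ⟨ y , v ⟩) ↑ 2 ⊗ ⟨ x , v ⟩))
        ⊕ ((c ⊗ ⟨ x , v ⟩) ⊗ (⟨ v , y ⟩ ⊕ ((c ⊗ ⟨ y , v ⟩) ↑ 2 ⊗ ⟨ v , v ⟩)))
          ≡⟨ cong (λ a → (⟨ x , y ⟩ ⊕ ((c ⊗ ⟨ y , v ⟩) ↑ 2 ⊗ ⟨ x , v ⟩)) ⊕ ((c ⊗ ⟨ x , v ⟩) ⊗ (a ⊕ ((c ⊗ ⟨ y , v ⟩) ↑ 2 ⊗ ⟨ v , v ⟩)))) (⟨⟩-swap y v) ⟩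
      (⟨ x , y ⟩ ⊕ ((c ⊗ ⟨ y , v ⟩) ↑ 2 ⊗ ⟨ x , v ⟩))
        ⊕ ((c ⊗ ⟨ x , v ⟩) ⊗ (⟨ y , v ⟩ ↑ 2 ⊕ ((c ⊗ ⟨ y , v ⟩) ↑ 2 ⊗ ⟨ v , v ⟩)))
          ≡⟨ cross c ⟨ v , v ⟩ eq ⟨ x , v ⟩ ⟨ y , v ⟩ ⟨ x , y ⟩ ⟩
      ⟨ x , y ⟩                                                                       ∎
  ; to-from = λ x → begin
      r (c ↑ 2) x ⊹ ((c ⊗ ⟨ r (c ↑ 2) x , v ⟩) • v)
        ≡⟨ cong (λ a → r (c ↑ 2) x ⊹ ((c ⊗ a) • v)) (trans (⟨⟩-⊹ˡ x _ v) (cong (⟨ x , v ⟩ ⊕_) (⟨⟩-•ˡ _ v v))) ⟩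
      r (c ↑ 2) x ⊹ ((c ⊗ (⟨ x , v ⟩ ⊕ ((c ↑ 2 ⊗ ⟨ x , v ⟩) ⊗ ⟨ v , v ⟩))) • v)       ≡⟨ ⊹-assoc x _ _ ⟩
      x ⊹ (((c ↑ 2 ⊗ ⟨ x , v ⟩) • v) ⊹ ((c ⊗ (⟨ x , v ⟩ ⊕ ((c ↑ 2 ⊗ ⟨ x , v ⟩) ⊗ ⟨ v , v ⟩))) • v))
        ≡⟨ cong (x ⊹_) (•-distribʳ v _ _) ⟨
      x ⊹ (((c ↑ 2 ⊗ ⟨ x , v ⟩) ⊕ (c ⊗ (⟨ x , v ⟩ ⊕ ((c ↑ 2 ⊗ ⟨ x , v ⟩) ⊗ ⟨ v , v ⟩)))) • v)
        ≡⟨ cong (λ a → x ⊹ (a • v)) (cancel c ⟨ v , v ⟩ eq ⟨ x , v ⟩) ⟩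
      x ⊹ (𝟘 • v)                                                                     ≡⟨ cong (x ⊹_) (•-zeroˡ v) ⟩
      x ⊹ 0⃗                                                                           ≡⟨ ⊹-identityʳ x ⟩
      x                                                                               ∎
  }
  where
  open ≡-Reasoning
  r : 𝔽₄ → 𝔽₄^ n → 𝔽₄^ n
  r c x = x ⊹ ((c ⊗ ⟨ x , v ⟩) • v)
  ⟨⟩r : ∀ x y → ⟨ x , r c y ⟩ ≡ ⟨ x , y ⟩ ⊕ ((c ⊗ ⟨ y , v ⟩) ↑ 2 ⊗ ⟨ x , v ⟩)
  ⟨⟩r x y = trans (⟨⟩-⊹ʳ x y _) (cong (⟨ x , y ⟩ ⊕_) (⟨⟩-•ʳ (c ⊗ ⟨ y , v ⟩) x v))
  ⊗-left-comm : ∀ c d a → c ⊗ (d ⊗ a) ≡ d ⊗ (c ⊗ a)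
  ⊗-left-comm = from-yes (∀? λ c → ∀? λ d → ∀? λ a → (c ⊗ (d ⊗ a)) ≟ (d ⊗ (c ⊗ a)))
  -- Apart from s, all terms are multiples of pq², with total coefficient c + c² + c³m.
  cross : ∀ c m → (c ⊕ c ↑ 2) ⊕ (c ↑ 3 ⊗ m) ≡ 𝟘 → ∀ p q s →
          (s ⊕ ((c ⊗ q) ↑ 2 ⊗ p)) ⊕ ((c ⊗ p) ⊗ (q ↑ 2 ⊕ ((c ⊗ q) ↑ 2 ⊗ m))) ≡ s
  cross = from-yes (∀? λ c → ∀? λ m → (((c ⊕ c ↑ 2) ⊕ (c ↑ 3 ⊗ m)) ≟ 𝟘) →-dec (∀? λ p → ∀? λ q → ∀? λ s →
          ((s ⊕ ((c ⊗ q) ↑ 2 ⊗ p)) ⊕ ((c ⊗ p) ⊗ (q ↑ 2 ⊕ ((c ⊗ q) ↑ 2 ⊗ m)))) ≟ s))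
  cancel : ∀ c m → (c ⊕ c ↑ 2) ⊕ (c ↑ 3 ⊗ m) ≡ 𝟘 → ∀ p →
           (c ↑ 2 ⊗ p) ⊕ (c ⊗ (p ⊕ ((c ↑ 2 ⊗ p) ⊗ m))) ≡ 𝟘
  cancel = from-yes (∀? λ c → ∀? λ m → (((c ⊕ c ↑ 2) ⊕ (c ↑ 3 ⊗ m)) ≟ 𝟘) →-dec (∀? λ p →
           ((c ↑ 2 ⊗ p) ⊕ (c ⊗ (p ⊕ ((c ↑ 2 ⊗ p) ⊗ m)))) ≟ 𝟘))

-- Put v = x + y and p = ⟨x,v⟩. The coefficient 1/p = p² sends x to x + v = y. As p³ = 1, the
-- condition for an isometry becomes ⟨v,v⟩ = p + p², and this follows from the equality of norms.
reflect : ∀ {n} (x y : 𝔽₄^ n) → ⟨ x , x ⟩ ≡ ⟨ y , y ⟩ → ⟨ x , x ⊹ y ⟩ ≢ 𝟘 → ∃ λ (f : Isometry n) → to f x ≡ y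
reflect x y xx≡yy p≢0 = reflection v (p ↑ 2) preserved , (begin
    x ⊹ ((p ↑ 2 ⊗ p) • v)   ≡⟨ cong (λ a → x ⊹ (a • v)) (↑2-inverse p p≢0) ⟩
    x ⊹ (𝟙 • v)             ≡⟨ cong (x ⊹_) (•-identity v) ⟩
    x ⊹ (x ⊹ y)             ≡⟨ ⊹-cancel x y ⟩
    y                       ∎)
  where
  open ≡-Reasoning
  v = x ⊹ y
  p = ⟨ x , v ⟩
  preserved : (p ↑ 2 ⊕ (p ↑ 2) ↑ 2) ⊕ ((p ↑ 2) ↑ 3 ⊗ ⟨ v , v ⟩) ≡ 𝟘
  preserved = subst (λ m → (p ↑ 2 ⊕ (p ↑ 2) ↑ 2) ⊕ ((p ↑ 2) ↑ 3 ⊗ m) ≡ 𝟘) (sym norm) (arith p p≢0)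
    where
    arith : ∀ p → p ≢ 𝟘 → (p ↑ 2 ⊕ (p ↑ 2) ↑ 2) ⊕ ((p ↑ 2) ↑ 3 ⊗ (p ⊕ p ↑ 2)) ≡ 𝟘
    arith = from-yes (∀? λ p → ¬? (p ≟ 𝟘) →-dec (((p ↑ 2 ⊕ (p ↑ 2) ↑ 2) ⊕ ((p ↑ 2) ↑ 3 ⊗ (p ⊕ p ↑ 2))) ≟ 𝟘))
    trace : ∀ a b → a ≡ a ↑ 2 → (a ⊕ a) ⊕ (b ⊕ b ↑ 2) ≡ (a ⊕ b) ⊕ (a ⊕ b) ↑ 2
    trace = from-yes (∀? λ a → ∀? λ b → (a ≟ (a ↑ 2)) →-dec (((a ⊕ a) ⊕ (b ⊕ b ↑ 2)) ≟ ((a ⊕ b) ⊕ (a ⊕ b) ↑ 2)))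
    norm : ⟨ v , v ⟩ ≡ p ⊕ p ↑ 2
    norm = begin
      ⟨ v , v ⟩                                                    ≡⟨ norm-⊹ x y ⟩
      (⟨ x , x ⟩ ⊕ ⟨ y , y ⟩) ⊕ (⟨ x , y ⟩ ⊕ ⟨ x , y ⟩ ↑ 2)
        ≡⟨ cong (λ a → (⟨ x , x ⟩ ⊕ a) ⊕ (⟨ x , y ⟩ ⊕ ⟨ x , y ⟩ ↑ 2)) (sym xx≡yy) ⟩
      (⟨ x , x ⟩ ⊕ ⟨ x , x ⟩) ⊕ (⟨ x , y ⟩ ⊕ ⟨ x , y ⟩ ↑ 2)        ≡⟨ trace ⟨ x , x ⟩ ⟨ x , y ⟩ (⟨⟩-swap x x) ⟩
      (⟨ x , x ⟩ ⊕ ⟨ x , y ⟩) ⊕ (⟨ x , x ⟩ ⊕ ⟨ x , y ⟩) ↑ 2        ≡⟨ cong (λ a → a ⊕ a ↑ 2) (sym (⟨⟩-⊹ʳ x x y)) ⟩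
      p ⊕ p ↑ 2                                                    ∎

norm-unit₀ : ∀ {n} → ⟨ unit (zero {n}) , unit zero ⟩ ≡ 𝟙
norm-unit₀ {n} = cong (𝟙 ⊕_) (⟨⟩-zeroˡ (0⃗ {n}))

-- A single reflection moves e₁ to v unless ⟨e₁,v⟩ = 1; in that case aim at ζ²v and rescale by ζ.
move-unit : ∀ {n} (v : 𝔽₄^ (suc n)) → ⟨ v , v ⟩ ≡ 𝟙 → ∃ λ (f : Isometry (suc n)) → to f (unit zero) ≡ v
move-unit {n} v vv≡1 with ⟨ unit zero , v ⟩ ≟ 𝟙
... | no ev≢1 = reflect (unit zero) v (trans (norm-unit₀ {n}) (sym vv≡1)) λ eq →
        ev≢1 (sym-⊕ ⟨ unit zero , v ⟩ (trans (cong (_⊕ ⟨ unit zero , v ⟩) (sym (norm-unit₀ {n}))) (trans (sym (⟨⟩-⊹ʳ (unit zero) (unit zero) v)) eq)))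
  where
  sym-⊕ : ∀ a → 𝟙 ⊕ a ≡ 𝟘 → a ≡ 𝟙
  sym-⊕ = from-yes (∀? λ a → ((𝟙 ⊕ a) ≟ 𝟘) →-dec (a ≟ 𝟙))
... | yes ev≡1 = scaling-ζ ⊚ proj₁ g , trans (cong (ζ •_) (proj₂ g)) (trans (sym (•-assoc ζ ζ² v)) (•-identity v))
  where
  v′ = ζ² • v
  ζ²≢0 : ζ² ≢ 𝟘
  ζ²≢0 ()
  v′v′≡1 : ⟨ v′ , v′ ⟩ ≡ 𝟙
  v′v′≡1 = trans (⟨⟩-•ˡ ζ² v v′) (cong (ζ² ⊗_) (trans (⟨⟩-•ʳ ζ² v v) (cong (ζ ⊗_) vv≡1)))
  -- The second argument is conjugated, so the value is 1 + ζ = ζ²; being nonzero, it admits a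
  -- reflection to v′.
  pairing : ⟨ unit zero , unit zero ⊹ v′ ⟩ ≡ ζ²
  pairing = trans (⟨⟩-⊹ʳ (unit zero) (unit zero) v′) (cong₂ _⊕_ (norm-unit₀ {n}) (trans (⟨⟩-•ʳ ζ² (unit zero) v) (cong (ζ ⊗_) ev≡1)))
  g = reflect (unit zero) v′ (trans (norm-unit₀ {n}) (sym v′v′≡1)) λ eq → ζ²≢0 (trans (sym pairing) eq)

Isotropic : ∀ {n} → 𝔽₄^ n → Set
Isotropic x = ⟨ x , x ⟩ ≡ 𝟘

to-zero : ∀ {n} (f : Isometry n) → to f 0⃗ ≡ 0⃗
to-zero f = trans (cong (to f) (sym (•-zeroˡ 0⃗))) (trans (to-• f 𝟘 0⃗) (•-zeroˡ (to f 0⃗)))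

⊥unit⇒0∷tail : ∀ {n} (x : 𝔽₄^ (suc n)) → ⟨ x , unit zero ⟩ ≡ 𝟘 → x ≡ 𝟘 ∷ Vec.tail x
⊥unit⇒0∷tail (a ∷ x) eq = ∷-cong (trans (sym (⟨⟩-unitʳ (a ∷ x) zero)) eq) refl

-- After e₁ has been moved to u, the pullback of v is orthogonal to e₁, so it begins with 𝟘 and its
-- tail is a unit vector one dimension lower. A lifted isometry moves it there without disturbing
-- e₁.
move-orthonormal : ∀ {n} (u v : 𝔽₄^ (suc (suc n))) → ⟨ u , u ⟩ ≡ 𝟙 → ⟨ v , v ⟩ ≡ 𝟙 → ⟨ u , v ⟩ ≡ 𝟘 →
                   ∃ λ (f : Isometry (suc (suc n))) → to f (unit 0F) ≡ u × to f (unit 1F) ≡ v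
move-orthonormal {n} u v uu≡1 vv≡1 uv≡0 =
  g ⊚ lift h , trans (cong (λ z → to g (𝟙 ∷ z)) (to-zero h)) ge≡u , (begin
    to g (𝟘 ∷ to h (unit zero))  ≡⟨ cong (λ z → to g (𝟘 ∷ z)) (proj₂ moved) ⟩
    to g (𝟘 ∷ Vec.tail w)        ≡⟨ cong (to g) (sym w≡0∷) ⟩
    to g w                       ≡⟨ to-from g v ⟩
    v                            ∎)
  where
  open ≡-Reasoning
  g = proj₁ (move-unit u uu≡1)
  ge≡u = proj₂ (move-unit u uu≡1)
  w = from g v
  w≡0∷ : w ≡ 𝟘 ∷ Vec.tail w
  w≡0∷ = ⊥unit⇒0∷tail w (begin
    ⟨ w , unit zero ⟩               ≡⟨ sym (to-⟨⟩ g w (unit zero)) ⟩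
    ⟨ to g w , to g (unit zero) ⟩   ≡⟨ cong₂ ⟨_,_⟩ (to-from g v) ge≡u ⟩
    ⟨ v , u ⟩                       ≡⟨ ⟨⟩-swap u v ⟩
    ⟨ u , v ⟩ ↑ 2                   ≡⟨ cong (_↑ 2) uv≡0 ⟩
    𝟘                               ∎)
  moved = move-unit (Vec.tail w) (trans (sym (cong₂ ⟨_,_⟩ w≡0∷ w≡0∷)) (trans (from-⟨⟩ g v v) vv≡1))
  h = proj₁ moved

-- If u = ζ²x + y and v = ζx + y, then x = u + v and y = ζu + ζ²v. These are the coordinates of a
-- hyperbolic pair in the orthonormal basis (u, v) of its span.
x₀ y₀ : ∀ {n} → 𝔽₄^ (suc (suc n))
x₀ = 𝟙 ∷ 𝟙 ∷ 0⃗
y₀ = ζ ∷ ζ² ∷ 0⃗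

z₀ : ∀ {n} → 𝔽₄^ (suc (suc (suc (suc n))))
z₀ = 𝟘 ∷ 𝟘 ∷ x₀

-- (ζ²x + y, ζx + y) is an orthonormal basis of the span of a hyperbolic pair (x, y).
move-hyperbolic : ∀ {n} (x y : 𝔽₄^ (suc (suc n))) → Isotropic x → Isotropic y → ⟨ x , y ⟩ ≡ 𝟙 →
                  ∃ λ (f : Isometry (suc (suc n))) → to f x₀ ≡ x × to f y₀ ≡ y
move-hyperbolic {n} x y xx≡0 yy≡0 xy≡1 = f , (begin
    to f x₀                                    ≡⟨ cong (to f) x₀≡ ⟩
    to f (unit 0F ⊹ unit 1F)                   ≡⟨ to-⊹ f (unit 0F) (unit 1F) ⟩
    to f (unit 0F) ⊹ to f (unit 1F)            ≡⟨ cong₂ _⊹_ fe₀ fe₁ ⟩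
    combo ζ² ⊹ combo ζ                         ≡⟨ ⊹-interchange (ζ² • x) y (ζ • x) y ⟩
    ((ζ² • x) ⊹ (ζ • x)) ⊹ (y ⊹ y)
      ≡⟨ cong₂ _⊹_ (trans (sym (•-distribʳ x ζ² ζ)) (•-identity x)) (⊹-self y) ⟩
    x ⊹ 0⃗                                      ≡⟨ ⊹-identityʳ x ⟩
    x                                          ∎) , (begin
    to f y₀                                    ≡⟨ cong (to f) y₀≡ ⟩
    to f ((ζ • unit 0F) ⊹ (ζ² • unit 1F))      ≡⟨ to-⊹ f _ _ ⟩
    to f (ζ • unit 0F) ⊹ to f (ζ² • unit 1F)
      ≡⟨ cong₂ _⊹_ (trans (to-• f ζ _) (cong (ζ •_) fe₀)) (trans (to-• f ζ² _) (cong (ζ² •_) fe₁)) ⟩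
    (ζ • combo ζ²) ⊹ (ζ² • combo ζ)            ≡⟨ cong₂ _⊹_ (distrib ζ ζ² refl) (distrib ζ² ζ refl) ⟩
    (x ⊹ (ζ • y)) ⊹ (x ⊹ (ζ² • y))             ≡⟨ ⊹-interchange x (ζ • y) x (ζ² • y) ⟩
    (x ⊹ x) ⊹ ((ζ • y) ⊹ (ζ² • y))
      ≡⟨ cong₂ _⊹_ (⊹-self x) (trans (sym (•-distribʳ y ζ ζ²)) (•-identity y)) ⟩
    0⃗ ⊹ y                                      ≡⟨ ⊹-identityˡ y ⟩
    y                                          ∎)
  where
  open ≡-Reasoning
  combo : 𝔽₄ → 𝔽₄^ (suc (suc n))
  combo c = (c • x) ⊹ y
  distrib : ∀ c d → c ⊗ d ≡ 𝟙 → c • combo d ≡ x ⊹ (c • y)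
  distrib c d cd≡1 = trans (•-distribˡ c (d • x) y)
    (cong (_⊹ (c • y)) (trans (sym (•-assoc c d x)) (trans (cong (_• x) cd≡1) (•-identity x))))
  ⟨combo⟩ : ∀ c d → ⟨ combo c , combo d ⟩ ≡ c ⊕ d ↑ 2
  ⟨combo⟩ c d = begin
    ⟨ combo c , combo d ⟩                                      ≡⟨ ⟨⟩-⊹ˡ (c • x) y (combo d) ⟩
    ⟨ c • x , combo d ⟩ ⊕ ⟨ y , combo d ⟩                      ≡⟨ cong₂ _⊕_ (⟨⟩-•ˡ c x (combo d)) refl ⟩
    (c ⊗ ⟨ x , combo d ⟩) ⊕ ⟨ y , combo d ⟩                    ≡⟨ cong₂ (λ a b → (c ⊗ a) ⊕ b) (⟨combo x) (⟨combo y) ⟩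
    (c ⊗ ((d ↑ 2 ⊗ ⟨ x , x ⟩) ⊕ ⟨ x , y ⟩)) ⊕ ((d ↑ 2 ⊗ ⟨ y , x ⟩) ⊕ ⟨ y , y ⟩)
      ≡⟨ cong₂ (λ a b → (c ⊗ ((d ↑ 2 ⊗ a) ⊕ b)) ⊕ ((d ↑ 2 ⊗ ⟨ y , x ⟩) ⊕ ⟨ y , y ⟩)) xx≡0 xy≡1 ⟩
    (c ⊗ ((d ↑ 2 ⊗ 𝟘) ⊕ 𝟙)) ⊕ ((d ↑ 2 ⊗ ⟨ y , x ⟩) ⊕ ⟨ y , y ⟩)
      ≡⟨ cong₂ (λ a b → (c ⊗ ((d ↑ 2 ⊗ 𝟘) ⊕ 𝟙)) ⊕ ((d ↑ 2 ⊗ a) ⊕ b)) (trans (⟨⟩-swap x y) (cong (_↑ 2) xy≡1)) yy≡0 ⟩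
    (c ⊗ ((d ↑ 2 ⊗ 𝟘) ⊕ 𝟙)) ⊕ ((d ↑ 2 ⊗ 𝟙) ⊕ 𝟘)               ≡⟨ arith c d ⟩
    c ⊕ d ↑ 2                                                  ∎
    where
    ⟨combo : ∀ z → ⟨ z , combo d ⟩ ≡ (d ↑ 2 ⊗ ⟨ z , x ⟩) ⊕ ⟨ z , y ⟩
    ⟨combo z = trans (⟨⟩-⊹ʳ z (d • x) y) (cong (_⊕ ⟨ z , y ⟩) (⟨⟩-•ʳ d z x))
    arith : ∀ c d → (c ⊗ ((d ↑ 2 ⊗ 𝟘) ⊕ 𝟙)) ⊕ ((d ↑ 2 ⊗ 𝟙) ⊕ 𝟘) ≡ c ⊕ d ↑ 2
    arith = from-yes (∀? λ c → ∀? λ d → ((c ⊗ ((d ↑ 2 ⊗ 𝟘) ⊕ 𝟙)) ⊕ ((d ↑ 2 ⊗ 𝟙) ⊕ 𝟘)) ≟ (c ⊕ d ↑ 2))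
  -- By the formula c + d², both norms are ζ + ζ² = 1, and the mixed product is ζ² + ζ² = 0.
  moved = move-orthonormal (combo ζ²) (combo ζ) (⟨combo⟩ ζ² ζ²) (⟨combo⟩ ζ ζ) (⟨combo⟩ ζ² ζ)
  f = proj₁ moved
  fe₀ = proj₁ (proj₂ moved)
  fe₁ = proj₂ (proj₂ moved)
  x₀≡ : x₀ ≡ unit 0F ⊹ unit 1F
  x₀≡ = cong (λ z → 𝟙 ∷ 𝟙 ∷ z) (sym (⊹-self 0⃗))
  y₀≡ : y₀ ≡ (ζ • unit 0F) ⊹ (ζ² • unit 1F)
  y₀≡ = cong (λ z → ζ ∷ ζ² ∷ z) (sym (trans (cong₂ _⊹_ (•-zeroʳ ζ) (•-zeroʳ ζ²)) (⊹-self 0⃗)))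

-- Dual vectors and hyperbolic partners

nonzero-coordinate : ∀ {n} (x : 𝔽₄^ n) → x ≢ 0⃗ → ∃ λ k → lookup x k ≢ 𝟘
nonzero-coordinate []      x≢0 = contradiction refl x≢0
nonzero-coordinate (a ∷ x) x≢0 with a ≟ 𝟘
... | no a≢0   = zero , a≢0
... | yes refl with nonzero-coordinate x (λ eq → x≢0 (cong (𝟘 ∷_) eq))
...   | k , xₖ≢0 = suc k , xₖ≢0

-- Nondegeneracy: ⟨x, a eₖ⟩ = a² xₖ, which is 1 for a = xₖ as soon as this coordinate is nonzero.
dual-vector : ∀ {n} (x : 𝔽₄^ n) → x ≢ 0⃗ → ∃ λ z → ⟨ x , z ⟩ ≡ 𝟙
dual-vector x x≢0 with nonzero-coordinate x x≢0
... | k , xₖ≢0 = lookup x k • unit k ,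
      trans (⟨⟩-•ʳ (lookup x k) x (unit k)) (trans (cong (lookup x k ↑ 2 ⊗_) (⟨⟩-unitʳ x k)) (↑2-inverse (lookup x k) xₖ≢0))

-- A Gram-Schmidt argument. With z dual to x and t = ⟨y,z⟩, independence makes y′ = y + tx nonzero,
-- so it has a dual vector w. Correcting w by a multiple of z gives w′ orthogonal to x with ⟨y,w′⟩ =
-- 1; correcting z by t²w′ then removes its product with y. Coefficients are squared because the
-- second argument is semilinear.
dual-vector₂ : ∀ {n} (x y : 𝔽₄^ n) → x ≢ 0⃗ → ¬ (∃ λ c → y ≡ c • x) → ∃ λ z → ⟨ x , z ⟩ ≡ 𝟙 × ⟨ y , z ⟩ ≡ 𝟘
dual-vector₂ x y x≢0 independent = z ⊹ ((t ↑ 2) • w′) , xz≡1 , yz≡0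
  where
  open ≡-Reasoning
  z = proj₁ (dual-vector x x≢0)
  t = ⟨ y , z ⟩
  y′ = y ⊹ (t • x)
  y′≢0 : y′ ≢ 0⃗
  y′≢0 eq = independent (t , ⊹≡0⇒≡ y (t • x) eq)
  w = proj₁ (dual-vector y′ y′≢0)
  s = ⟨ x , w ⟩
  w′ = w ⊹ ((s ↑ 2) • z)
  ⟨⟩-⊹•ʳ : ∀ u v c v′ → ⟨ u , v ⊹ ((c ↑ 2) • v′) ⟩ ≡ ⟨ u , v ⟩ ⊕ (c ⊗ ⟨ u , v′ ⟩)
  ⟨⟩-⊹•ʳ u v c v′ = trans (⟨⟩-⊹ʳ u v _) (cong (⟨ u , v ⟩ ⊕_)
    (trans (⟨⟩-•ʳ (c ↑ 2) u v′) (cong (_⊗ ⟨ u , v′ ⟩) (↑2-involutive c))))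
  xz : ⟨ x , z ⟩ ≡ 𝟙
  xz = proj₂ (dual-vector x x≢0)
  cancel : ∀ a → a ⊕ (a ⊗ 𝟙) ≡ 𝟘
  cancel = from-yes (∀? λ a → (a ⊕ (a ⊗ 𝟙)) ≟ 𝟘)
  xw′≡0 : ⟨ x , w′ ⟩ ≡ 𝟘
  xw′≡0 = trans (⟨⟩-⊹•ʳ x w s z) (trans (cong (λ a → s ⊕ (s ⊗ a)) xz) (cancel s))
  y′-pairing : ∀ v → ⟨ y′ , v ⟩ ≡ ⟨ y , v ⟩ ⊕ (t ⊗ ⟨ x , v ⟩)
  y′-pairing v = trans (⟨⟩-⊹ˡ y (t • x) v) (cong (⟨ y , v ⟩ ⊕_) (⟨⟩-•ˡ t x v))
  y′z≡0 : ⟨ y′ , z ⟩ ≡ 𝟘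
  y′z≡0 = trans (y′-pairing z) (trans (cong (λ a → t ⊕ (t ⊗ a)) xz) (cancel t))
  yw′≡1 : ⟨ y , w′ ⟩ ≡ 𝟙
  yw′≡1 = begin
    ⟨ y , w′ ⟩                       ≡⟨ sym (⊕-identityʳ _) ⟩
    ⟨ y , w′ ⟩ ⊕ 𝟘                   ≡⟨ cong (⟨ y , w′ ⟩ ⊕_) (sym (trans (cong (t ⊗_) xw′≡0) (⊗-zeroʳ t))) ⟩
    ⟨ y , w′ ⟩ ⊕ (t ⊗ ⟨ x , w′ ⟩)    ≡⟨ sym (y′-pairing w′) ⟩
    ⟨ y′ , w′ ⟩                      ≡⟨ ⟨⟩-⊹•ʳ y′ w s z ⟩
    ⟨ y′ , w ⟩ ⊕ (s ⊗ ⟨ y′ , z ⟩)    ≡⟨ cong₂ (λ a b → a ⊕ (s ⊗ b)) (proj₂ (dual-vector y′ y′≢0)) y′z≡0 ⟩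
    𝟙 ⊕ (s ⊗ 𝟘)                      ≡⟨ cong (𝟙 ⊕_) (⊗-zeroʳ s) ⟩
    𝟙                                ∎
  xz≡1 : ⟨ x , z ⊹ ((t ↑ 2) • w′) ⟩ ≡ 𝟙
  xz≡1 = trans (⟨⟩-⊹•ʳ x z t w′) (cong₂ _⊕_ xz (trans (cong (t ⊗_) xw′≡0) (⊗-zeroʳ t)))
  yz≡0 : ⟨ y , z ⊹ ((t ↑ 2) • w′) ⟩ ≡ 𝟘
  yz≡0 = trans (⟨⟩-⊹•ʳ y z t w′) (trans (cong (λ a → t ⊕ (t ⊗ a)) yw′≡1) (cancel t))

-- As x is isotropic and ⟨z,x⟩ = 1, adding cx changes the norm of z by the trace of c². The trace of
-- ζ is 1 and the norm of z is 0 or 1, so c = ζ⟨z,z⟩ cancels it.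
isotropic-correction : ∀ {n} (x z : 𝔽₄^ n) → Isotropic x → ⟨ x , z ⟩ ≡ 𝟙 → ∃ λ c → Isotropic (z ⊹ (c • x))
isotropic-correction x z xx≡0 xz≡1 = c , (begin
    ⟨ z ⊹ (c • x) , z ⊹ (c • x) ⟩                                               ≡⟨ norm-⊹ z (c • x) ⟩
    (⟨ z , z ⟩ ⊕ ⟨ c • x , c • x ⟩) ⊕ (⟨ z , c • x ⟩ ⊕ ⟨ z , c • x ⟩ ↑ 2)
      ≡⟨ cong₂ (λ a b → (⟨ z , z ⟩ ⊕ a) ⊕ (b ⊕ b ↑ 2)) cxcx zcx ⟩
    (⟨ z , z ⟩ ⊕ 𝟘) ⊕ (c ↑ 2 ⊕ (c ↑ 2) ↑ 2)                                     ≡⟨ arith ⟨ z , z ⟩ (norm-cases z) ⟩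
    𝟘                                                                           ∎)
  where
  open ≡-Reasoning
  c = ζ ⊗ ⟨ z , z ⟩
  cxcx : ⟨ c • x , c • x ⟩ ≡ 𝟘
  cxcx = trans (⟨⟩-•ˡ c x (c • x)) (trans (cong (c ⊗_) (trans (⟨⟩-•ʳ c x x) (trans (cong (c ↑ 2 ⊗_) xx≡0) (⊗-zeroʳ (c ↑ 2))))) (⊗-zeroʳ c))
  zcx : ⟨ z , c • x ⟩ ≡ c ↑ 2
  zcx = trans (⟨⟩-•ʳ c z x) (trans (cong (c ↑ 2 ⊗_) (trans (⟨⟩-swap x z) (cong (_↑ 2) xz≡1))) (⊗-comm (c ↑ 2) 𝟙))
  arith : ∀ a → a ≡ 𝟘 ⊎ a ≡ 𝟙 → (a ⊕ 𝟘) ⊕ ((ζ ⊗ a) ↑ 2 ⊕ ((ζ ⊗ a) ↑ 2) ↑ 2) ≡ 𝟘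
  arith _ (inj₁ refl) = refl
  arith _ (inj₂ refl) = refl

-- The correction only adds a multiple of x. The last clause records that orthogonality to x and z
-- survives it, which is how a second isotropic vector stays orthogonal to the whole plane in
-- `move-orthogonal`.
hyperbolic-partner : ∀ {n} (x z : 𝔽₄^ n) → Isotropic x → ⟨ x , z ⟩ ≡ 𝟙 →
  ∃ λ z′ → Isotropic z′ × ⟨ x , z′ ⟩ ≡ 𝟙 × (∀ y → ⟨ y , x ⟩ ≡ 𝟘 → ⟨ y , z ⟩ ≡ 𝟘 → ⟨ y , z′ ⟩ ≡ 𝟘)
hyperbolic-partner x z xx≡0 xz≡1 with isotropic-correction x z xx≡0 xz≡1
... | c , isotropic = z ⊹ (c • x) , isotropic , trans (pairing x xx≡0) xz≡1 ,
      λ y yx≡0 yz≡0 → trans (pairing y yx≡0) yz≡0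
  where
  pairing : ∀ y → ⟨ y , x ⟩ ≡ 𝟘 → ⟨ y , z ⊹ (c • x) ⟩ ≡ ⟨ y , z ⟩
  pairing y yx≡0 = trans (⟨⟩-⊹ʳ y z (c • x)) (trans (cong (⟨ y , z ⟩ ⊕_)
    (trans (⟨⟩-•ʳ c y x) (trans (cong (c ↑ 2 ⊗_) yx≡0) (⊗-zeroʳ (c ↑ 2))))) (⊕-identityʳ ⟨ y , z ⟩))

move-isotropic : ∀ {n} (x : 𝔽₄^ (suc (suc n))) → x ≢ 0⃗ → Isotropic x → ∃ λ (f : Isometry (suc (suc n))) → to f x₀ ≡ x
move-isotropic x x≢0 xx≡0 =
  let z , xz≡1                = dual-vector x x≢0
      z′ , z′z′≡0 , xz′≡1 , _ = hyperbolic-partner x z xx≡0 xz≡1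
      f , fx₀≡x , _           = move-hyperbolic x z′ xx≡0 z′z′≡0 xz′≡1
  in f , fx₀≡x

⊥x₀y₀⇒0∷0∷ : ∀ {n} (w : 𝔽₄^ (suc (suc n))) → ⟨ w , x₀ ⟩ ≡ 𝟘 → ⟨ w , y₀ ⟩ ≡ 𝟘 → w ≡ 𝟘 ∷ 𝟘 ∷ Vec.tail (Vec.tail w)
⊥x₀y₀⇒0∷0∷ (a ∷ b ∷ w) wx≡0 wy≡0 = cong₂ (λ a b → a ∷ b ∷ w) (proj₁ both) (proj₂ both)
  where
  arith : ∀ a b → (a ⊗ 𝟙) ⊕ ((b ⊗ 𝟙) ⊕ 𝟘) ≡ 𝟘 → (a ⊗ ζ²) ⊕ ((b ⊗ ζ) ⊕ 𝟘) ≡ 𝟘 → a ≡ 𝟘 × b ≡ 𝟘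
  arith = from-yes (∀? λ a → ∀? λ b → (((a ⊗ 𝟙) ⊕ ((b ⊗ 𝟙) ⊕ 𝟘)) ≟ 𝟘) →-dec
    ((((a ⊗ ζ²) ⊕ ((b ⊗ ζ) ⊕ 𝟘)) ≟ 𝟘) →-dec ((a ≟ 𝟘) ×-dec (b ≟ 𝟘))))
  both : a ≡ 𝟘 × b ≡ 𝟘
  both = arith a b (trans (cong (λ s → (a ⊗ 𝟙) ⊕ ((b ⊗ 𝟙) ⊕ s)) (sym (⟨⟩-zeroʳ w))) wx≡0)
                   (trans (cong (λ s → (a ⊗ ζ²) ⊕ ((b ⊗ ζ) ⊕ s)) (sym (⟨⟩-zeroʳ w))) wy≡0)

-- Pulled back along f, the vector y is orthogonal to the plane of the first two coordinates, so it
-- lives in the remaining ones; these still contain an isotropic vector like x₀. Two lifts move it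
-- there while fixing x₀.
extend-hyperbolic : ∀ {n} (x y z : 𝔽₄^ (4 ℕ.+ n)) (f : Isometry (4 ℕ.+ n)) → to f x₀ ≡ x → to f y₀ ≡ z →
  y ≢ 0⃗ → Isotropic y → ⟨ y , x ⟩ ≡ 𝟘 → ⟨ y , z ⟩ ≡ 𝟘 → ∃ λ (g : Isometry (4 ℕ.+ n)) → to g x₀ ≡ x × to g z₀ ≡ y
extend-hyperbolic x y z f fx₀≡x fy₀≡z y≢0 yy≡0 yx≡0 yz≡0 =
  f ⊚ lift (lift h) ,
      trans (cong (λ u → to f (𝟙 ∷ 𝟙 ∷ u)) (to-zero h)) fx₀≡x , (begin
      to f (𝟘 ∷ 𝟘 ∷ to h x₀)  ≡⟨ cong (λ u → to f (𝟘 ∷ 𝟘 ∷ u)) (proj₂ moved) ⟩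
      to f (𝟘 ∷ 𝟘 ∷ w′)       ≡⟨ cong (to f) (sym w≡) ⟩
      to f w                  ≡⟨ to-from f y ⟩
      y                       ∎)
  where
  open ≡-Reasoning
  w = from f y
  w′ = Vec.tail (Vec.tail w)
  pull : ∀ u v → to f u ≡ v → ⟨ w , u ⟩ ≡ ⟨ y , v ⟩
  pull u v fu≡v = trans (sym (to-⟨⟩ f w u)) (cong₂ ⟨_,_⟩ (to-from f y) fu≡v)
  w≡ : w ≡ 𝟘 ∷ 𝟘 ∷ w′
  w≡ = ⊥x₀y₀⇒0∷0∷ w (trans (pull x₀ x fx₀≡x) yx≡0) (trans (pull y₀ z fy₀≡z) yz≡0)
  w′≢0 : w′ ≢ 0⃗
  w′≢0 eq = y≢0 (begin
    y                   ≡⟨ sym (to-from f y) ⟩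
    to f w              ≡⟨ cong (to f) (trans w≡ (cong (λ u → 𝟘 ∷ 𝟘 ∷ u) eq)) ⟩
    to f 0⃗              ≡⟨ to-zero f ⟩
    0⃗                   ∎)
  moved = move-isotropic w′ w′≢0 (trans (sym (cong₂ ⟨_,_⟩ w≡ w≡)) (trans (from-⟨⟩ f y y) yy≡0))
  h = proj₁ moved

move-orthogonal : ∀ {n} (x y : 𝔽₄^ (4 ℕ.+ n)) → x ≢ 0⃗ → Isotropic x → Isotropic y → ⟨ x , y ⟩ ≡ 𝟘 →
                  ¬ (∃ λ c → y ≡ c • x) → ∃ λ (f : Isometry (4 ℕ.+ n)) → to f x₀ ≡ x × to f z₀ ≡ y
move-orthogonal x y x≢0 xx≡0 yy≡0 xy≡0 independent =
  let yx≡0                             = trans (⟨⟩-swap x y) (cong (_↑ 2) xy≡0)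
      z , xz≡1 , yz≡0                  = dual-vector₂ x y x≢0 independent
      z′ , z′z′≡0 , xz′≡1 , orthogonal = hyperbolic-partner x z xx≡0 xz≡1
      f , fx₀≡x , fy₀≡z′               = move-hyperbolic x z′ xx≡0 z′z′≡0 xz′≡1
  in extend-hyperbolic x y z′ f fx₀≡x fy₀≡z′ (λ y≡0 → independent (𝟘 , trans y≡0 (sym (•-zeroˡ x))))
       yy≡0 yx≡0 (orthogonal y yx≡0 yz≡0)

-- Unitary matrices

·-• : ∀ {m n} c (x : 𝔽₄^ m) (U : 𝔽₄^[ m × n ]) → (c • x) · U ≡ c • (x · U)
·-• c [] []           = sym (•-zeroʳ c)
·-• c (a ∷ x) (u ∷ U) = trans (cong₂ _⊹_ (•-assoc c a u) (·-• c x U)) (sym (•-distribˡ c (a • u) (x · U)))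

∑ᶠ : ∀ {m} → 𝔽₄^ m → (Fin m → 𝔽₄) → 𝔽₄
∑ᶠ []      g = 𝟘
∑ᶠ (a ∷ x) g = (a ⊗ g zero) ⊕ ∑ᶠ x (g ∘ suc)

∑ᶠ-cong : ∀ {m} (x : 𝔽₄^ m) {g h : Fin m → 𝔽₄} → (∀ k → g k ≡ h k) → ∑ᶠ x g ≡ ∑ᶠ x h
∑ᶠ-cong []      eq = refl
∑ᶠ-cong (a ∷ x) eq = cong₂ _⊕_ (cong (a ⊗_) (eq zero)) (∑ᶠ-cong x (eq ∘ suc))

∑ᶠ-zero : ∀ {m} (x : 𝔽₄^ m) → ∑ᶠ x (λ _ → 𝟘) ≡ 𝟘
∑ᶠ-zero []      = refl
∑ᶠ-zero (a ∷ x) = cong₂ _⊕_ (⊗-zeroʳ a) (∑ᶠ-zero x)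

∑ᶠ-δ : ∀ {m} (x : 𝔽₄^ m) l → ∑ᶠ x (λ k → δ k l) ≡ lookup x l
∑ᶠ-δ (a ∷ x) zero    = trans (cong₂ _⊕_ (⊗-comm a 𝟙) (∑ᶠ-zero x)) (⊕-identityʳ a)
∑ᶠ-δ (a ∷ x) (suc l) = cong₂ _⊕_ (⊗-zeroʳ a) (∑ᶠ-δ x l)

∑ᶠ-lookup : ∀ {m} (x y : 𝔽₄^ m) → ∑ᶠ x (λ k → lookup y k ↑ 2) ≡ ⟨ x , y ⟩
∑ᶠ-lookup [] []           = refl
∑ᶠ-lookup (a ∷ x) (b ∷ y) = cong (a ⊗ b ↑ 2 ⊕_) (∑ᶠ-lookup x y)

⟨·⟩ : ∀ {m n} (x : 𝔽₄^ m) (U : 𝔽₄^[ m × n ]) z → ⟨ x · U , z ⟩ ≡ ∑ᶠ x (λ k → ⟨ lookup U k , z ⟩)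
⟨·⟩ [] [] z           = ⟨⟩-zeroˡ z
⟨·⟩ (a ∷ x) (u ∷ U) z = trans (⟨⟩-⊹ˡ (a • u) (x · U) z) (cong₂ _⊕_ (⟨⟩-•ˡ a u z) (⟨·⟩ x U z))

module _ {n} {U : 𝔽₄^[ n × n ]} (unitary : InGU U) where

  -- The rows are orthonormal, so pairing with them reads off coordinates. Preservation of the form
  -- and injectivity both follow from this.
  ·-coordinate : ∀ x l → ⟨ x · U , lookup U l ⟩ ≡ lookup x l
  ·-coordinate x l = trans (⟨·⟩ x U (lookup U l)) (trans (∑ᶠ-cong x λ k → unitary k l) (∑ᶠ-δ x l))

  ·-⟨⟩ : ∀ x y → ⟨ x · U , y · U ⟩ ≡ ⟨ x , y ⟩
  ·-⟨⟩ x y = trans (⟨·⟩ x U (y · U)) (trans (∑ᶠ-cong x λ k →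
    trans (⟨⟩-swap (y · U) (lookup U k)) (cong (_↑ 2) (·-coordinate y k))) (∑ᶠ-lookup x y))

  ·-injective : ∀ x y → x · U ≡ y · U → x ≡ y
  ·-injective x y eq = begin
    x                      ≡⟨ Vecₚ.tabulate∘lookup x ⟨
    tabulate (lookup x)
      ≡⟨ Vecₚ.tabulate-cong (λ l → trans (sym (·-coordinate x l)) (trans (cong ⟨_, lookup U l ⟩ eq) (·-coordinate y l))) ⟩
    tabulate (lookup y)    ≡⟨ Vecₚ.tabulate∘lookup y ⟩
    y                      ∎
    where open ≡-Reasoning

matrix : ∀ {n} → Isometry n → 𝔽₄^[ n × n ]
matrix f = tabulate (to f ∘ unit)

matrix-InGU : ∀ {n} (f : Isometry n) → InGU (matrix f)
matrix-InGU f k l = begin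
  ⟨ lookup (matrix f) k , lookup (matrix f) l ⟩
    ≡⟨ cong₂ ⟨_,_⟩ (Vecₚ.lookup∘tabulate (to f ∘ unit) k) (Vecₚ.lookup∘tabulate (to f ∘ unit) l) ⟩
  ⟨ to f (unit k) , to f (unit l) ⟩               ≡⟨ to-⟨⟩ f (unit k) (unit l) ⟩
  ⟨ unit k , unit l ⟩                             ≡⟨ ⟨⟩-unitʳ (unit k) l ⟩
  lookup (unit k) l                               ≡⟨ lookup-unit k l ⟩
  δ k l                                           ∎
  where open ≡-Reasoning

-- Linearity takes f out of the row combination, and what is left inside is the identity matrix.
·-matrix : ∀ {n} (f : Isometry n) x → x · matrix f ≡ to f x
·-matrix f x = trans (linear x unit) (cong (to f) (identity x))
  where
  linear : ∀ {m} (x : 𝔽₄^ m) (b : Fin m → 𝔽₄^ _) → x · tabulate (to f ∘ b) ≡ to f (x · tabulate b)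
  linear [] b      = sym (to-zero f)
  linear (a ∷ x) b = trans (cong₂ _⊹_ (sym (to-• f a (b zero))) (linear x (b ∘ suc)))
                           (sym (to-⊹ f (a • b zero) (x · tabulate (b ∘ suc))))
  pad : ∀ {m n} (x : 𝔽₄^ m) (b : Fin m → 𝔽₄^ n) → x · tabulate (λ k → 𝟘 ∷ b k) ≡ 𝟘 ∷ x · tabulate b
  pad [] b      = refl
  pad (a ∷ x) b = trans (cong ((a • (𝟘 ∷ b zero)) ⊹_) (pad x (b ∘ suc)))
                        (∷-cong (trans (⊕-identityʳ (a ⊗ 𝟘)) (⊗-zeroʳ a)) refl)
  identity : ∀ {m} (x : 𝔽₄^ m) → x · tabulate unit ≡ x
  identity []      = refl
  identity (a ∷ x) = trans (cong ((a • unit zero) ⊹_) (pad x unit))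
    (∷-cong (trans (⊕-identityʳ (a ⊗ 𝟙)) (⊗-comm a 𝟙)) (trans (cong₂ _⊹_ (•-zeroʳ a) (identity x)) (⊹-identityˡ x)))

-- Orbitals

-- The proof fields of Φ are irrelevant, which makes points with equal vectors equal; their content
-- is recovered here by deciding it again.
isotropicᶲ : ∀ {n} (x : Φ n) → Isotropic (vec x)
isotropicᶲ (mkΦ x _ xx≡0) = recompute (⟨ x , x ⟩ ≟ 𝟘) xx≡0

nonzeroᶲ : ∀ {n} (x : Φ n) → vec x ≢ 0⃗
nonzeroᶲ (mkΦ x x≢0 _) = recompute (¬? (x ≟ᵛ 0⃗)) x≢0

vec-injective : ∀ {n} (x y : Φ n) → vec x ≡ vec y → x ≡ y
vec-injective (mkΦ x _ _) (mkΦ _ _ _) refl = refl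

isometry⇒orbital : ∀ {n} (x y x′ y′ : Φ n) (f : Isometry n) → to f (vec x) ≡ vec x′ → to f (vec y) ≡ vec y′ →
                   InOrbital x y x′ y′
isometry⇒orbital x y x′ y′ f fx fy =
  matrix f , matrix-InGU f , trans (·-matrix f (vec x)) fx , trans (·-matrix f (vec y)) fy

scale : ∀ {n} c → c ≢ 𝟘 → Φ n → Φ n
scale c c≢0 (mkΦ x x≢0 xx≡0) = mkΦ (c • x)
  (λ cx≡0 → x≢0 (trans (sym (undo c x c≢0)) (trans (cong ((c ↑ 2) •_) cx≡0) (•-zeroʳ (c ↑ 2)))))
  (trans (⟨⟩-•ˡ c x (c • x)) (trans (cong (c ⊗_) (trans (⟨⟩-•ʳ c x x) (trans (cong (c ↑ 2 ⊗_) xx≡0) (⊗-zeroʳ (c ↑ 2))))) (⊗-zeroʳ c)))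
  where
  undo : ∀ {n} c (x : 𝔽₄^ n) → c ≢ 𝟘 → (c ↑ 2) • (c • x) ≡ x
  undo c x c≢0 = trans (sym (•-assoc (c ↑ 2) c x)) (trans (cong (_• x) (↑2-inverse c c≢0)) (•-identity x))

X₀ Y₀ : ∀ {n} → Φ (suc (suc n))
X₀ {n} = mkΦ x₀ (λ ()) (cong (λ a → 𝟙 ⊕ (𝟙 ⊕ a)) (⟨⟩-zeroˡ (0⃗ {n})))
Y₀ {n} = mkΦ y₀ (λ ()) (cong (λ a → 𝟙 ⊕ (𝟙 ⊕ a)) (⟨⟩-zeroˡ (0⃗ {n})))

Z₀ : ∀ {n} → Φ (4 ℕ.+ n)
Z₀ {n} = mkΦ z₀ (λ ()) (cong (λ a → 𝟙 ⊕ (𝟙 ⊕ a)) (⟨⟩-zeroˡ (0⃗ {n})))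

identity-orbital : ∀ {n} (x y : Φ n) → InOrbital x y x y
identity-orbital x y = isometry⇒orbital x y x y identity refl refl
  where
  identity : Isometry _
  identity = record
    { to      = λ x → x
    ; from    = λ x → x
    ; to-⊹    = λ _ _ → refl
    ; to-•    = λ _ _ → refl
    ; to-⟨⟩   = λ _ _ → refl
    ; to-from = λ _ → refl
    }

-- Names a relation by the scalar or the product itself instead of an exponent of α, so that
-- disjointness and transitivity are argued once for both primitive elements.
data Kind : Set where
  scalar product : 𝔽₄ → Kind
  perp           : Kind

Rel : ∀ {n} → Kind → Φ n → Φ n → Set
Rel (scalar c)  x y = vec y ≡ c • vec x
Rel (product c) x y = ⟨ vec x , vec y ⟩ ≡ c
Rel perp        x y = ⟨ vec x , vec y ⟩ ≡ 𝟘 × ¬ (∃ λ c → vec y ≡ c • vec x)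

-- No scalar belongs to `perp`; a true inequality fills its place.
Nonzero : Kind → Set
Nonzero (scalar c)  = c ≢ 𝟘
Nonzero (product c) = c ≢ 𝟘
Nonzero perp        = 𝟙 ≢ 𝟘

Rel-pairing : ∀ {n} c (x y : Φ n) → Rel (scalar c) x y → ⟨ vec x , vec y ⟩ ≡ 𝟘
Rel-pairing c x y y≡cx = trans (cong ⟨ vec x ,_⟩ y≡cx) (trans (⟨⟩-•ʳ c (vec x) (vec x))
  (trans (cong (c ↑ 2 ⊗_) (isotropicᶲ x)) (⊗-zeroʳ (c ↑ 2))))

•-cancelʳ : ∀ {n} c d (x : 𝔽₄^ n) → x ≢ 0⃗ → c • x ≡ d • x → c ≡ d
•-cancelʳ c d x x≢0 cx≡dx with nonzero-coordinate x x≢0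
... | k , xₖ≢0 = cancel (lookup x k) xₖ≢0 c d
      (trans (sym (Vecₚ.lookup-map k (c ⊗_) x)) (trans (cong (λ y → lookup y k) cx≡dx) (Vecₚ.lookup-map k (d ⊗_) x)))
  where
  cancel : ∀ a → a ≢ 𝟘 → ∀ c d → c ⊗ a ≡ d ⊗ a → c ≡ d
  cancel = from-yes (∀? λ a → ¬? (a ≟ 𝟘) →-dec (∀? λ c → ∀? λ d → ((c ⊗ a) ≟ (d ⊗ a)) →-dec (c ≟ d)))

Rel-unique : ∀ {n} k l (x y : Φ n) → Nonzero k → Nonzero l → Rel k x y → Rel l x y → k ≡ l
Rel-unique (scalar c)  (scalar d)  x y _   _   p q = cong scalar (•-cancelʳ c d (vec x) (nonzeroᶲ x) (trans (sym p) q))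
Rel-unique (scalar c)  (product d) x y _   d≢0 p q = contradiction (trans (sym q) (Rel-pairing c x y p)) d≢0
Rel-unique (scalar c)  perp        x y _   _   p q = contradiction (c , p) (proj₂ q)
Rel-unique (product c) (scalar d)  x y c≢0 _   p q = contradiction (trans (sym p) (Rel-pairing d x y q)) c≢0
Rel-unique (product c) (product d) x y _   _   p q = cong product (trans (sym p) q)
Rel-unique (product c) perp        x y c≢0 _   p q = contradiction (trans (sym p) (proj₁ q)) c≢0
Rel-unique perp        (scalar d)  x y _   _   p q = contradiction (d , q) (proj₂ p)
Rel-unique perp        (product d) x y _   d≢0 p q = contradiction (trans (sym q) (proj₁ p)) d≢0
Rel-unique perp        perp        x y _   _   p q = refl

classify : ∀ {n} (x y : Φ n) → ∃ λ k → Nonzero k × Rel k x y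
classify x y with ⟨ vec x , vec y ⟩ ≟ 𝟘
... | no xy≢0  = product ⟨ vec x , vec y ⟩ , xy≢0 , refl
... | yes xy≡0 with ∀? (λ c → ¬? (vec y ≟ᵛ (c • vec x)))
...   | yes none = perp , (λ ()) , xy≡0 , λ { (c , y≡cx) → none c y≡cx }
...   | no ¬none with vec y ≟ᵛ (𝟙 • vec x) | vec y ≟ᵛ (ζ • vec x) | vec y ≟ᵛ (ζ² • vec x)
...     | yes p | _     | _     = scalar 𝟙 , (λ ()) , p
...     | no _  | yes p | _     = scalar ζ , (λ ()) , p
...     | no _  | no _  | yes p = scalar ζ² , (λ ()) , p
-- The scalar 𝟘 would make y the zero vector, so all four scalars fail, against `¬none`.
...     | no p  | no q  | no r  = contradiction
          (λ { 𝟘 y≡0 → nonzeroᶲ y (trans y≡0 (•-zeroˡ (vec x))) ; 𝟙 → p ; ζ → q ; ζ² → r }) ¬none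

IsOrbital : ∀ {n} → (Φ n → Φ n → Set) → Set
IsOrbital R = ∃₂ λ x y → ∀ x′ y′ → R x′ y′ ⇔ InOrbital x y x′ y′

Rel-invariant : ∀ {n} k (x y x′ y′ : Φ n) → Rel k x y → InOrbital x y x′ y′ → Rel k x′ y′
Rel-invariant (scalar c) x y x′ y′ r (U , unitary , xU , yU) =
  trans (sym yU) (trans (cong (_· U) r) (trans (·-• c (vec x) U) (cong (c •_) xU)))
Rel-invariant (product c) x y x′ y′ r (U , unitary , xU , yU) =
  trans (cong₂ ⟨_,_⟩ (sym xU) (sym yU)) (trans (·-⟨⟩ {U = U} unitary (vec x) (vec y)) r)
Rel-invariant perp x y x′ y′ (r , independent) (U , unitary , xU , yU) =
  trans (cong₂ ⟨_,_⟩ (sym xU) (sym yU)) (trans (·-⟨⟩ {U = U} unitary (vec x) (vec y)) r) ,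
  -- A dependence between the images pulls back because x ↦ xU is injective and linear.
  λ { (c , y′≡cx′) → independent (c , ·-injective {U = U} unitary (vec y) (c • vec x)
        (trans yU (trans y′≡cx′ (trans (cong (c •_) (sym xU)) (sym (·-• c (vec x) U)))))) }

Rel-X₀Z₀ : ∀ {n} → Rel perp (X₀ {suc (suc n)}) Z₀
Rel-X₀Z₀ {n} = ⟨⟩-zeroˡ (x₀ {n}) , λ { (𝟘 , ()) ; (𝟙 , ()) ; (ζ , ()) ; (ζ² , ()) }

Rel-X₀Y₀ : ∀ {n} → ⟨ x₀ {n} , y₀ ⟩ ≡ 𝟙
Rel-X₀Y₀ {n} = cong (λ a → ζ² ⊕ (ζ ⊕ a)) (⟨⟩-zeroˡ (0⃗ {n}))

-- Each kind has a standard pair. For a product c the vector y is rescaled to cy, so that ⟨x,cy⟩ =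
-- c²c = 1 and hyperbolic pairs can be moved; multiplication by c² undoes the rescaling.
Rel-orbital : ∀ {n} k → Nonzero k → IsOrbital (Rel {4 ℕ.+ n} k)
Rel-orbital (scalar c) c≢0 = X₀ , scale c c≢0 X₀ , λ x y → mk⇔
  (λ y≡cx →
    let f , fx₀≡x = move-isotropic (vec x) (nonzeroᶲ x) (isotropicᶲ x)
    in isometry⇒orbital X₀ (scale c c≢0 X₀) x y f fx₀≡x (trans (to-• f c x₀) (trans (cong (c •_) fx₀≡x) (sym y≡cx))))
  (Rel-invariant (scalar c) X₀ (scale c c≢0 X₀) x y refl)
Rel-orbital {n} (product c) c≢0 = X₀ , cY₀ , λ x y → mk⇔
  (λ xy≡c →
    let f , fx₀≡x , fy₀≡cy = move-hyperbolic (vec x) (c • vec y) (isotropicᶲ x) (isotropicᶲ (scale c c≢0 y))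
                               (trans (⟨⟩-•ʳ c (vec x) (vec y)) (trans (cong (c ↑ 2 ⊗_) xy≡c) (↑2-inverse c c≢0)))
    in isometry⇒orbital X₀ cY₀ x y f fx₀≡x (trans (to-• f (c ↑ 2) y₀) (trans (cong ((c ↑ 2) •_) fy₀≡cy)
         (trans (sym (•-assoc (c ↑ 2) c (vec y))) (trans (cong (_• vec y) (↑2-inverse c c≢0)) (•-identity (vec y)))))))
  (Rel-invariant (product c) X₀ cY₀ x y
    (trans (⟨⟩-•ʳ (c ↑ 2) (x₀ {suc (suc n)}) y₀) (trans (cong ((c ↑ 2) ↑ 2 ⊗_) (Rel-X₀Y₀ {suc (suc n)})) (trans (⊗-comm _ 𝟙) (↑2-involutive c)))))
  where
  square≢0 : ∀ c → c ≢ 𝟘 → c ↑ 2 ≢ 𝟘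
  square≢0 = from-yes (∀? λ c → ¬? (c ≟ 𝟘) →-dec ¬? ((c ↑ 2) ≟ 𝟘))
  -- Conjugation turns the factor c² into c⁴ = c, so ⟨x₀, c²y₀⟩ = c.
  cY₀ = scale (c ↑ 2) (square≢0 c c≢0) Y₀
Rel-orbital perp _ = X₀ , Z₀ , λ x y → mk⇔
  (λ { (xy≡0 , independent) →
    let f , fx₀≡x , fz₀≡y = move-orthogonal (vec x) (vec y) (nonzeroᶲ x) (isotropicᶲ x) (isotropicᶲ y) xy≡0 independent
    in isometry⇒orbital X₀ Z₀ x y f fx₀≡x fz₀≡y })
  (Rel-invariant perp X₀ Z₀ x y Rel-X₀Z₀)

kind : 𝔽₄ → Fin 7 → Kind
kind α 0F = scalar (α ↑ 0)
kind α 1F = scalar (α ↑ 1)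
kind α 2F = scalar (α ↑ 2)
kind α 3F = product (α ↑ 3)
kind α 4F = product (α ↑ 4)
kind α 5F = product (α ↑ 5)
kind α 6F = perp

ℛ⇒Rel : ∀ {n} α l (x y : Φ n) → ℛ α l x y → Rel (kind α l) x y
ℛ⇒Rel α 0F x y r = r
ℛ⇒Rel α 1F x y r = r
ℛ⇒Rel α 2F x y r = r
ℛ⇒Rel α 3F x y r = r
ℛ⇒Rel α 4F x y r = r
ℛ⇒Rel α 5F x y r = r
ℛ⇒Rel α 6F x y r = r

Rel⇒ℛ : ∀ {n} α l (x y : Φ n) → Rel (kind α l) x y → ℛ α l x y
Rel⇒ℛ α 0F x y r = r
Rel⇒ℛ α 1F x y r = r
Rel⇒ℛ α 2F x y r = r
Rel⇒ℛ α 3F x y r = r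
Rel⇒ℛ α 4F x y r = r
Rel⇒ℛ α 5F x y r = r
Rel⇒ℛ α 6F x y r = r

module _ {α : 𝔽₄} (α-cases : α ≡ ζ ⊎ α ≡ ζ²) where

  -- The last branches stand for α², the only remaining nonzero scalar; `Nonzero` keeps 𝟘 away from
  -- them.
  index : Kind → Fin 7
  index (scalar c)  = if does (c ≟ 𝟙) then 0F else if does (c ≟ α) then 1F else 2F
  index (product c) = if does (c ≟ 𝟙) then 3F else if does (c ≟ α) then 4F else 5F
  index perp        = 6F

  index-kind : ∀ l → index (kind α l) ≡ l
  index-kind = cases α-cases
    where
    cases : α ≡ ζ ⊎ α ≡ ζ² → ∀ l → index (kind α l) ≡ l
    cases (inj₁ refl) = from-yes (Fin.all? λ l → index (kind ζ l) Fin.≟ l)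
    cases (inj₂ refl) = from-yes (Fin.all? λ l → index (kind ζ² l) Fin.≟ l)

  kind-index : ∀ k → Nonzero k → kind α (index k) ≡ k
  kind-index k k≢0 = cases α-cases k k≢0
    where
    cases : α ≡ ζ ⊎ α ≡ ζ² → ∀ k → Nonzero k → kind α (index k) ≡ k
    cases _           (scalar 𝟘)   k≢0 = contradiction refl k≢0
    cases _           (product 𝟘)  k≢0 = contradiction refl k≢0
    cases (inj₁ refl) (scalar 𝟙)   _ = refl
    cases (inj₁ refl) (scalar ζ)   _ = refl
    cases (inj₁ refl) (scalar ζ²)  _ = refl
    cases (inj₁ refl) (product 𝟙)  _ = refl
    cases (inj₁ refl) (product ζ)  _ = refl
    cases (inj₁ refl) (product ζ²) _ = refl
    cases (inj₁ refl) perp         _ = refl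
    cases (inj₂ refl) (scalar 𝟙)   _ = refl
    cases (inj₂ refl) (scalar ζ)   _ = refl
    cases (inj₂ refl) (scalar ζ²)  _ = refl
    cases (inj₂ refl) (product 𝟙)  _ = refl
    cases (inj₂ refl) (product ζ)  _ = refl
    cases (inj₂ refl) (product ζ²) _ = refl
    cases (inj₂ refl) perp         _ = refl

  kind-nonzero : ∀ l → Nonzero (kind α l)
  kind-nonzero = cases α-cases
    where
    cases : α ≡ ζ ⊎ α ≡ ζ² → ∀ l → Nonzero (kind α l)
    cases (inj₁ refl) = λ { 0F () ; 1F () ; 2F () ; 3F () ; 4F () ; 5F () ; 6F () }
    cases (inj₂ refl) = λ { 0F () ; 1F () ; 2F () ; 3F () ; 4F () ; 5F () ; 6F () }

  ℛ-unique : ∀ {n} k l (x y : Φ n) → ℛ α k x y → ℛ α l x y → k ≡ l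
  ℛ-unique k l x y p q = trans (sym (index-kind k)) (trans (cong index
    (Rel-unique (kind α k) (kind α l) x y (kind-nonzero k) (kind-nonzero l) (ℛ⇒Rel α k x y p) (ℛ⇒Rel α l x y q)))
    (index-kind l))

  ℛ-total : ∀ {n} (x y : Φ n) → ∃ λ l → ℛ α l x y
  ℛ-total x y =
    let k , k≢0 , r = classify x y
    in index k , Rel⇒ℛ α (index k) x y (subst (λ k → Rel k x y) (sym (kind-index k k≢0)) r)

  ℛ-orbitals : ∀ {n} → AreTheOrbitals {4 ℕ.+ n} (ℛ α)
  ℛ-orbitals = record
    { partition = λ x y → let l , r = ℛ-total x y in l , r , λ {k} → ℛ-unique l k x y r
    ; orbital   = λ l → let x , y , h = Rel-orbital (kind α l) (kind-nonzero l) in x , y , λ x′ y′ →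
        mk⇔ (Equivalence.to (h x′ y′) ∘ ℛ⇒Rel α l x′ y′) (Rel⇒ℛ α l x′ y′ ∘ Equivalence.from (h x′ y′))
    }

-- Real and complex numbers

-- Equality of reals says that a difference is null. Congruence of the operations thus becomes
-- closure of null sequences under sums, negation and multiplication by a Cauchy sequence, which is
-- bounded.
IsNull : (ℕ → ℚ) → Set
IsNull u = ∀ ε → 0ℚ ℚ.< ε → ∃ λ N → ∀ n → N ℕ.≤ n → ℚ.∣ u n ∣ ℚ.< ε

null-cong : ∀ {u v} → (∀ n → u n ≡ v n) → IsNull u → IsNull v
null-cong eq null ε 0<ε =
  let N , h = null ε 0<ε in N , λ n N≤n → subst (λ q → ℚ.∣ q ∣ ℚ.< ε) (eq n) (h n N≤n)

null-zero : IsNull (λ _ → 0ℚ)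
null-zero ε 0<ε = 0 , λ _ _ → 0<ε

null-+ : ∀ {u v} → IsNull u → IsNull v → IsNull (λ n → u n ℚ.+ v n)
null-+ {u} {v} u→0 v→0 ε 0<ε =
  let M , hu = u→0 (½ ℚ.* ε) (halve ε 0<ε)
      N , hv = v→0 (½ ℚ.* ε) (halve ε 0<ε)
  in M ℕ.⊔ N , λ n n≥ → begin-strict
    ℚ.∣ u n ℚ.+ v n ∣            ≤⟨ ℚₚ.∣p+q∣≤∣p∣+∣q∣ (u n) (v n) ⟩
    ℚ.∣ u n ∣ ℚ.+ ℚ.∣ v n ∣      <⟨ ℚₚ.+-mono-< (hu n (ℕₚ.m⊔n≤o⇒m≤o M N n≥)) (hv n (ℕₚ.m⊔n≤o⇒n≤o M N n≥)) ⟩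
    ½ ℚ.* ε ℚ.+ ½ ℚ.* ε          ≡⟨ halves ε ⟩
    ε                            ∎
  where open ℚₚ.≤-Reasoning

null-neg : ∀ {u} → IsNull u → IsNull (λ n → ℚ.- u n)
null-neg {u} u→0 ε 0<ε =
  let N , h = u→0 ε 0<ε in N , λ n N≤n → subst (ℚ._< ε) (sym (ℚₚ.∣-p∣≡∣p∣ (u n))) (h n N≤n)

product-bound : ∀ B → 0ℚ ℚ.< B → ∀ ε → 0ℚ ℚ.< ε →
  ∃ λ δ → 0ℚ ℚ.< δ × (∀ p q → ℚ.∣ p ∣ ℚ.≤ B → ℚ.∣ q ∣ ℚ.< δ → ℚ.∣ p ℚ.* q ∣ ℚ.< ε)
product-bound B 0<B ε 0<ε = quotient , quotient-pos , bound
  where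
  open ℚₚ.≤-Reasoning
  B⁻¹ : ℚ
  B⁻¹ = (ℚ.1/ B) {{ℚₚ.pos⇒nonZero B {{ℚ.positive 0<B}}}}
  quotient : ℚ
  quotient = B⁻¹ ℚ.* ε
  quotient-pos : 0ℚ ℚ.< quotient
  quotient-pos = ℚₚ.positive⁻¹ quotient
    {{ℚₚ.pos*pos⇒pos B⁻¹ {{ℚₚ.1/pos⇒pos B {{ℚ.positive 0<B}}}} ε {{ℚ.positive 0<ε}}}}
  bound : ∀ p q → ℚ.∣ p ∣ ℚ.≤ B → ℚ.∣ q ∣ ℚ.< quotient → ℚ.∣ p ℚ.* q ∣ ℚ.< ε
  bound p q p≤B q< = begin-strict
    ℚ.∣ p ℚ.* q ∣            ≡⟨ ℚₚ.∣p*q∣≡∣p∣*∣q∣ p q ⟩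
    ℚ.∣ p ∣ ℚ.* ℚ.∣ q ∣      ≤⟨ ℚₚ.*-monoʳ-≤-nonNeg ℚ.∣ q ∣ {{ℚₚ.∣-∣-nonNeg q}} p≤B ⟩
    B ℚ.* ℚ.∣ q ∣            <⟨ ℚₚ.*-monoʳ-<-pos B {{ℚ.positive 0<B}} q< ⟩
    B ℚ.* (B⁻¹ ℚ.* ε)        ≡⟨ ℚₚ.*-assoc B B⁻¹ ε ⟨
    B ℚ.* B⁻¹ ℚ.* ε          ≡⟨ cong (ℚ._* ε) (ℚₚ.*-inverseʳ B {{ℚₚ.pos⇒nonZero B {{ℚ.positive 0<B}}}}) ⟩
    1ℚ ℚ.* ε                 ≡⟨ ℚₚ.*-identityˡ ε ⟩
    ε                        ∎

null-* : ∀ (x : ℝ) {u} → IsNull u → IsNull (λ n → seq x n ℚ.* u n)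
null-* x {u} u→0 ε 0<ε =
  let M , B , 0<B , x≤B = eventually-bounded x
      δ , 0<δ , bound   = product-bound B 0<B ε 0<ε
      N , u<δ           = u→0 δ 0<δ
  in M ℕ.⊔ N , λ n n≥ → bound (seq x n) (u n) (x≤B n (ℕₚ.m⊔n≤o⇒m≤o M N n≥)) (u<δ n (ℕₚ.m⊔n≤o⇒n≤o M N n≥))

¼ 3ℚ : ℚ
¼  = + 1 ℚ./ 4
3ℚ = + 3 ℚ./ 1

-- A ring solver for K with rational coefficients embedded by ι, so that constants such as ½ are
-- normalised and not treated as variables.
module RationalSolver
  (K : CommutativeRing 0ℓ 0ℓ) (ι : ℚ → CommutativeRing.Carrier K)
  (ι-homo : IsRingHomomorphism ℚ.+-*-rawRing (CommutativeRing.rawRing K) ι)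
  where

  private module H = IsRingHomomorphism ι-homo

  morphism : ℚ.+-*-rawRing -Raw-AlmostCommutative⟶ fromCommutativeRing K
  morphism = record
    { ⟦_⟧    = ι
    ; +-homo = H.+-homo
    ; *-homo = H.*-homo
    ; -‿homo = H.-‿homo
    ; 0-homo = H.0#-homo
    ; 1-homo = H.1#-homo
    }

  weaklyDecidable : WeaklyDecidable (Induced-equivalence morphism)
  weaklyDecidable p q with p ℚₚ.≟ q
  ... | yes p≡q = just (H.⟦⟧-cong p≡q)
  ... | no _    = nothing

  open Solver ℚ.+-*-rawRing (fromCommutativeRing K) morphism weaklyDecidable public

-- A pair (a , b) stands for a + bi; K is arbitrary because the operations of ℚ itself would unfold.
module ComplexIdentities
  (K : CommutativeRing 0ℓ 0ℓ) (ι : ℚ → CommutativeRing.Carrier K)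
  (ι-homo : IsRingHomomorphism ℚ.+-*-rawRing (CommutativeRing.rawRing K) ι)
  where

  open CommutativeRing K renaming (refl to ≈-refl; sym to ≈-sym; trans to ≈-trans)
  open RationalSolver K ι ι-homo

  flip-difference : ∀ p q → - (p - q) ≈ q - p
  flip-difference = solve 2 (λ p q → :- (p :- q) := q :- p) ≈-refl

  telescope : ∀ p q r → (p - q) + (q - r) ≈ p - r
  telescope = solve 3 (λ p q r → (p :- q) :+ (q :- r) := p :- r) ≈-refl

  +-difference : ∀ a b c d → (a - b) + (c - d) ≈ (a + c) - (b + d)
  +-difference = solve 4 (λ a b c d → (a :- b) :+ (c :- d) := (a :+ c) :- (b :+ d)) ≈-refl

  negate-difference : ∀ p q → - (p - q) ≈ - p - - q
  negate-difference = solve 2 (λ p q → :- (p :- q) := :- p :- :- q) ≈-refl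

  *-difference : ∀ a b c d → a * (c - d) + d * (a - b) ≈ a * c - b * d
  *-difference = solve 4 (λ a b c d → a :* (c :- d) :+ d :* (a :- b) := a :* c :- b :* d) ≈-refl

  *-assoc-re : ∀ a b c d e f → (a * c + - (b * d)) * e + - ((a * d + b * c) * f)
                             ≈ a * (c * e + - (d * f)) + - (b * (c * f + d * e))
  *-assoc-re = solve 6 (λ a b c d e f → (a :* c :+ :- (b :* d)) :* e :+ :- ((a :* d :+ b :* c) :* f)
                                     := a :* (c :* e :+ :- (d :* f)) :+ :- (b :* (c :* f :+ d :* e))) ≈-refl

  *-assoc-im : ∀ a b c d e f → (a * c + - (b * d)) * f + (a * d + b * c) * e
                             ≈ a * (c * f + d * e) + b * (c * e + - (d * f))
  *-assoc-im = solve 6 (λ a b c d e f → (a :* c :+ :- (b :* d)) :* f :+ (a :* d :+ b :* c) :* e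
                                     := a :* (c :* f :+ d :* e) :+ b :* (c :* e :+ :- (d :* f))) ≈-refl

  *-identityˡ-re : ∀ a b → ι 1ℚ * a + - (ι 0ℚ * b) ≈ a
  *-identityˡ-re = solve 2 (λ a b → con 1ℚ :* a :+ :- (con 0ℚ :* b) := a) ≈-refl

  *-identityˡ-im : ∀ a b → ι 1ℚ * b + ι 0ℚ * a ≈ b
  *-identityˡ-im = solve 2 (λ a b → con 1ℚ :* b :+ con 0ℚ :* a := b) ≈-refl

  *-distribˡ-re : ∀ a b c d e f → a * (c + e) + - (b * (d + f)) ≈ (a * c + - (b * d)) + (a * e + - (b * f))
  *-distribˡ-re = solve 6 (λ a b c d e f → a :* (c :+ e) :+ :- (b :* (d :+ f))
                                        := (a :* c :+ :- (b :* d)) :+ (a :* e :+ :- (b :* f))) ≈-refl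

  *-distribˡ-im : ∀ a b c d e f → a * (d + f) + b * (c + e) ≈ (a * d + b * c) + (a * f + b * e)
  *-distribˡ-im = solve 6 (λ a b c d e f → a :* (d :+ f) :+ b :* (c :+ e)
                                        := (a :* d :+ b :* c) :+ (a :* f :+ b :* e)) ≈-refl

  *-comm-re : ∀ a b c d → a * c + - (b * d) ≈ c * a + - (d * b)
  *-comm-re = solve 4 (λ a b c d → a :* c :+ :- (b :* d) := c :* a :+ :- (d :* b)) ≈-refl

  *-comm-im : ∀ a b c d → a * d + b * c ≈ c * b + d * a
  *-comm-im = solve 4 (λ a b c d → a :* d :+ b :* c := c :* b :+ d :* a) ≈-refl

  factor-square : ∀ A K R u → A * ((K * u) * (K * u)) - (R * u) * (R * u) ≈ (A * (K * K) - R * R) * (u * u)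
  factor-square = solve 4 (λ A K R u → A :* ((K :* u) :* (K :* u)) :- (R :* u) :* (R :* u)
                                    := (A :* (K :* K) :- R :* R) :* (u :* u)) ≈-refl

  neg-square : ∀ p → - p * - p ≈ p * p
  neg-square = solve 1 (λ p → :- p :* :- p := p :* p) ≈-refl

  add-back : ∀ p q → (p - q) + q ≈ p
  add-back = solve 2 (λ p q → (p :- q) :+ q := p) ≈-refl

  subtract-back : ∀ p q → p + - (p - q) ≈ q
  subtract-back = solve 2 (λ p q → p :+ :- (p :- q) := q) ≈-refl

  cancel-middle : ∀ p q → (p + q) - p ≈ q
  cancel-middle = solve 2 (λ p q → (p :+ q) :- p := q) ≈-refl

  regroup : ∀ C K u → C * K * (u * u) ≈ C * u * (K * u)
  regroup = solve 3 (λ C K u → C :* K :* (u :* u) := C :* u :* (K :* u)) ≈-refl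

  -- Expanding, w² + w + 1 = ¼(3 + s²i²) holds before anything is known about s and i.
  omega : ∀ s i → s * s ≈ ι 3ℚ → i * i ≈ - ι 1ℚ → let w = ι ½ * (- ι 1ℚ + s * i) in w * w + w + ι 1ℚ ≈ ι 0ℚ
  omega s i ss≈3 ii≈-1 = begin
    w * w + w + ι 1ℚ                                 ≈⟨ solve 2 (λ s i → let w = con ½ :* (:- con 1ℚ :+ s :* i) in
      w :* w :+ w :+ con 1ℚ := con ¼ :* (con 3ℚ :+ (s :* s) :* (i :* i))) ≈-refl s i ⟩
    ι ¼ * (ι 3ℚ + (s * s) * (i * i))                 ≈⟨ *-congˡ (+-congˡ (*-cong ss≈3 ii≈-1)) ⟩
    ι ¼ * (ι 3ℚ + ι 3ℚ * - ι 1ℚ)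
      ≈⟨ solve 0 (con ¼ :* (con 3ℚ :+ con 3ℚ :* :- con 1ℚ) := con 0ℚ) ≈-refl ⟩
    ι 0ℚ                                             ∎
    where
    open SetoidReasoning setoid
    w = ι ½ * (- ι 1ℚ + s * i)

  idempotent⇒zero-product : ∀ z → z * z ≈ z → z * (ι 1ℚ + - z) ≈ ι 0ℚ
  idempotent⇒zero-product z zz≈z = begin
    z * (ι 1ℚ + - z)     ≈⟨ solve 1 (λ z → z :* (con 1ℚ :+ :- z) := z :- z :* z) ≈-refl z ⟩
    z - z * z            ≈⟨ +-congˡ (-‿cong zz≈z) ⟩
    z - z                ≈⟨ solve 1 (λ z → z :- z := con 0ℚ) ≈-refl z ⟩
    ι 0ℚ                 ∎
    where open SetoidReasoning setoid

  zero-product-absorb : ∀ x y w → x * y ≈ ι 0ℚ → x * (y * w) ≈ ι 0ℚ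
  zero-product-absorb x y w xy≈0 = begin
    x * (y * w)     ≈⟨ *-assoc x y w ⟨
    (x * y) * w     ≈⟨ *-congʳ xy≈0 ⟩
    ι 0ℚ * w        ≈⟨ solve 1 (λ w → con 0ℚ :* w := con 0ℚ) ≈-refl w ⟩
    ι 0ℚ            ∎
    where open SetoidReasoning setoid

  zero-product-comm : ∀ x y → x * y ≈ ι 0ℚ → y * x ≈ ι 0ℚ
  zero-product-comm x y = ≈-trans (*-comm y x)

  1-z≈0⇒z≈1 : ∀ z → ι 1ℚ + - z ≈ ι 0ℚ → z ≈ ι 1ℚ
  1-z≈0⇒z≈1 z eq = begin
    z                                ≈⟨ solve 1 (λ z → z := con 1ℚ :+ :- (con 1ℚ :+ :- z)) ≈-refl z ⟩
    ι 1ℚ + - (ι 1ℚ + - z)            ≈⟨ +-congˡ (-‿cong eq) ⟩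
    ι 1ℚ + - ι 0ℚ                    ≈⟨ solve 0 (con 1ℚ :+ :- con 0ℚ := con 1ℚ) ≈-refl ⟩
    ι 1ℚ                             ∎
    where open SetoidReasoning setoid

  -- Multiplying x + yi by (a + bi)(a - bi) scales both components by a² + b², since the imaginary
  -- part of that product cancels.
  norm-re : ∀ x y a b → (x * (a * a + - (b * - b)) + - (y * (a * - b + b * a))) ≈ x * (a * a + b * b)
  norm-re = solve 4 (λ x y a b → (x :* (a :* a :+ :- (b :* :- b)) :+ :- (y :* (a :* :- b :+ b :* a)))
                              := x :* (a :* a :+ b :* b)) ≈-refl

  norm-im : ∀ x y a b → (x * (a * - b + b * a) + y * (a * a + - (b * - b))) ≈ y * (a * a + b * b)
  norm-im = solve 4 (λ x y a b → (x :* (a :* :- b :+ b :* a) :+ y :* (a :* a :+ :- (b :* :- b)))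
                              := y :* (a :* a :+ b :* b)) ≈-refl

  -- Here w is the real part of ω exactly as its definition unfolds, zero summands included, with s
  -- an approximation of √3.
  omega-re : ∀ s → let w = ι ½ * (- ι 1ℚ + (s * ι 0ℚ + - (ι 0ℚ * ι 1ℚ)))
                           + - (ι 0ℚ * (- ι 0ℚ + (s * ι 1ℚ + ι 0ℚ * ι 0ℚ))) in
             w + w + ι 1ℚ ≈ ι 0ℚ
  omega-re = solve 1 (λ s → let w = con ½ :* (:- con 1ℚ :+ (s :* con 0ℚ :+ :- (con 0ℚ :* con 1ℚ)))
                                     :+ :- (con 0ℚ :* (:- con 0ℚ :+ (s :* con 1ℚ :+ con 0ℚ :* con 0ℚ))) in
    w :+ w :+ con 1ℚ := con 0ℚ) ≈-refl

module Pairs = ComplexIdentities ℚₚ.+-*-commutativeRing (λ q → q) (Identity.isRingHomomorphism ℚ.+-*-rawRing refl)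

pointwise : ∀ {x y} → (∀ n → seq x n ≡ seq y n) → x ≈ℝ y
pointwise {x} {y} eq = null-cong (λ n → trans (sym (ℚₚ.+-inverseʳ (seq x n))) (cong (λ q → seq x n ℚ.- q) (eq n))) null-zero

≈ℝ-refl : ∀ {x} → x ≈ℝ x
≈ℝ-refl {x} = pointwise {x} {x} λ _ → refl

≈ℝ-sym : ∀ {x y} → x ≈ℝ y → y ≈ℝ x
≈ℝ-sym {x} {y} p = null-cong (λ n → Pairs.flip-difference (seq x n) (seq y n)) (null-neg p)

≈ℝ-trans : ∀ {x y z} → x ≈ℝ y → y ≈ℝ z → x ≈ℝ z
≈ℝ-trans {x} {y} {z} p q = null-cong (λ n → Pairs.telescope (seq x n) (seq y n) (seq z n)) (null-+ p q)

+ℝ-cong : ∀ {x x′ y y′} → x ≈ℝ x′ → y ≈ℝ y′ → x +ℝ y ≈ℝ x′ +ℝ y′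
+ℝ-cong {x} {x′} {y} {y′} p q =
  null-cong (λ n → Pairs.+-difference (seq x n) (seq x′ n) (seq y n) (seq y′ n)) (null-+ p q)

-ℝ-cong : ∀ {x y} → x ≈ℝ y → -ℝ x ≈ℝ -ℝ y
-ℝ-cong {x} {y} p = null-cong (λ n → Pairs.negate-difference (seq x n) (seq y n)) (null-neg p)

*ℝ-cong : ∀ {x x′ y y′} → x ≈ℝ x′ → y ≈ℝ y′ → x *ℝ y ≈ℝ x′ *ℝ y′
*ℝ-cong {x} {x′} {y} {y′} p q =
  null-cong (λ n → Pairs.*-difference (seq x n) (seq x′ n) (seq y n) (seq y′ n)) (null-+ (null-* x q) (null-* y′ p))

ℂ-pointwise : ∀ z w → (∀ n → seq (re z) n ≡ seq (re w) n) → (∀ n → seq (im z) n ≡ seq (im w) n) → z ℂ.≈ w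
ℂ-pointwise z w p q = pointwise {re z} {re w} p , pointwise {im z} {im w} q

-- The ring laws hold term by term on the approximating sequences; limits enter only through the
-- congruences and the equivalence relation.
ℂ-isCommutativeRing : IsCommutativeRing ℂ._≈_ ℂ._+_ ℂ._*_ ℂ.-_ 0ᶜ 1ᶜ
ℂ-isCommutativeRing = record
  { isRing = record
    { +-isAbelianGroup = record
      { isGroup = record
        { isMonoid = record
          { isSemigroup = record
            { isMagma = record
              { isEquivalence = record
                { refl  = λ {z} → ≈ℝ-refl {re z} , ≈ℝ-refl {im z}
                ; sym   = λ {z} {w} (p , q) → ≈ℝ-sym {re z} {re w} p , ≈ℝ-sym {im z} {im w} q
                ; trans = λ {z} {w} {v} → ≈-trans z w v
                }
              ; ∙-cong = λ {z} {z′} {w} {w′} → ℂ-+-cong z z′ w w′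
              }
            ; assoc = λ z w v → ℂ-pointwise ((z ℂ.+ w) ℂ.+ v) (z ℂ.+ (w ℂ.+ v)) (λ n → ℚₚ.+-assoc (seq (re z) n) _ _) (λ n → ℚₚ.+-assoc (seq (im z) n) _ _)
            }
          ; identity = (λ z → ℂ-pointwise (0ᶜ ℂ.+ z) z (λ n → ℚₚ.+-identityˡ (seq (re z) n)) (λ n → ℚₚ.+-identityˡ (seq (im z) n)))
                     , (λ z → ℂ-pointwise (z ℂ.+ 0ᶜ) z (λ n → ℚₚ.+-identityʳ (seq (re z) n)) (λ n → ℚₚ.+-identityʳ (seq (im z) n)))
          }
        ; inverse = (λ z → ℂ-pointwise (ℂ.- z ℂ.+ z) 0ᶜ (λ n → ℚₚ.+-inverseˡ (seq (re z) n)) (λ n → ℚₚ.+-inverseˡ (seq (im z) n)))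
                  , (λ z → ℂ-pointwise (z ℂ.+ ℂ.- z) 0ᶜ (λ n → ℚₚ.+-inverseʳ (seq (re z) n)) (λ n → ℚₚ.+-inverseʳ (seq (im z) n)))
        ; ⁻¹-cong = λ {z} {w} (p , q) → -ℝ-cong {re z} {re w} p , -ℝ-cong {im z} {im w} q
        }
      ; comm = λ z w → ℂ-pointwise (z ℂ.+ w) (w ℂ.+ z) (λ n → ℚₚ.+-comm (seq (re z) n) _) (λ n → ℚₚ.+-comm (seq (im z) n) _)
      }
    ; *-cong = λ {z} {z′} {w} {w′} (p , q) (r , s) →
        +ℝ-cong {re z *ℝ re w} {re z′ *ℝ re w′} { -ℝ (im z *ℝ im w)} { -ℝ (im z′ *ℝ im w′)}
          (*ℝ-cong {re z} {re z′} {re w} {re w′} p r)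
          (-ℝ-cong {im z *ℝ im w} {im z′ *ℝ im w′} (*ℝ-cong {im z} {im z′} {im w} {im w′} q s)) ,
        +ℝ-cong {re z *ℝ im w} {re z′ *ℝ im w′} {im z *ℝ re w} {im z′ *ℝ re w′}
          (*ℝ-cong {re z} {re z′} {im w} {im w′} p s)
          (*ℝ-cong {im z} {im z′} {re w} {re w′} q r)
    ; *-assoc = λ z w v → ℂ-pointwise ((z ℂ.* w) ℂ.* v) (z ℂ.* (w ℂ.* v))
        (λ n → Pairs.*-assoc-re (seq (re z) n) (seq (im z) n) (seq (re w) n) (seq (im w) n) (seq (re v) n) (seq (im v) n))
        (λ n → Pairs.*-assoc-im (seq (re z) n) (seq (im z) n) (seq (re w) n) (seq (im w) n) (seq (re v) n) (seq (im v) n))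
    ; *-identity = *-identityˡ , λ z → ≈-trans (z ℂ.* 1ᶜ) (1ᶜ ℂ.* z) z (*-comm z 1ᶜ) (*-identityˡ z)
    ; distrib = *-distribˡ , λ z w v →
        ≈-trans ((w ℂ.+ v) ℂ.* z) (z ℂ.* (w ℂ.+ v)) (w ℂ.* z ℂ.+ v ℂ.* z) (*-comm (w ℂ.+ v) z)
          (≈-trans (z ℂ.* (w ℂ.+ v)) (z ℂ.* w ℂ.+ z ℂ.* v) (w ℂ.* z ℂ.+ v ℂ.* z) (*-distribˡ z w v)
            (ℂ-+-cong (z ℂ.* w) (w ℂ.* z) (z ℂ.* v) (v ℂ.* z) (*-comm z w) (*-comm z v)))
    }
  ; *-comm = *-comm
  }
  where
  ≈-trans : ∀ z w v → z ℂ.≈ w → w ℂ.≈ v → z ℂ.≈ v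
  ≈-trans z w v (p , q) (r , s) = ≈ℝ-trans {re z} {re w} {re v} p r , ≈ℝ-trans {im z} {im w} {im v} q s
  ℂ-+-cong : ∀ z z′ w w′ → z ℂ.≈ z′ → w ℂ.≈ w′ → z ℂ.+ w ℂ.≈ z′ ℂ.+ w′
  ℂ-+-cong z z′ w w′ (p , q) (r , s) =
    +ℝ-cong {re z} {re z′} {re w} {re w′} p r , +ℝ-cong {im z} {im z′} {im w} {im w′} q s
  *-comm : ∀ z w → z ℂ.* w ℂ.≈ w ℂ.* z
  *-comm z w = ℂ-pointwise (z ℂ.* w) (w ℂ.* z)
    (λ n → Pairs.*-comm-re (seq (re z) n) (seq (im z) n) (seq (re w) n) (seq (im w) n))
    (λ n → Pairs.*-comm-im (seq (re z) n) (seq (im z) n) (seq (re w) n) (seq (im w) n))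
  *-identityˡ : ∀ z → 1ᶜ ℂ.* z ℂ.≈ z
  *-identityˡ z = ℂ-pointwise (1ᶜ ℂ.* z) z
    (λ n → Pairs.*-identityˡ-re (seq (re z) n) (seq (im z) n))
    (λ n → Pairs.*-identityˡ-im (seq (re z) n) (seq (im z) n))
  *-distribˡ : ∀ z w v → z ℂ.* (w ℂ.+ v) ℂ.≈ z ℂ.* w ℂ.+ z ℂ.* v
  *-distribˡ z w v = ℂ-pointwise (z ℂ.* (w ℂ.+ v)) (z ℂ.* w ℂ.+ z ℂ.* v)
    (λ n → Pairs.*-distribˡ-re (seq (re z) n) (seq (im z) n) (seq (re w) n) (seq (im w) n) (seq (re v) n) (seq (im v) n))
    (λ n → Pairs.*-distribˡ-im (seq (re z) n) (seq (im z) n) (seq (re w) n) (seq (im w) n) (seq (re v) n) (seq (im v) n))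

ℂ-commutativeRing : CommutativeRing 0ℓ 0ℓ
ℂ-commutativeRing = record { isCommutativeRing = ℂ-isCommutativeRing }

rational-isRingHomomorphism : IsRingHomomorphism ℚ.+-*-rawRing (CommutativeRing.rawRing ℂ-commutativeRing) rational
rational-isRingHomomorphism = record
  { isSemiringHomomorphism = record
    { isNearSemiringHomomorphism = record
      { +-isMonoidHomomorphism = record
        { isMagmaHomomorphism = record
          { isRelHomomorphism = record { cong = λ { {p} refl → ≈-refl (rational p) } }
          ; homo = λ p q → ℂ-pointwise (rational (p ℚ.+ q)) (rational p ℂ.+ rational q) (λ _ → refl) (λ _ → refl)
          }
        ; ε-homo = ≈-refl 0ᶜ
        }
      ; *-homo = λ p q → ℂ-pointwise (rational (p ℚ.* q)) (rational p ℂ.* rational q)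
          (λ _ → sym (ℚₚ.+-identityʳ (p ℚ.* q)))
          (λ _ → sym (cong₂ ℚ._+_ (ℚₚ.*-zeroʳ p) (ℚₚ.*-zeroˡ q)))
      }
    ; 1#-homo = ≈-refl 1ᶜ
    }
  ; -‿homo = λ p → ℂ-pointwise (rational (ℚ.- p)) (ℂ.- rational p) (λ _ → refl) (λ _ → refl)
  }
  where
  ≈-refl : ∀ z → z ℂ.≈ z
  ≈-refl z = ≈ℝ-refl {re z} , ≈ℝ-refl {im z}

-- Normalisation by the greatest common divisor blocks on a variable k; the explicit fraction lets
-- rational arithmetic compute.
/1-mkℚ : ∀ k → k ℚ./ 1 ≡ mkℚ k 0 (Coprimality.sym (Coprimality.1-coprimeTo ℤ.∣ k ∣))
/1-mkℚ k = ℚₚ.↥p/↧p≡p (mkℚ k 0 (Coprimality.sym (Coprimality.1-coprimeTo ℤ.∣ k ∣)))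

/1-+ : ∀ k l → (k ℤ.+ l) ℚ./ 1 ≡ k ℚ./ 1 ℚ.+ l ℚ./ 1
/1-+ k l = trans (cong₂ (λ a b → (a ℤ.+ b) ℚ./ 1) (sym (ℤₚ.*-identityʳ k)) (sym (ℤₚ.*-identityʳ l)))
  (sym (cong₂ ℚ._+_ (/1-mkℚ k) (/1-mkℚ l)))

/1-* : ∀ k l → (k ℤ.* l) ℚ./ 1 ≡ (k ℚ./ 1) ℚ.* (l ℚ./ 1)
/1-* k l = sym (cong₂ ℚ._*_ (/1-mkℚ k) (/1-mkℚ l))

/1-neg : ∀ k → (ℤ.- k) ℚ./ 1 ≡ ℚ.- (k ℚ./ 1)
/1-neg k = begin
  (ℤ.- k) ℚ./ 1                                          ≡⟨ cancel (k ℚ./ 1) ((ℤ.- k) ℚ./ 1) ⟩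
  ℚ.- (k ℚ./ 1) ℚ.+ (k ℚ./ 1 ℚ.+ (ℤ.- k) ℚ./ 1)          ≡⟨ cong (ℚ.- (k ℚ./ 1) ℚ.+_) (/1-+ k (ℤ.- k)) ⟨
  ℚ.- (k ℚ./ 1) ℚ.+ (k ℤ.+ ℤ.- k) ℚ./ 1                  ≡⟨ cong (λ l → ℚ.- (k ℚ./ 1) ℚ.+ l ℚ./ 1) (ℤₚ.+-inverseʳ k) ⟩
  ℚ.- (k ℚ./ 1) ℚ.+ 0ℚ                                   ≡⟨ ℚₚ.+-identityʳ (ℚ.- (k ℚ./ 1)) ⟩
  ℚ.- (k ℚ./ 1)                                          ∎
  where
  open ≡-Reasoning
  cancel : ∀ p q → q ≡ ℚ.- p ℚ.+ (p ℚ.+ q)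
  cancel p q = trans (sym (ℚₚ.+-identityˡ q)) (trans (cong (ℚ._+ q) (sym (ℚₚ.+-inverseˡ p))) (ℚₚ.+-assoc (ℚ.- p) p q))

/1-mono : ∀ {k l} → k ℤ.≤ l → k ℚ./ 1 ℚ.≤ l ℚ./ 1
/1-mono {k} {l} k≤l = subst₂ ℚ._≤_ (sym (/1-mkℚ k)) (sym (/1-mkℚ l))
  (ℚ.*≤* (subst₂ ℤ._≤_ (sym (ℤₚ.*-identityʳ k)) (sym (ℤₚ.*-identityʳ l)) k≤l))

reciprocal-nonNeg : ∀ k → 0ℚ ℚ.≤ + 1 ℚ./ suc k
reciprocal-nonNeg k = ℚₚ.toℚᵘ-cancel-≤ (ℚᵘₚ.≤-respʳ-≃ (ℚᵘₚ.≃-sym (ℚₚ.toℚᵘ-fromℚᵘ (ℚᵘ.mkℚᵘ (+ 1) k)))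
  (ℚᵘ.*≤* (ℤ.+≤+ ℕ.z≤n)))

reciprocals-null : IsNull (λ n → + 1 ℚ./ suc n)
reciprocals-null (mkℚ (+ zero) d _) (ℚ.*<* (ℤ.+<+ ()))
reciprocals-null (mkℚ ℤ.-[1+ p ] d _) (ℚ.*<* ())
reciprocals-null ε@(mkℚ (+ suc p) d _) _ = suc d , λ n d<n → subst (ℚ._< ε) (sym (ℚₚ.0≤p⇒∣p∣≡p (reciprocal-nonNeg n)))
  (ℚₚ.toℚᵘ-cancel-< (ℚᵘₚ.<-respˡ-≃ (ℚᵘₚ.≃-sym (ℚₚ.toℚᵘ-fromℚᵘ (ℚᵘ.mkℚᵘ (+ 1) n)))
    (ℚᵘ.*<* (subst₂ ℤ._<_ (ℤₚ.pos-* 1 (suc d)) (ℤₚ.pos-* (suc p) (suc n)) (ℤ.+<+ (begin-strict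
      1 ℕ.* suc d        ≡⟨ ℕₚ.*-identityˡ (suc d) ⟩
      suc d              <⟨ ℕ.s≤s d<n ⟩
      suc n              ≤⟨ ℕₚ.m≤m+n (suc n) (p ℕ.* suc n) ⟩
      suc p ℕ.* suc n    ∎))))))
  where
  open ℕₚ.≤-Reasoning

null-squeeze : ∀ {u v} → (∀ n → ℚ.∣ u n ∣ ℚ.≤ ℚ.∣ v n ∣) → IsNull v → IsNull u
null-squeeze u≤v v→0 ε 0<ε = let N , h = v→0 ε 0<ε in N , λ n N≤n → ℚₚ.≤-<-trans (u≤v n) (h n N≤n)

-- With r the rounded root, ak² < (r + 1)² gives an error of at most 2r, and r² ≤ ak² ≤ (ak)² gives
-- r ≤ ak. The crude bound is linear in k, which suffices after division by k².
⌊√⌋-error : ∀ a k → a ℕ.* (k ℕ.* k) ℕ.≤ ⌊√ a ℕ.* (k ℕ.* k) ⌋ ℕ.* ⌊√ a ℕ.* (k ℕ.* k) ⌋ ℕ.+ 2 ℕ.* a ℕ.* k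
⌊√⌋-error a k = begin
  a ℕ.* (k ℕ.* k)                 ≤⟨ ℕ.s≤s⁻¹ (subst (a ℕ.* (k ℕ.* k) ℕ.<_) (expand r) (⌊√⌋-upper (a ℕ.* (k ℕ.* k)))) ⟩
  r ℕ.* r ℕ.+ 2 ℕ.* r             ≤⟨ ℕₚ.+-monoʳ-≤ (r ℕ.* r) (ℕₚ.*-monoʳ-≤ 2 (square-cancel-≤ r (a ℕ.* k) squares)) ⟩
  r ℕ.* r ℕ.+ 2 ℕ.* (a ℕ.* k)     ≡⟨ cong (r ℕ.* r ℕ.+_) (ℕₚ.*-assoc 2 a k) ⟨
  r ℕ.* r ℕ.+ 2 ℕ.* a ℕ.* k       ∎
  where
  open ℕₚ.≤-Reasoning
  r : ℕ
  r = ⌊√ a ℕ.* (k ℕ.* k) ⌋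
  expand : ∀ r → suc r ℕ.* suc r ≡ suc (r ℕ.* r ℕ.+ 2 ℕ.* r)
  expand = solve-∀
  square-cancel-≤ : ∀ m n → m ℕ.* m ℕ.≤ n ℕ.* n → m ℕ.≤ n
  square-cancel-≤ m n mm≤nn = ℕₚ.≮⇒≥ λ n<m → ℕₚ.<⇒≱ (ℕₚ.*-mono-< n<m n<m) mm≤nn
  a≤a*a : ∀ a → a ℕ.≤ a ℕ.* a
  a≤a*a zero    = ℕ.z≤n
  a≤a*a (suc a) = ℕₚ.m≤m*n (suc a) (suc a)
  interchange : ∀ a k → (a ℕ.* a) ℕ.* (k ℕ.* k) ≡ (a ℕ.* k) ℕ.* (a ℕ.* k)
  interchange = solve-∀
  squares : r ℕ.* r ℕ.≤ (a ℕ.* k) ℕ.* (a ℕ.* k)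
  squares = begin
    r ℕ.* r                        ≤⟨ ⌊√⌋-lower (a ℕ.* (k ℕ.* k)) ⟩
    a ℕ.* (k ℕ.* k)                ≤⟨ ℕₚ.*-monoˡ-≤ (k ℕ.* k) (a≤a*a a) ⟩
    (a ℕ.* a) ℕ.* (k ℕ.* k)        ≡⟨ interchange a k ⟩
    (a ℕ.* k) ℕ.* (a ℕ.* k)        ∎

/-split : ∀ r k → + r ℚ./ suc k ≡ (+ r ℚ./ 1) ℚ.* (+ 1 ℚ./ suc k)
/-split r k = ℚₚ.toℚᵘ-injective
  (ℚᵘₚ.≃-trans (ℚₚ.toℚᵘ-fromℚᵘ (ℚᵘ.mkℚᵘ (+ r) k))
  (ℚᵘₚ.≃-trans (ℚᵘ.*≡* (trans (cong (+ r ℤ.*_) (cong +_ (ℕₚ.*-identityˡ (suc k)))) (cong (ℤ._* + suc k) (sym (ℤₚ.*-identityʳ (+ r))))))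
  (ℚᵘₚ.≃-trans (ℚᵘₚ.*-cong (ℚᵘₚ.≃-sym (ℚₚ.toℚᵘ-fromℚᵘ (ℚᵘ.mkℚᵘ (+ r) 0))) (ℚᵘₚ.≃-sym (ℚₚ.toℚᵘ-fromℚᵘ (ℚᵘ.mkℚᵘ (+ 1) k))))
               (ℚᵘₚ.≃-sym (ℚₚ.toℚᵘ-homo-* (+ r ℚ./ 1) (+ 1 ℚ./ suc k))))))

/-self : ∀ k → (+ suc k ℚ./ 1) ℚ.* (+ 1 ℚ./ suc k) ≡ 1ℚ
/-self k = trans (sym (/-split (suc k) k)) (ℚₚ.toℚᵘ-injective
  (ℚᵘₚ.≃-trans (ℚₚ.toℚᵘ-fromℚᵘ (ℚᵘ.mkℚᵘ (+ suc k) k)) (ℚᵘ.*≡* (ℤₚ.*-comm (+ suc k) (+ 1)))))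

-- Scaled by (k + 1)², the error of the k-th square lies between 0 and 2a(k + 1), so the error
-- itself is at most 2a/(k + 1).
√-square : ∀ a → (√ a) *ℝ (√ a) ≈ℝ fromℚ (+ a ℚ./ 1)
√-square a = ≈ℝ-sym {fromℚ (+ a ℚ./ 1)} {(√ a) *ℝ (√ a)} (null-squeeze bound (null-* (fromℚ C) reciprocals-null))
  where
  C : ℚ
  C = + (2 ℕ.* a) ℚ./ 1
  bound : ∀ k → ℚ.∣ + a ℚ./ 1 ℚ.- √-approx a k ℚ.* √-approx a k ∣ ℚ.≤ ℚ.∣ C ℚ.* (+ 1 ℚ./ suc k) ∣
  bound k = subst₂ ℚ._≤_ (sym (ℚₚ.0≤p⇒∣p∣≡p error≥0)) (sym (ℚₚ.0≤p⇒∣p∣≡p (ℚₚ.≤-trans error≥0 error≤))) error≤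
    where
    open ℚₚ.≤-Reasoning
    r : ℕ
    r = ⌊√ a ℕ.* (suc k ℕ.* suc k) ⌋
    A K R u : ℚ
    A = + a ℚ./ 1
    K = + suc k ℚ./ 1
    R = + r ℚ./ 1
    u = + 1 ℚ./ suc k
    u≥0 : ℚ.NonNegative (u ℚ.* u)
    u≥0 = ℚₚ.nonNeg*nonNeg⇒nonNeg u {{ℚ.nonNegative (reciprocal-nonNeg k)}} u {{ℚ.nonNegative (reciprocal-nonNeg k)}}
    error : ℚ
    error = A ℚ.- √-approx a k ℚ.* √-approx a k
    error≡ : error ≡ (A ℚ.* (K ℚ.* K) ℚ.- R ℚ.* R) ℚ.* (u ℚ.* u)
    error≡ = trans (cong₂ (λ p q → p ℚ.- q ℚ.* q)
        (sym (trans (cong (λ p → A ℚ.* (p ℚ.* p)) (/-self k)) (ℚₚ.*-identityʳ A))) (/-split r k))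
      (Pairs.factor-square A K R u)
    AKK≡ : + (a ℕ.* (suc k ℕ.* suc k)) ℚ./ 1 ≡ A ℚ.* (K ℚ.* K)
    AKK≡ = trans (cong (ℚ._/ 1) (ℤₚ.pos-* a (suc k ℕ.* suc k))) (trans (/1-* (+ a) (+ (suc k ℕ.* suc k)))
      (cong (A ℚ.*_) (trans (cong (ℚ._/ 1) (ℤₚ.pos-* (suc k) (suc k))) (/1-* (+ suc k) (+ suc k)))))
    RR≡ : + (r ℕ.* r) ℚ./ 1 ≡ R ℚ.* R
    RR≡ = trans (cong (ℚ._/ 1) (ℤₚ.pos-* r r)) (/1-* (+ r) (+ r))
    CK≡ : + (2 ℕ.* a ℕ.* suc k) ℚ./ 1 ≡ C ℚ.* K
    CK≡ = trans (cong (ℚ._/ 1) (ℤₚ.pos-* (2 ℕ.* a) (suc k))) (/1-* (+ (2 ℕ.* a)) (+ suc k))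
    lower : 0ℚ ℚ.≤ A ℚ.* (K ℚ.* K) ℚ.- R ℚ.* R
    lower = subst (ℚ._≤ A ℚ.* (K ℚ.* K) ℚ.- R ℚ.* R) (ℚₚ.+-inverseʳ (R ℚ.* R)) (ℚₚ.+-monoˡ-≤ (ℚ.- (R ℚ.* R))
      (subst₂ ℚ._≤_ RR≡ AKK≡ (/1-mono (ℤ.+≤+ (⌊√⌋-lower (a ℕ.* (suc k ℕ.* suc k)))))))
    upper : A ℚ.* (K ℚ.* K) ℚ.- R ℚ.* R ℚ.≤ C ℚ.* K
    upper = begin
      A ℚ.* (K ℚ.* K) ℚ.- R ℚ.* R                                    ≡⟨ cong₂ ℚ._-_ (sym AKK≡) (sym RR≡) ⟩
      + (a ℕ.* (suc k ℕ.* suc k)) ℚ./ 1 ℚ.- + (r ℕ.* r) ℚ./ 1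
        ≤⟨ ℚₚ.+-monoˡ-≤ (ℚ.- (+ (r ℕ.* r) ℚ./ 1)) (/1-mono (ℤ.+≤+ (⌊√⌋-error a (suc k)))) ⟩
      + (r ℕ.* r ℕ.+ 2 ℕ.* a ℕ.* suc k) ℚ./ 1 ℚ.- + (r ℕ.* r) ℚ./ 1
        ≡⟨ cong (ℚ._- + (r ℕ.* r) ℚ./ 1) (trans (cong (ℚ._/ 1) (ℤₚ.pos-+ (r ℕ.* r) (2 ℕ.* a ℕ.* suc k))) (/1-+ (+ (r ℕ.* r)) (+ (2 ℕ.* a ℕ.* suc k)))) ⟩
      (+ (r ℕ.* r) ℚ./ 1 ℚ.+ + (2 ℕ.* a ℕ.* suc k) ℚ./ 1) ℚ.- + (r ℕ.* r) ℚ./ 1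
        ≡⟨ Pairs.cancel-middle (+ (r ℕ.* r) ℚ./ 1) (+ (2 ℕ.* a ℕ.* suc k) ℚ./ 1) ⟩
      + (2 ℕ.* a ℕ.* suc k) ℚ./ 1                                    ≡⟨ CK≡ ⟩
      C ℚ.* K                                                        ∎
    error≥0 : 0ℚ ℚ.≤ error
    error≥0 = begin
      0ℚ                                                   ≡⟨ ℚₚ.*-zeroˡ (u ℚ.* u) ⟨
      0ℚ ℚ.* (u ℚ.* u)                                     ≤⟨ ℚₚ.*-monoʳ-≤-nonNeg (u ℚ.* u) {{u≥0}} lower ⟩
      (A ℚ.* (K ℚ.* K) ℚ.- R ℚ.* R) ℚ.* (u ℚ.* u)          ≡⟨ error≡ ⟨
      error                                                ∎
    error≤ : error ℚ.≤ C ℚ.* u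
    error≤ = begin
      error                                                ≡⟨ error≡ ⟩
      (A ℚ.* (K ℚ.* K) ℚ.- R ℚ.* R) ℚ.* (u ℚ.* u)          ≤⟨ ℚₚ.*-monoʳ-≤-nonNeg (u ℚ.* u) {{u≥0}} upper ⟩
      C ℚ.* K ℚ.* (u ℚ.* u)                                ≡⟨ Pairs.regroup C K u ⟩
      C ℚ.* u ℚ.* (K ℚ.* u)                                ≡⟨ cong (C ℚ.* u ℚ.*_) (/-self k) ⟩
      C ℚ.* u ℚ.* 1ℚ                                       ≡⟨ ℚₚ.*-identityʳ (C ℚ.* u) ⟩
      C ℚ.* u                                              ∎

module Cℂ = ComplexIdentities ℂ-commutativeRing rational rational-isRingHomomorphism

ω-minimal : ω ℂ.* ω ℂ.+ ω ℂ.+ 1ᶜ ℂ.≈ 0ᶜ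
ω-minimal = Cℂ.omega (real (√ 3)) i √3√3≈3 ii≈-1
  where
  √3√3≈3 : real (√ 3) ℂ.* real (√ 3) ℂ.≈ rational 3ℚ
  √3√3≈3 = ≈ℝ-trans {(√ 3) *ℝ (√ 3) +ℝ -ℝ (fromℚ 0ℚ *ℝ fromℚ 0ℚ)} {(√ 3) *ℝ (√ 3)} {fromℚ 3ℚ}
      (pointwise {(√ 3) *ℝ (√ 3) +ℝ -ℝ (fromℚ 0ℚ *ℝ fromℚ 0ℚ)} {(√ 3) *ℝ (√ 3)} λ n → ℚₚ.+-identityʳ _) (√-square 3) ,
    pointwise {(√ 3) *ℝ fromℚ 0ℚ +ℝ fromℚ 0ℚ *ℝ (√ 3)} {fromℚ 0ℚ}
      λ n → cong₂ ℚ._+_ (ℚₚ.*-zeroʳ (√-approx 3 n)) (ℚₚ.*-zeroˡ (√-approx 3 n))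
  ii≈-1 : i ℂ.* i ℂ.≈ ℂ.- 1ᶜ
  ii≈-1 = ℂ-pointwise (i ℂ.* i) (ℂ.- 1ᶜ) (λ _ → refl) (λ _ → refl)

ω̄-ω : ω̄ ℂ.+ ω ℂ.+ 1ᶜ ℂ.≈ 0ᶜ
ω̄-ω = ℂ-pointwise (ω̄ ℂ.+ ω ℂ.+ 1ᶜ) 0ᶜ (λ n → Pairs.omega-re (√-approx 3 n))
  (λ n → trans (ℚₚ.+-identityʳ _) (ℚₚ.+-inverseˡ (seq (im ω) n)))

ℂ-1≉0 : ¬ (1ᶜ ℂ.≈ 0ᶜ)
ℂ-1≉0 (p , _) = let N , h = p ½ (ℚₚ.positive⁻¹ ½) in ℚₚ.<-asym (h N ℕₚ.≤-refl) (from-yes (½ ℚₚ.<? 1ℚ))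

-- If y is bounded away from 0 then so is yȳ = |y|², a real number.
cancel-apart : ∀ x y → x ℂ.* y ℂ.≈ 0ᶜ → (∃ λ N → ∀ n → N ℕ.≤ n → ¼ ℚ.≤ seq (re y) n) → x ℂ.≈ 0ᶜ
cancel-apart x y xy≈0 (N , ¼≤y) =
  component (re x) (null-cong (λ n → cong (ℚ._+ ℚ.- 0ℚ) (Pairs.norm-re (seq (re x) n) (seq (im x) n) (seq (re y) n) (seq (im y) n))) (proj₁ xyȳ≈0)) ,
  component (im x) (null-cong (λ n → cong (ℚ._+ ℚ.- 0ℚ) (Pairs.norm-im (seq (re x) n) (seq (im x) n) (seq (re y) n) (seq (im y) n))) (proj₂ xyȳ≈0))
  where
  xyȳ≈0 : x ℂ.* (y ℂ.* conj y) ℂ.≈ 0ᶜ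
  xyȳ≈0 = Cℂ.zero-product-absorb x y (conj y) xy≈0
  component : ∀ u → IsNull (λ n → seq u n ℚ.* (seq (re y) n ℚ.* seq (re y) n ℚ.+ seq (im y) n ℚ.* seq (im y) n) ℚ.+ ℚ.- 0ℚ) →
              u ≈ℝ fromℚ 0ℚ
  component u null ε 0<ε =
    -- A real part of at least ¼ makes |y|² at least 1/16, so a product below ε/16 forces the factor
    -- u below ε.
    let M , h = null (½⁴ ℚ.* ε) (ℚₚ.positive⁻¹ (½⁴ ℚ.* ε) {{ℚₚ.pos*pos⇒pos ½⁴ ε {{ℚ.positive 0<ε}}}})
    in M ℕ.⊔ N , λ n n≥ → ℚₚ.*-cancelˡ-<-nonNeg ½⁴ (begin-strict
      ½⁴ ℚ.* ℚ.∣ seq u n ℚ.- 0ℚ ∣                ≡⟨ cong (λ q → ½⁴ ℚ.* ℚ.∣ q ∣) (ℚₚ.+-identityʳ (seq u n)) ⟩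
      ½⁴ ℚ.* ℚ.∣ seq u n ∣
        ≤⟨ ℚₚ.*-monoʳ-≤-nonNeg ℚ.∣ seq u n ∣ {{ℚₚ.∣-∣-nonNeg (seq u n)}} (¼²≤ n (¼≤y n (ℕₚ.m⊔n≤o⇒n≤o M N n≥))) ⟩
      v n ℚ.* ℚ.∣ seq u n ∣
        ≡⟨ cong (ℚ._* ℚ.∣ seq u n ∣) (ℚₚ.0≤p⇒∣p∣≡p (ℚₚ.≤-trans (from-yes (0ℚ ℚₚ.≤? ½⁴)) (¼²≤ n (¼≤y n (ℕₚ.m⊔n≤o⇒n≤o M N n≥))))) ⟨
      ℚ.∣ v n ∣ ℚ.* ℚ.∣ seq u n ∣                ≡⟨ ℚₚ.∣p*q∣≡∣p∣*∣q∣ (v n) (seq u n) ⟨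
      ℚ.∣ v n ℚ.* seq u n ∣
        ≡⟨ cong ℚ.∣_∣ (trans (ℚₚ.*-comm (v n) (seq u n)) (sym (ℚₚ.+-identityʳ _))) ⟩
      ℚ.∣ seq u n ℚ.* v n ℚ.+ ℚ.- 0ℚ ∣           <⟨ h n (ℕₚ.m⊔n≤o⇒m≤o M N n≥) ⟩
      ½⁴ ℚ.* ε                                   ∎)
    where
    open ℚₚ.≤-Reasoning
    ½⁴ : ℚ
    ½⁴ = ¼ ℚ.* ¼
    v : ℕ → ℚ
    v n = seq (re y) n ℚ.* seq (re y) n ℚ.+ seq (im y) n ℚ.* seq (im y) n
    square-nonNeg : ∀ p → 0ℚ ℚ.≤ p ℚ.* p
    square-nonNeg p = subst (0ℚ ℚ.≤_) (abs² (ℚₚ.∣p∣≡p∨∣p∣≡-p p)) (ℚₚ.nonNegative⁻¹ (ℚ.∣ p ∣ ℚ.* ℚ.∣ p ∣)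
      {{ℚₚ.nonNeg*nonNeg⇒nonNeg ℚ.∣ p ∣ {{ℚₚ.∣-∣-nonNeg p}} ℚ.∣ p ∣ {{ℚₚ.∣-∣-nonNeg p}}}})
      where
      abs² : ℚ.∣ p ∣ ≡ p ⊎ ℚ.∣ p ∣ ≡ ℚ.- p → ℚ.∣ p ∣ ℚ.* ℚ.∣ p ∣ ≡ p ℚ.* p
      abs² (inj₁ eq) = cong₂ ℚ._*_ eq eq
      abs² (inj₂ eq) = trans (cong₂ ℚ._*_ eq eq) (Pairs.neg-square p)
    ¼²≤ : ∀ n → ¼ ℚ.≤ seq (re y) n → ½⁴ ℚ.≤ v n
    ¼²≤ n ¼≤ = begin
      ¼ ℚ.* ¼                              ≤⟨ ℚₚ.*-monoˡ-≤-nonNeg ¼ ¼≤ ⟩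
      ¼ ℚ.* seq (re y) n
        ≤⟨ ℚₚ.*-monoʳ-≤-nonNeg (seq (re y) n) {{ℚ.nonNegative (ℚₚ.≤-trans (from-yes (0ℚ ℚₚ.≤? ¼)) ¼≤)}} ¼≤ ⟩
      seq (re y) n ℚ.* seq (re y) n        ≡⟨ ℚₚ.+-identityʳ _ ⟨
      seq (re y) n ℚ.* seq (re y) n ℚ.+ 0ℚ
        ≤⟨ ℚₚ.+-monoʳ-≤ (seq (re y) n ℚ.* seq (re y) n) (square-nonNeg (seq (im y) n)) ⟩
      v n                                  ∎

p≤∣p∣ : ∀ p → p ℚ.≤ ℚ.∣ p ∣
p≤∣p∣ p with ℚₚ.≤-total 0ℚ p
... | inj₁ 0≤p = ℚₚ.≤-reflexive (sym (ℚₚ.0≤p⇒∣p∣≡p 0≤p))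
... | inj₂ p≤0 = ℚₚ.≤-trans p≤0 (ℚₚ.0≤∣p∣ p)

-- Constructively, comparing a good rational approximation of re z with ½ decides whether z or 1 - z is invertible.
ℂ-idempotent : ∀ z → z ℂ.* z ℂ.≈ z → z ℂ.≈ 0ᶜ ⊎ z ℂ.≈ 1ᶜ
ℂ-idempotent z zz≈z with cauchy (re z) ¼ (ℚₚ.positive⁻¹ ¼)
... | N , close with seq (re z) N ℚₚ.≤? ½
...   | yes z≤½ = inj₁ (cancel-apart z (1ᶜ ℂ.+ ℂ.- z) z[1-z]≈0 (N , λ n N≤n → ¼≤1-z (seq (re z) n) (near n N≤n)))
  where
  open ℚₚ.≤-Reasoning
  z[1-z]≈0 : z ℂ.* (1ᶜ ℂ.+ ℂ.- z) ℂ.≈ 0ᶜ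
  z[1-z]≈0 = Cℂ.idempotent⇒zero-product z zz≈z
  near : ∀ n → N ℕ.≤ n → seq (re z) n ℚ.- seq (re z) N ℚ.≤ ¼
  near n N≤n = ℚₚ.≤-trans (p≤∣p∣ _) (ℚₚ.<⇒≤ (close n N N≤n ℕₚ.≤-refl))
  ¼≤1-z : ∀ q → q ℚ.- seq (re z) N ℚ.≤ ¼ → ¼ ℚ.≤ 1ℚ ℚ.+ ℚ.- q
  ¼≤1-z q q≤ = begin
    ¼                                                        ≡⟨⟩
    1ℚ ℚ.+ ℚ.- (¼ ℚ.+ ½)
      ≤⟨ ℚₚ.+-monoʳ-≤ 1ℚ (ℚₚ.neg-antimono-≤ (ℚₚ.+-mono-≤ q≤ z≤½)) ⟩
    1ℚ ℚ.+ ℚ.- ((q ℚ.- seq (re z) N) ℚ.+ seq (re z) N)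
      ≡⟨ cong (λ p → 1ℚ ℚ.+ ℚ.- p) (Pairs.add-back q (seq (re z) N)) ⟩
    1ℚ ℚ.+ ℚ.- q                                             ∎
...   | no z≰½ = inj₂ (Cℂ.1-z≈0⇒z≈1 z (cancel-apart (1ᶜ ℂ.+ ℂ.- z) z
          (Cℂ.zero-product-comm z (1ᶜ ℂ.+ ℂ.- z) (Cℂ.idempotent⇒zero-product z zz≈z))
          (N , λ n N≤n → ¼≤z (seq (re z) n) (near n N≤n))))
  where
  open ℚₚ.≤-Reasoning
  near : ∀ n → N ℕ.≤ n → seq (re z) N ℚ.- seq (re z) n ℚ.≤ ¼
  near n N≤n = ℚₚ.≤-trans (p≤∣p∣ _) (ℚₚ.<⇒≤ (close N n ℕₚ.≤-refl N≤n))
  ¼≤z : ∀ q → seq (re z) N ℚ.- q ℚ.≤ ¼ → ¼ ℚ.≤ q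
  ¼≤z q q≤ = begin
    ¼                                                        ≡⟨⟩
    ½ ℚ.+ ℚ.- ¼
      ≤⟨ ℚₚ.+-mono-≤ (ℚₚ.<⇒≤ (ℚₚ.≰⇒> z≰½)) (ℚₚ.neg-antimono-≤ q≤) ⟩
    seq (re z) N ℚ.+ ℚ.- (seq (re z) N ℚ.- q)                ≡⟨ Pairs.subtract-back (seq (re z) N) q ⟩
    q                                                        ∎

-- Finite sums and matrices over a commutative ring

-- Over an arbitrary K the ring operations stay opaque; at `ℂ` these sums and matrix products agree
-- by computation with those in the definition of a character table.
module Matrices (K : CommutativeRing 0ℓ 0ℓ) where

  open CommutativeRing K hiding (zero) renaming (Carrier to C; refl to ≈-refl; sym to ≈-sym; trans to ≈-trans; reflexive to ≈-reflexive)
  open SetoidReasoning setoid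
  open import Algebra.Properties.Ring ring using (-0#≈0#; -‿+-comm; -‿distribˡ-*)
  open import Algebra.Properties.CommutativeSemigroup +-commutativeSemigroup using (interchange)
  open import Algebra.Properties.CommutativeSemigroup *-commutativeSemigroup using (x∙yz≈y∙xz)

  ∑ : {A : Set} → List A → (A → C) → C
  ∑ as f = List.foldr (λ a s → f a + s) 0# as

  module _ {A : Set} where

    ∑-cong : ∀ (as : List A) {f g : A → C} → (∀ a → f a ≈ g a) → ∑ as f ≈ ∑ as g
    ∑-cong []       eq = ≈-refl
    ∑-cong (a ∷ as) eq = +-cong (eq a) (∑-cong as eq)

    ∑-zero : ∀ (as : List A) → ∑ as (λ _ → 0#) ≈ 0#
    ∑-zero []       = ≈-refl
    ∑-zero (a ∷ as) = ≈-trans (+-identityˡ _) (∑-zero as)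

    ∑-+ : ∀ (as : List A) (f g : A → C) → ∑ as (λ a → f a + g a) ≈ ∑ as f + ∑ as g
    ∑-+ []       f g = ≈-sym (+-identityˡ 0#)
    ∑-+ (a ∷ as) f g = ≈-trans (+-congˡ (∑-+ as f g)) (interchange (f a) (g a) (∑ as f) (∑ as g))

    ∑-*ˡ : ∀ (as : List A) c (f : A → C) → ∑ as (λ a → c * f a) ≈ c * ∑ as f
    ∑-*ˡ []       c f = ≈-sym (zeroʳ c)
    ∑-*ˡ (a ∷ as) c f = ≈-trans (+-congˡ (∑-*ˡ as c f)) (≈-sym (distribˡ c (f a) (∑ as f)))

    ∑-*ʳ : ∀ (as : List A) c (f : A → C) → ∑ as (λ a → f a * c) ≈ ∑ as f * c
    ∑-*ʳ as c f = ≈-trans (∑-cong as λ a → *-comm (f a) c) (≈-trans (∑-*ˡ as c f) (*-comm c (∑ as f)))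

    ∑-neg : ∀ (as : List A) (f : A → C) → ∑ as (λ a → - f a) ≈ - ∑ as f
    ∑-neg []       f = ≈-sym -0#≈0#
    ∑-neg (a ∷ as) f = ≈-trans (+-congˡ (∑-neg as f)) (-‿+-comm (f a) (∑ as f))

    ∑-++ : ∀ (as bs : List A) (f : A → C) → ∑ (as List.++ bs) f ≈ ∑ as f + ∑ bs f
    ∑-++ []       bs f = ≈-sym (+-identityˡ (∑ bs f))
    ∑-++ (a ∷ as) bs f = ≈-trans (+-congˡ (∑-++ as bs f)) (≈-sym (+-assoc (f a) (∑ as f) (∑ bs f)))

  ∑-empty : ∀ {A : Set} (as : List A) f → length as ≡ 0 → ∑ as f ≈ 0#
  ∑-empty [] f refl = ≈-refl

  ∑-swap : ∀ {A B : Set} (as : List A) (bs : List B) (f : A → B → C) →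
           ∑ as (λ a → ∑ bs (f a)) ≈ ∑ bs (λ b → ∑ as (λ a → f a b))
  ∑-swap []       bs f = ≈-sym (∑-zero bs)
  ∑-swap (a ∷ as) bs f = ≈-trans (+-congˡ (∑-swap as bs f)) (≈-sym (∑-+ bs (f a) (λ b → ∑ as (λ a → f a b))))

  ∑-map : ∀ {A B : Set} (g : A → B) as (f : B → C) → ∑ (List.map g as) f ≈ ∑ as (f ∘ g)
  ∑-map g []       f = ≈-refl
  ∑-map g (a ∷ as) f = +-congˡ (∑-map g as f)

  ∑-cartesianProductWith : ∀ {A B D : Set} (g : A → B → D) as bs (f : D → C) →
    ∑ (List.cartesianProductWith g as bs) f ≈ ∑ as (λ a → ∑ bs (λ b → f (g a b)))
  ∑-cartesianProductWith g []       bs f = ≈-refl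
  ∑-cartesianProductWith g (a ∷ as) bs f = ≈-trans (∑-++ (List.map (g a) bs) _ f)
    (+-cong (∑-map (g a) bs f) (∑-cartesianProductWith g as bs f))

  ∑-mapMaybe : ∀ {A B : Set} (g : A → Maybe B) as (f : B → C) → ∑ (List.mapMaybe g as) f ≈ ∑ as (λ a → maybe f 0# (g a))
  ∑-mapMaybe g []       f = ≈-refl
  ∑-mapMaybe g (a ∷ as) f with g a
  ... | just b  = +-congˡ (∑-mapMaybe g as f)
  ... | nothing = ≈-trans (∑-mapMaybe g as f) (≈-sym (+-identityˡ _))

  ∑-tabulate : ∀ {A : Set} m (g : Fin m → A) (f : A → C) k → (∀ l → l ≢ k → f (g l) ≈ 0#) → ∑ (List.tabulate g) f ≈ f (g k)
  ∑-tabulate (suc m) g f zero    eq = ≈-trans (+-congˡ (vanish m (g ∘ suc) λ l → eq (suc l) λ ())) (+-identityʳ _)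
    where
    vanish : ∀ m g → (∀ l → f (g l) ≈ 0#) → ∑ (List.tabulate {n = m} g) f ≈ 0#
    vanish zero    g eq = ≈-refl
    vanish (suc m) g eq = ≈-trans (+-cong (eq zero) (vanish m (g ∘ suc) (eq ∘ suc))) (+-identityˡ 0#)
  ∑-tabulate (suc m) g f (suc k) eq = ≈-trans (+-cong (eq zero λ ())
    (∑-tabulate m (g ∘ suc) f k λ l l≢k → eq (suc l) (l≢k ∘ Fin.suc-injective))) (+-identityˡ _)

  ∑-allFin : ∀ {m} (f : Fin m → C) k → (∀ l → l ≢ k → f l ≈ 0#) → ∑ (allFin m) f ≈ f k
  ∑-allFin {m} f = ∑-tabulate m (λ l → l) f

  Matrix : Set → Set
  Matrix X = X → X → C

  module _ {X : Set} (elems : List X) where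

    infix  4 _≋_
    infixl 7 _⊡_

    _≋_ : Matrix X → Matrix X → Set
    M ≋ N = ∀ x y → M x y ≈ N x y

    _⊡_ : Matrix X → Matrix X → Matrix X
    (M ⊡ N) x y = ∑ elems λ z → M x z * N z y

    linComb : ∀ {m} → (Fin m → C) → (Fin m → Matrix X) → Matrix X
    linComb {m} c M x y = ∑ (allFin m) λ j → c j * M j x y

    ⊡-cong : ∀ {M M′ N N′} → M ≋ M′ → N ≋ N′ → M ⊡ N ≋ M′ ⊡ N′
    ⊡-cong p q x y = ∑-cong elems λ z → *-cong (p x z) (q z y)

    linComb-⊡ : ∀ {m} (f : Fin m → C) M N → linComb f M ⊡ N ≋ linComb f (λ j → M j ⊡ N)
    linComb-⊡ {m} f M N x y = begin
      ∑ elems (λ z → ∑ (allFin m) (λ j → f j * M j x z) * N z y)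
        ≈⟨ ∑-cong elems (λ z → ≈-sym (∑-*ʳ (allFin m) (N z y) _)) ⟩
      ∑ elems (λ z → ∑ (allFin m) (λ j → f j * M j x z * N z y))     ≈⟨ ∑-swap elems (allFin m) _ ⟩
      ∑ (allFin m) (λ j → ∑ elems (λ z → f j * M j x z * N z y))
        ≈⟨ ∑-cong (allFin m) (λ j → ≈-trans (∑-cong elems λ z → *-assoc (f j) _ _) (∑-*ˡ elems (f j) _)) ⟩
      ∑ (allFin m) (λ j → f j * (M j ⊡ N) x y)                       ∎

    ⊡-linComb : ∀ {m} (f : Fin m → C) M N → N ⊡ linComb f M ≋ linComb f (λ j → N ⊡ M j)
    ⊡-linComb {m} f M N x y = begin
      ∑ elems (λ z → N x z * ∑ (allFin m) (λ j → f j * M j z y))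
        ≈⟨ ∑-cong elems (λ z → ≈-sym (∑-*ˡ (allFin m) (N x z) _)) ⟩
      ∑ elems (λ z → ∑ (allFin m) (λ j → N x z * (f j * M j z y)))   ≈⟨ ∑-swap elems (allFin m) _ ⟩
      ∑ (allFin m) (λ j → ∑ elems (λ z → N x z * (f j * M j z y)))
        ≈⟨ ∑-cong (allFin m) (λ j → ≈-trans (∑-cong elems λ z → x∙yz≈y∙xz (N x z) (f j) _) (∑-*ˡ elems (f j) _)) ⟩
      ∑ (allFin m) (λ j → f j * (N ⊡ M j) x y)                       ∎

    linComb-substitute : ∀ {l m} (f : Fin l → C) (B : Fin l → Matrix X) (w : Fin l → Fin m → C) A →
      (∀ k → B k ≋ linComb (w k) A) → linComb f B ≋ linComb (λ j → ∑ (allFin l) (λ k → f k * w k j)) A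
    linComb-substitute {l} {m} f B w A B≋ x y = begin
      ∑ (allFin l) (λ k → f k * B k x y)
        ≈⟨ ∑-cong (allFin l) (λ k → *-congˡ (B≋ k x y)) ⟩
      ∑ (allFin l) (λ k → f k * ∑ (allFin m) (λ j → w k j * A j x y))
        ≈⟨ ∑-cong (allFin l) (λ k → ≈-sym (∑-*ˡ (allFin m) (f k) _)) ⟩
      ∑ (allFin l) (λ k → ∑ (allFin m) (λ j → f k * (w k j * A j x y)))       ≈⟨ ∑-swap (allFin l) (allFin m) _ ⟩
      ∑ (allFin m) (λ j → ∑ (allFin l) (λ k → f k * (w k j * A j x y)))
        ≈⟨ ∑-cong (allFin m) (λ j → ≈-trans (∑-cong (allFin l) λ k → ≈-sym (*-assoc (f k) (w k j) _)) (∑-*ʳ (allFin l) (A j x y) _)) ⟩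
      ∑ (allFin m) (λ j → ∑ (allFin l) (λ k → f k * w k j) * A j x y)         ∎

    -- Two hypotheses carry the constructive content: `cancel` strengthens E k ≠ 0 so that
    -- coefficients are unique, and `dichotomy` decides vanishing for idempotent scalars only.
    module OrthogonalIdempotents {d} (E : Fin d → Matrix X)
      (idempotent : ∀ k → E k ⊡ E k ≋ E k)
      (orthogonal : ∀ k l → k ≢ l → E k ⊡ E l ≋ λ _ _ → 0#)
      (cancel : ∀ k c → (∀ x y → c * E k x y ≈ 0#) → c ≈ 0#)
      (1≉0 : ¬ (1# ≈ 0#))
      (dichotomy : ∀ z → z * z ≈ z → z ≈ 0# ⊎ z ≈ 1#)
      where

      nonzero : ∀ k → ¬ (E k ≋ λ _ _ → 0#)
      nonzero k E≋0 = 1≉0 (cancel k 1# λ x y → ≈-trans (*-identityˡ _) (E≋0 x y))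

      distinct : ∀ k l → E k ≋ E l → k ≡ l
      distinct k l Ek≋El with k Fin.≟ l
      ... | yes k≡l = k≡l
      ... | no k≢l  = contradiction (λ x y → begin
              E k x y              ≈⟨ idempotent k x y ⟨
              (E k ⊡ E k) x y      ≈⟨ ⊡-cong {E k} {E k} {E k} {E l} (λ _ _ → ≈-refl) Ek≋El x y ⟩
              (E k ⊡ E l) x y      ≈⟨ orthogonal k l k≢l x y ⟩
              0#                   ∎) (nonzero k)

      linComb-⊡-E : ∀ f k → linComb f E ⊡ E k ≋ λ x y → f k * E k x y
      linComb-⊡-E f k x y = begin
        (linComb f E ⊡ E k) x y                         ≈⟨ linComb-⊡ f E (E k) x y ⟩
        ∑ (allFin d) (λ l → f l * (E l ⊡ E k) x y)
          ≈⟨ ∑-allFin _ k (λ l l≢k → ≈-trans (*-congˡ (orthogonal l k l≢k x y)) (zeroʳ (f l))) ⟩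
        f k * (E k ⊡ E k) x y                           ≈⟨ *-congˡ (idempotent k x y) ⟩
        f k * E k x y                                   ∎

      -- Multiplication by E k isolates the k-th coefficient, and `cancel` strips off the matrix.
      coefficients-unique : ∀ f g → linComb f E ≋ linComb g E → ∀ k → f k ≈ g k
      coefficients-unique f g eq k = begin
        f k                      ≈⟨ +-identityʳ (f k) ⟨
        f k + 0#                 ≈⟨ +-congˡ (-‿inverseˡ (g k)) ⟨
        f k + (- g k + g k)      ≈⟨ +-assoc (f k) (- g k) (g k) ⟨
        (f k - g k) + g k        ≈⟨ +-congʳ (cancel k (f k - g k) difference) ⟩
        0# + g k                 ≈⟨ +-identityˡ (g k) ⟩
        g k                      ∎
        where
        difference : ∀ x y → (f k - g k) * E k x y ≈ 0#
        difference x y = begin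
          (f k - g k) * E k x y                ≈⟨ distribʳ (E k x y) (f k) (- g k) ⟩
          f k * E k x y + - g k * E k x y
            ≈⟨ +-cong (≈-sym (linComb-⊡-E f k x y)) (≈-sym (-‿distribˡ-* (g k) (E k x y))) ⟩
          (linComb f E ⊡ E k) x y - g k * E k x y
            ≈⟨ +-congʳ (⊡-cong {N = E k} {N′ = E k} eq (λ _ _ → ≈-refl) x y) ⟩
          (linComb g E ⊡ E k) x y - g k * E k x y              ≈⟨ +-congʳ (linComb-⊡-E g k x y) ⟩
          g k * E k x y - g k * E k x y        ≈⟨ -‿inverseʳ _ ⟩
          0#                                   ∎

      -- Orthogonality makes multiplication on the span coordinatewise, so an idempotent of the span
      -- is a vector of idempotent scalars.
      linComb-⊡-linComb : ∀ f g → linComb f E ⊡ linComb g E ≋ linComb (λ k → f k * g k) E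
      linComb-⊡-linComb f g x y = ≈-trans (⊡-linComb g E (linComb f E) x y) (∑-cong (allFin d) λ k → begin
        g k * (linComb f E ⊡ E k) x y    ≈⟨ *-congˡ (linComb-⊡-E f k x y) ⟩
        g k * (f k * E k x y)            ≈⟨ *-assoc (g k) (f k) _ ⟨
        g k * f k * E k x y              ≈⟨ *-congʳ (*-comm (g k) (f k)) ⟩
        f k * g k * E k x y              ∎)

      Span : Matrix X → Set
      Span M = ∃ λ f → M ≋ linComb f E

      coefficients-⊡ : ∀ {M N P} ((f , _) : Span M) ((g , _) : Span N) ((h , _) : Span P) → M ⊡ N ≋ P → ∀ k → f k * g k ≈ h k
      coefficients-⊡ {M} {N} {P} (f , M≋) (g , N≋) (h , P≋) MN≋P = coefficients-unique (λ k → f k * g k) h λ x y → begin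
        linComb (λ k → f k * g k) E x y      ≈⟨ linComb-⊡-linComb f g x y ⟨
        (linComb f E ⊡ linComb g E) x y      ≈⟨ ⊡-cong M≋ N≋ x y ⟨
        (M ⊡ N) x y                          ≈⟨ MN≋P x y ⟩
        P x y                                ≈⟨ P≋ x y ⟩
        linComb h E x y                      ∎

      zero-Span : Span (λ _ _ → 0#)
      zero-Span = (λ _ → 0#) , λ x y → ≈-sym (≈-trans (∑-cong (allFin d) λ k → zeroˡ _) (∑-zero (allFin d)))

      δᵏ : Fin d → Fin d → C
      δᵏ k l = if does (l Fin.≟ k) then 1# else 0#

      δ-diag : ∀ k → δᵏ k k ≈ 1#
      δ-diag k = ≈-reflexive (cong (if_then 1# else 0#) (dec-true (k Fin.≟ k) refl))

      δ-off : ∀ k l → l ≢ k → δᵏ k l ≈ 0#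
      δ-off k l l≢k = ≈-reflexive (cong (if_then 1# else 0#) (dec-false (l Fin.≟ k) l≢k))

      single : ∀ f k → (∀ l → l ≢ k → f l ≈ 0#) → linComb f E ≋ λ x y → f k * E k x y
      single f k eq x y = ∑-allFin _ k λ l l≢k → ≈-trans (*-congʳ (eq l l≢k)) (zeroˡ _)

      E-Span : ∀ k → Span (E k)
      E-Span k = δᵏ k , λ x y → ≈-sym (≈-trans (single (δᵏ k) k (δ-off k) x y)
        (≈-trans (*-congʳ (δ-diag k)) (*-identityˡ _)))

      coefficients-zero : ∀ {M} ((f , _) : Span M) → (∀ k → f k ≈ 0#) → M ≋ λ _ _ → 0#
      coefficients-zero (f , M≋) f≈0 x y = ≈-trans (M≋ x y)
        (≈-trans (∑-cong (allFin d) λ k → ≈-trans (*-congʳ (f≈0 k)) (zeroˡ _)) (∑-zero (allFin d)))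

      coefficients-+ : ∀ {M F G} ((h , _) : Span M) ((f , _) : Span F) ((g , _) : Span G) →
        M ≋ (λ x y → F x y + G x y) → ∀ k → f k + g k ≈ h k
      coefficients-+ {M} {F} {G} (h , M≋) (f , F≋) (g , G≋) M≋F+G = coefficients-unique (λ k → f k + g k) h λ x y → begin
        linComb (λ l → f l + g l) E x y                        ≈⟨ ∑-cong (allFin d) (λ l → distribʳ _ (f l) (g l)) ⟩
        ∑ (allFin d) (λ l → f l * E l x y + g l * E l x y)     ≈⟨ ∑-+ (allFin d) _ _ ⟩
        linComb f E x y + linComb g E x y                      ≈⟨ +-cong (F≋ x y) (G≋ x y) ⟨
        F x y + G x y                                          ≈⟨ M≋F+G x y ⟨
        M x y                                                  ≈⟨ M≋ x y ⟩
        linComb h E x y                                        ∎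

      -- Off the k-th component the coefficients are f and -f with f idempotent and f(-f) = 0.
      indecomposable : ∀ k F G → Span F → Span G → F ⊡ F ≋ F → G ⊡ G ≋ G → F ⊡ G ≋ (λ _ _ → 0#) →
        E k ≋ (λ x y → F x y + G x y) → (F ≋ λ _ _ → 0#) ⊎ (G ≋ λ _ _ → 0#)
      indecomposable k F G F∈@(f , F≋) G∈@(g , G≋) FF GG FG E≋F+G with dichotomy (f k) (coefficients-⊡ F∈ F∈ F∈ FF k)
      ... | inj₁ fk≈0 = inj₁ (coefficients-zero {F} F∈ all)
        where
        all : ∀ l → f l ≈ 0#
        all l with l Fin.≟ k
        ... | yes refl = fk≈0
        ... | no l≢k   = begin
          f l                    ≈⟨ coefficients-⊡ F∈ F∈ F∈ FF l ⟨
          f l * f l              ≈⟨ +-identityʳ _ ⟨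
          f l * f l + 0#         ≈⟨ +-congˡ (coefficients-⊡ F∈ G∈ zero-Span FG l) ⟨
          f l * f l + f l * g l  ≈⟨ distribˡ (f l) (f l) (g l) ⟨
          f l * (f l + g l)
            ≈⟨ *-congˡ (≈-trans (coefficients-+ {E k} {F} {G} (E-Span k) F∈ G∈ E≋F+G l) (δ-off k l l≢k)) ⟩
          f l * 0#               ≈⟨ zeroʳ (f l) ⟩
          0#                     ∎
      ... | inj₂ fk≈1 = inj₂ (coefficients-zero {G} G∈ all)
        where
        all : ∀ l → g l ≈ 0#
        all l with l Fin.≟ k
        ... | yes refl = begin
          g k          ≈⟨ *-identityˡ (g k) ⟨
          1# * g k     ≈⟨ *-congʳ fk≈1 ⟨
          f k * g k    ≈⟨ coefficients-⊡ F∈ G∈ zero-Span FG k ⟩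
          0#           ∎
        ... | no l≢k   = begin
          g l                    ≈⟨ coefficients-⊡ G∈ G∈ G∈ GG l ⟨
          g l * g l              ≈⟨ +-identityˡ _ ⟨
          0# + g l * g l         ≈⟨ +-congʳ (coefficients-⊡ F∈ G∈ zero-Span FG l) ⟨
          f l * g l + g l * g l  ≈⟨ distribʳ (g l) (f l) (g l) ⟨
          (f l + g l) * g l
            ≈⟨ *-congʳ (≈-trans (coefficients-+ {E k} {F} {G} (E-Span k) F∈ G∈ E≋F+G l) (δ-off k l l≢k)) ⟩
          0# * g l               ≈⟨ zeroˡ (g l) ⟩
          0#                     ∎

      IndecomposableIn : (Matrix X → Set) → Matrix X → Set
      IndecomposableIn 𝒜 M = ∀ F G → 𝒜 F → 𝒜 G → F ⊡ F ≋ F → G ⊡ G ≋ G → F ⊡ G ≋ (λ _ _ → 0#) →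
        G ⊡ F ≋ (λ _ _ → 0#) → M ≋ (λ x y → F x y + G x y) → (F ≋ λ _ _ → 0#) ⊎ (G ≋ λ _ _ → 0#)

      search : ∀ {m} (P Q : Fin m → Set) → (∀ k → P k ⊎ Q k) → (∀ k → P k) ⊎ ∃ Q
      search {zero}  P Q decide = inj₁ λ ()
      search {suc m} P Q decide with decide zero | search (P ∘ suc) (Q ∘ suc) (decide ∘ suc)
      ... | inj₂ q | _            = inj₂ (zero , q)
      ... | inj₁ _ | inj₂ (k , q) = inj₂ (suc k , q)
      ... | inj₁ p | inj₁ ps      = inj₁ λ { zero → p ; (suc k) → ps k }

      -- A nonzero idempotent has some coefficient f k = 1, and then splits as E k plus the idempotent with f k reset to 0.
      exhaustive : ∀ F → Span F → F ⊡ F ≋ F → ¬ (F ≋ λ _ _ → 0#) → IndecomposableIn Span F → ∃ λ k → F ≋ E k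
      exhaustive F F∈@(f , F≋) FF F≉0 indec
        with search (λ k → f k ≈ 0#) (λ k → f k ≈ 1#) (λ k → dichotomy (f k) (coefficients-⊡ F∈ F∈ F∈ FF k))
      ... | inj₁ f≈0        = contradiction (coefficients-zero {F} F∈ f≈0) F≉0
      ... | inj₂ (k , fk≈1) = k , conclude (indec (E k) G (E-Span k) (g , λ _ _ → ≈-refl) (idempotent k) GG EG GE F≋E+G)
        where
        g : Fin d → C
        g l = if does (l Fin.≟ k) then 0# else f l
        G : Matrix X
        G = linComb g E
        ff : ∀ l → f l * f l ≈ f l
        ff = coefficients-⊡ F∈ F∈ F∈ FF
        congruent : ∀ h h′ → (∀ l → h l ≈ h′ l) → linComb h E ≋ linComb h′ E
        congruent h h′ eq x y = ∑-cong (allFin d) λ l → *-congʳ (eq l)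
        gg : ∀ l → g l * g l ≈ g l
        gg l with l Fin.≟ k
        ... | yes _ = zeroˡ 0#
        ... | no _  = ff l
        gk≈0 : g k ≈ 0#
        gk≈0 = ≈-reflexive (cong (if_then 0# else f k) (dec-true (k Fin.≟ k) refl))
        GG : G ⊡ G ≋ G
        GG x y = ≈-trans (linComb-⊡-linComb g g x y) (congruent (λ l → g l * g l) g gg x y)
        GE : G ⊡ E k ≋ λ _ _ → 0#
        GE x y = ≈-trans (linComb-⊡-E g k x y) (≈-trans (*-congʳ gk≈0) (zeroˡ _))
        EG : E k ⊡ G ≋ λ _ _ → 0#
        EG x y = begin
          (E k ⊡ G) x y                                ≈⟨ ⊡-linComb g E (E k) x y ⟩
          ∑ (allFin d) (λ l → g l * (E k ⊡ E l) x y)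
            ≈⟨ ∑-allFin _ k (λ l l≢k → ≈-trans (*-congˡ (orthogonal k l (l≢k ∘ sym) x y)) (zeroʳ (g l))) ⟩
          g k * (E k ⊡ E k) x y                        ≈⟨ *-congʳ gk≈0 ⟩
          0# * (E k ⊡ E k) x y                         ≈⟨ zeroˡ _ ⟩
          0#                                           ∎
        split : ∀ l → f l ≈ δᵏ k l + g l
        split l with l Fin.≟ k
        ... | yes refl = ≈-trans fk≈1 (≈-sym (+-identityʳ 1#))
        ... | no _     = ≈-sym (+-identityˡ (f l))
        F≋E+G : F ≋ λ x y → E k x y + G x y
        F≋E+G x y = begin
          F x y                                                  ≈⟨ F≋ x y ⟩
          linComb f E x y                                        ≈⟨ congruent f (λ l → δᵏ k l + g l) split x y ⟩
          linComb (λ l → δᵏ k l + g l) E x y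
            ≈⟨ ∑-cong (allFin d) (λ l → distribʳ _ (δᵏ k l) (g l)) ⟩
          ∑ (allFin d) (λ l → δᵏ k l * E l x y + g l * E l x y)  ≈⟨ ∑-+ (allFin d) _ _ ⟩
          linComb (δᵏ k) E x y + G x y                           ≈⟨ +-congʳ (proj₂ (E-Span k) x y) ⟨
          E k x y + G x y                                        ∎
        conclude : (E k ≋ λ _ _ → 0#) ⊎ (G ≋ λ _ _ → 0#) → F ≋ E k
        conclude (inj₁ Ek≋0) = contradiction Ek≋0 (nonzero k)
        conclude (inj₂ G≋0)  = λ x y → ≈-trans (F≋E+G x y) (≈-trans (+-congˡ (G≋0 x y)) (+-identityʳ _))

-- Eisenstein numbers

-- (p , q) stands for p + q ω.
ℚω : Set
ℚω = ℚ × ℚ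

infix  8 -ₑ_
infixl 7 _*ₑ_
infixl 6 _+ₑ_

-- The product reduces ω² to -1 - ω.
_+ₑ_ _*ₑ_ : ℚω → ℚω → ℚω
(p , q) +ₑ (r , s) = p ℚ.+ r , q ℚ.+ s
(p , q) *ₑ (r , s) = p ℚ.* r ℚ.- q ℚ.* s , p ℚ.* s ℚ.+ q ℚ.* r ℚ.- q ℚ.* s

-ₑ_ : ℚω → ℚω
-ₑ (p , q) = ℚ.- p , ℚ.- q

_≟ₑ_ : DecidableEquality ℚω
_≟ₑ_ = Product.≡-dec ℚₚ._≟_ ℚₚ._≟_

rat : ℚ → ℚω
rat p = p , 0ℚ

int : ℤ → ℚω
int k = rat (k ℚ./ 1)

0ₑ 1ₑ ωₑ ω̄ₑ : ℚω
0ₑ = int (+ 0)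
1ₑ = int (+ 1)
ωₑ = 0ℚ , 1ℚ
ω̄ₑ = ℚ.- 1ℚ , ℚ.- 1ℚ

-- The solver asks of its coefficients only the operations, a test for equality and a homomorphism
-- into K, hence a raw ring.
ℚω-rawRing : RawRing 0ℓ 0ℓ
ℚω-rawRing = record { Carrier = ℚω ; _≈_ = _≡_ ; _+_ = _+ₑ_ ; _*_ = _*ₑ_ ; -_ = -ₑ_ ; 0# = 0ₑ ; 1# = 1ₑ }

module EisensteinMorphism
  (K : CommutativeRing 0ℓ 0ℓ) (ι : ℚ → CommutativeRing.Carrier K)
  (ι-homo : IsRingHomomorphism ℚ.+-*-rawRing (CommutativeRing.rawRing K) ι)
  where

  open CommutativeRing K renaming (refl to ≈-refl; sym to ≈-sym; trans to ≈-trans; reflexive to ≈-reflexive)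
  open RationalSolver K ι ι-homo
  open SetoidReasoning setoid
  private module H = IsRingHomomorphism ι-homo

  module _ (w : Carrier) (minimal : w * w + w + ι 1ℚ ≈ ι 0ℚ) where

    evaluate : ℚω → Carrier
    evaluate (p , q) = ι p + ι q * w

    evaluate-homo : IsRingHomomorphism ℚω-rawRing rawRing evaluate
    evaluate-homo = record
      { isSemiringHomomorphism = record
        { isNearSemiringHomomorphism = record
          { +-isMonoidHomomorphism = record
            { isMagmaHomomorphism = record
              { isRelHomomorphism = record { cong = λ { refl → ≈-refl } }
              ; homo = λ (p , q) (r , s) → begin
                  ι (p ℚ.+ r) + ι (q ℚ.+ s) * w        ≈⟨ +-cong (H.+-homo p r) (*-congʳ (H.+-homo q s)) ⟩
                  (ι p + ι r) + (ι q + ι s) * w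
                    ≈⟨ solve 5 (λ p r q s w → (p :+ r) :+ (q :+ s) :* w := (p :+ q :* w) :+ (r :+ s :* w)) ≈-refl (ι p) (ι r) (ι q) (ι s) w ⟩
                  (ι p + ι q * w) + (ι r + ι s * w)    ∎
              }
            ; ε-homo = ≈-trans (solve 1 (λ w → con 0ℚ :+ con 0ℚ :* w := con 0ℚ) ≈-refl w) H.0#-homo
            }
          ; *-homo = λ (p , q) (r , s) → begin
              ι (p ℚ.* r ℚ.- q ℚ.* s) + ι (p ℚ.* s ℚ.+ q ℚ.* r ℚ.- q ℚ.* s) * w
                ≈⟨ +-cong (difference (p ℚ.* r) (q ℚ.* s)) (*-congʳ (difference (p ℚ.* s ℚ.+ q ℚ.* r) (q ℚ.* s))) ⟩
              (ι (p ℚ.* r) - ι (q ℚ.* s)) + (ι (p ℚ.* s ℚ.+ q ℚ.* r) - ι (q ℚ.* s)) * w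
                ≈⟨ +-cong (+-cong (H.*-homo p r) (-‿cong (H.*-homo q s)))
                          (*-congʳ (+-cong (≈-trans (H.+-homo _ _) (+-cong (H.*-homo p s) (H.*-homo q r))) (-‿cong (H.*-homo q s)))) ⟩
              (ι p * ι r - ι q * ι s) + (ι p * ι s + ι q * ι r - ι q * ι s) * w
                -- The product formula differs from true multiplication by qs times the minimal
                -- polynomial at w.
                ≈⟨ solve 5 (λ p q r s w → (p :* r :- q :* s) :+ (p :* s :+ q :* r :- q :* s) :* w
                     := (p :+ q :* w) :* (r :+ s :* w) :- q :* s :* (w :* w :+ w :+ con 1ℚ)) ≈-refl (ι p) (ι q) (ι r) (ι s) w ⟩
              (ι p + ι q * w) * (ι r + ι s * w) - ι q * ι s * (w * w + w + ι 1ℚ)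
                ≈⟨ +-congˡ (-‿cong (*-congˡ minimal)) ⟩
              (ι p + ι q * w) * (ι r + ι s * w) - ι q * ι s * ι 0ℚ
                ≈⟨ solve 2 (λ x y → x :- y :* con 0ℚ := x) ≈-refl _ (ι q * ι s) ⟩
              (ι p + ι q * w) * (ι r + ι s * w)                              ∎
          }
        ; 1#-homo = ≈-trans (solve 1 (λ w → con 1ℚ :+ con 0ℚ :* w := con 1ℚ) ≈-refl w) H.1#-homo
        }
      ; -‿homo = λ (p , q) → begin
          ι (ℚ.- p) + ι (ℚ.- q) * w     ≈⟨ +-cong (H.-‿homo p) (*-congʳ (H.-‿homo q)) ⟩
          - ι p + - ι q * w
            ≈⟨ solve 3 (λ p q w → :- p :+ :- q :* w := :- (p :+ q :* w)) ≈-refl (ι p) (ι q) w ⟩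
          - (ι p + ι q * w)             ∎
      }
      where
      difference : ∀ p q → ι (p ℚ.- q) ≈ ι p - ι q
      difference p q = ≈-trans (H.+-homo p (ℚ.- q)) (+-congˡ (H.-‿homo q))

    evaluate-rat : ∀ p → evaluate (rat p) ≈ ι p
    evaluate-rat p = solve 2 (λ p w → p :+ con 0ℚ :* w := p) ≈-refl (ι p) w

    evaluate-ω : evaluate ωₑ ≈ w
    evaluate-ω = solve 1 (λ w → con 0ℚ :+ con 1ℚ :* w := w) ≈-refl w

    evaluate-ω̄ : ∀ w̄ → w̄ + w + ι 1ℚ ≈ ι 0ℚ → evaluate ω̄ₑ ≈ w̄
    evaluate-ω̄ w̄ sum = begin
      ι (ℚ.- 1ℚ) + ι (ℚ.- 1ℚ) * w
        ≈⟨ solve 2 (λ w w̄ → con (ℚ.- 1ℚ) :+ con (ℚ.- 1ℚ) :* w := w̄ :- (w̄ :+ w :+ con 1ℚ)) ≈-refl w w̄ ⟩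
      w̄ - (w̄ + w + ι 1ℚ)                         ≈⟨ +-congˡ (-‿cong sum) ⟩
      w̄ - ι 0ℚ                                   ≈⟨ solve 1 (λ w̄ → w̄ :- con 0ℚ := w̄) ≈-refl w̄ ⟩
      w̄                                          ∎

module EisensteinSolver
  (K : CommutativeRing 0ℓ 0ℓ) (κ : ℚω → CommutativeRing.Carrier K)
  (κ-homo : IsRingHomomorphism ℚω-rawRing (CommutativeRing.rawRing K) κ)
  where

  private module H = IsRingHomomorphism κ-homo

  morphism : ℚω-rawRing -Raw-AlmostCommutative⟶ fromCommutativeRing K
  morphism = record
    { ⟦_⟧    = κ
    ; +-homo = H.+-homo
    ; *-homo = H.*-homo
    ; -‿homo = H.-‿homo
    ; 0-homo = H.0#-homo
    ; 1-homo = H.1#-homo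
    }

  weaklyDecidable : WeaklyDecidable (Induced-equivalence morphism)
  weaklyDecidable p q with p ≟ₑ q
  ... | yes p≡q = just (H.⟦⟧-cong p≡q)
  ... | no _    = nothing

  open Solver ℚω-rawRing (fromCommutativeRing K) morphism weaklyDecidable public

-- Character sums

-- The additive character (-1)^Tr of 𝔽₄.
sign : 𝔽₄ → ℚω
sign 𝟘  = 1ₑ
sign 𝟙  = 1ₑ
sign ζ  = int (ℤ.- + 1)
sign ζ² = int (ℤ.- + 1)

module Characters
  (K : CommutativeRing 0ℓ 0ℓ) (κ : ℚω → CommutativeRing.Carrier K)
  (κ-homo : IsRingHomomorphism ℚω-rawRing (CommutativeRing.rawRing K) κ)
  where

  open CommutativeRing K hiding (zero) renaming (Carrier to C; refl to ≈-refl; sym to ≈-sym; trans to ≈-trans; reflexive to ≈-reflexive)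
  open EisensteinSolver K κ κ-homo
  open Matrices K
  open SetoidReasoning setoid
  private module H = IsRingHomomorphism κ-homo

  ♯ : ℤ → C
  ♯ k = κ (int k)

  ψ : 𝔽₄ → C
  ψ a = κ (sign a)

  ψ-⊕ : ∀ a b → ψ (a ⊕ b) ≈ ψ a * ψ b
  ψ-⊕ a b = ≈-trans (≈-reflexive (cong κ (multiplicative a b))) (H.*-homo (sign a) (sign b))
    where
    multiplicative : ∀ a b → sign (a ⊕ b) ≡ sign a *ₑ sign b
    multiplicative = from-yes (∀? λ a → ∀? λ b → sign (a ⊕ b) ≟ₑ (sign a *ₑ sign b))

  ψ-↑2 : ∀ a → ψ (a ↑ 2) ≡ ψ a
  ψ-↑2 a = cong κ (from-yes (∀? λ a → sign (a ↑ 2) ≟ₑ sign a) a)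

  -- The trace is invariant under conjugation, so F is symmetric although the form is only
  -- Hermitian.
  ψ-swap : ∀ {n} (x y : 𝔽₄^ n) → ψ ⟨ x , y ⟩ ≡ ψ ⟨ y , x ⟩
  ψ-swap x y = trans (sym (ψ-↑2 ⟨ x , y ⟩)) (cong ψ (sym (⟨⟩-swap x y)))

  ∑𝔽₄ : ∀ (f : 𝔽₄ → C) → ∑ 𝔽₄-elements f ≈ f 𝟘 + (f 𝟙 + (f ζ + f ζ²))
  ∑𝔽₄ f = +-congˡ (+-congˡ (+-congˡ (+-identityʳ (f ζ²))))

  pow : ℕ → C
  pow zero    = ♯ (+ 1)
  pow (suc n) = ♯ (ℤ.- + 2) * pow n

  ∑-product : ∀ n (f : 𝔽₄^ (suc n) → C) (g : 𝔽₄ → C) (h : 𝔽₄^ n → C) → (∀ a v → f (a ∷ v) ≈ g a * h v) →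
              ∑ (vectors (suc n)) f ≈ ∑ 𝔽₄-elements g * ∑ (vectors n) h
  ∑-product n f g h eq = begin
    ∑ (vectors (suc n)) f
      ≈⟨ ∑-cartesianProductWith _∷_ 𝔽₄-elements (vectors n) f ⟩
    ∑ 𝔽₄-elements (λ a → ∑ (vectors n) (λ v → f (a ∷ v)))
      ≈⟨ ∑-cong 𝔽₄-elements (λ a → ≈-trans (∑-cong (vectors n) (eq a)) (∑-*ˡ (vectors n) (g a) h)) ⟩
    ∑ 𝔽₄-elements (λ a → g a * ∑ (vectors n) h)                  ≈⟨ ∑-*ʳ 𝔽₄-elements (∑ (vectors n) h) g ⟩
    ∑ 𝔽₄-elements g * ∑ (vectors n) h                            ∎

  linear-sum : ∀ {n} → 𝔽₄^ n → C
  linear-sum {n} w = ∑ (vectors n) λ v → ψ ⟨ v , w ⟩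

  linear-sum-∷ : ∀ {n} b (w : 𝔽₄^ n) → linear-sum (b ∷ w) ≈ ∑ 𝔽₄-elements (λ a → ψ (a ⊗ b ↑ 2)) * linear-sum w
  linear-sum-∷ b w = ∑-product _ _ _ _ λ a v → ψ-⊕ (a ⊗ b ↑ 2) ⟨ v , w ⟩

  -- All 4ⁿ vectors contribute 1. The count is written as the square of (-2)ⁿ so that a single
  -- variable serves the later identities.
  linear-sum-zero : ∀ n → linear-sum (0⃗ {n}) ≈ pow n * pow n
  linear-sum-zero zero    = ≈-trans (+-identityʳ _) (solve 0 (con 1ₑ := con 1ₑ :* con 1ₑ) ≈-refl)
  linear-sum-zero (suc n) = begin
    linear-sum (0⃗ {suc n})                                        ≈⟨ linear-sum-∷ 𝟘 (0⃗ {n}) ⟩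
    ∑ 𝔽₄-elements (λ a → ψ (a ⊗ 𝟘)) * linear-sum (0⃗ {n})
      ≈⟨ *-cong (∑𝔽₄ (λ a → ψ (a ⊗ 𝟘))) (linear-sum-zero n) ⟩
    (♯ (+ 1) + (♯ (+ 1) + (♯ (+ 1) + ♯ (+ 1)))) * (pow n * pow n)
      ≈⟨ solve 1 (λ p → (con 1ₑ :+ (con 1ₑ :+ (con 1ₑ :+ con 1ₑ))) :* (p :* p) := (con (int (ℤ.- + 2)) :* p) :* (con (int (ℤ.- + 2)) :* p)) ≈-refl (pow n) ⟩
    pow (suc n) * pow (suc n)                                     ∎

  -- The sum factors over coordinates, and at a nonzero coordinate the factor is the sum of a
  -- nontrivial character over 𝔽₄, which is 0.
  linear-sum-nonzero : ∀ {n} (w : 𝔽₄^ n) → w ≢ 0⃗ → linear-sum w ≈ 0#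
  linear-sum-nonzero []      w≢0 = contradiction refl w≢0
  linear-sum-nonzero (b ∷ w) w≢0 = ≈-trans (linear-sum-∷ b w) (vanish b w≢0)
    where
    balanced : ∀ b → b ≢ 𝟘 → ∑ 𝔽₄-elements (λ a → ψ (a ⊗ b ↑ 2)) ≈ 0#
    balanced b b≢0 = ≈-trans (∑𝔽₄ (λ a → ψ (a ⊗ b ↑ 2))) (≈-trans (≈-sym (sums b)) (≈-trans (≈-reflexive (cong κ (cancels b b≢0))) H.0#-homo))
      where
      total : 𝔽₄ → ℚω
      total b = sign (𝟘 ⊗ b ↑ 2) +ₑ (sign (𝟙 ⊗ b ↑ 2) +ₑ (sign (ζ ⊗ b ↑ 2) +ₑ sign (ζ² ⊗ b ↑ 2)))
      sums : ∀ b → κ (total b) ≈ ψ (𝟘 ⊗ b ↑ 2) + (ψ (𝟙 ⊗ b ↑ 2) + (ψ (ζ ⊗ b ↑ 2) + ψ (ζ² ⊗ b ↑ 2)))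
      sums b = ≈-trans (H.+-homo _ _) (+-congˡ (≈-trans (H.+-homo _ _) (+-congˡ (H.+-homo _ _))))
      cancels : ∀ b → b ≢ 𝟘 → total b ≡ 0ₑ
      cancels = from-yes (∀? λ b → ¬? (b ≟ 𝟘) →-dec (total b ≟ₑ 0ₑ))
    vanish : ∀ b → b ∷ w ≢ 0⃗ → ∑ 𝔽₄-elements (λ a → ψ (a ⊗ b ↑ 2)) * linear-sum w ≈ 0#
    vanish b bw≢0 with b ≟ 𝟘
    ... | yes refl = ≈-trans (*-congˡ (linear-sum-nonzero w λ w≡0 → bw≢0 (cong (𝟘 ∷_) w≡0))) (zeroʳ _)
    ... | no b≢0   = ≈-trans (*-congʳ (balanced b b≢0)) (zeroˡ _)

  -- As ζ has trace 1, ψ(ζ⟨v,v⟩) is -1 to the norm of v. The norm of v + w exceeds the sum of the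
  -- two norms by the trace of ⟨v,w⟩, so the summand depends on v + w up to the phase at w. The form
  -- is diagonal, so the check is made in one coordinate, where 𝔽₄ contributes 1 - 3 = -2.
  quadratic-sum : ∀ {n} (w : 𝔽₄^ n) → ∑ (vectors n) (λ v → ψ (ζ ⊗ ⟨ v , v ⟩ ⊕ ⟨ v , w ⟩)) ≈ pow n * ψ (ζ ⊗ ⟨ w , w ⟩)
  quadratic-sum []          = ≈-trans (+-identityʳ _) (solve 0 (con 1ₑ := con 1ₑ :* con 1ₑ) ≈-refl)
  quadratic-sum {suc n} (b ∷ w) = begin
    ∑ (vectors (suc n)) (λ v → ψ (ζ ⊗ ⟨ v , v ⟩ ⊕ ⟨ v , b ∷ w ⟩))
      ≈⟨ ∑-product n _ (λ a → ψ (local a b)) (λ v → ψ (ζ ⊗ ⟨ v , v ⟩ ⊕ ⟨ v , w ⟩)) (λ a v → ≈-trans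
           (≈-reflexive (cong ψ (split (a ⊗ a ↑ 2) ⟨ v , v ⟩ (a ⊗ b ↑ 2) ⟨ v , w ⟩))) (ψ-⊕ (local a b) _)) ⟩
    ∑ 𝔽₄-elements (λ a → ψ (local a b)) * ∑ (vectors n) (λ v → ψ (ζ ⊗ ⟨ v , v ⟩ ⊕ ⟨ v , w ⟩))
      ≈⟨ *-cong (gauss b) (quadratic-sum w) ⟩
    (♯ (ℤ.- + 2) * ψ (ζ ⊗ (b ⊗ b ↑ 2))) * (pow n * ψ (ζ ⊗ ⟨ w , w ⟩))
      ≈⟨ solve 3 (λ p q r → (con (int (ℤ.- + 2)) :* p) :* (q :* r) := (con (int (ℤ.- + 2)) :* q) :* (p :* r)) ≈-refl _ (pow n) _ ⟩
    pow (suc n) * (ψ (ζ ⊗ (b ⊗ b ↑ 2)) * ψ (ζ ⊗ ⟨ w , w ⟩))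
      ≈⟨ *-congˡ (≈-sym (≈-trans (≈-reflexive (cong ψ (⊗-distribˡ ζ (b ⊗ b ↑ 2) ⟨ w , w ⟩))) (ψ-⊕ _ _))) ⟩
    pow (suc n) * ψ (ζ ⊗ ⟨ b ∷ w , b ∷ w ⟩) ∎
    where
    local : 𝔽₄ → 𝔽₄ → 𝔽₄
    local a b = ζ ⊗ (a ⊗ a ↑ 2) ⊕ a ⊗ b ↑ 2
    split : ∀ p q r s → ζ ⊗ (p ⊕ q) ⊕ (r ⊕ s) ≡ (ζ ⊗ p ⊕ r) ⊕ (ζ ⊗ q ⊕ s)
    split = from-yes (∀? λ p → ∀? λ q → ∀? λ r → ∀? λ s → (ζ ⊗ (p ⊕ q) ⊕ (r ⊕ s)) ≟ ((ζ ⊗ p ⊕ r) ⊕ (ζ ⊗ q ⊕ s)))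
    gauss : ∀ b → ∑ 𝔽₄-elements (λ a → ψ (local a b)) ≈ ♯ (ℤ.- + 2) * ψ (ζ ⊗ (b ⊗ b ↑ 2))
    gauss b = begin
      ∑ 𝔽₄-elements (λ a → ψ (local a b))                                    ≈⟨ ∑𝔽₄ (λ a → ψ (local a b)) ⟩
      ψ (local 𝟘 b) + (ψ (local 𝟙 b) + (ψ (local ζ b) + ψ (local ζ² b)))
        ≈⟨ ≈-trans (H.+-homo _ _) (+-congˡ (≈-trans (H.+-homo _ _) (+-congˡ (H.+-homo _ _)))) ⟨
      κ (total b)                                                            ≈⟨ ≈-reflexive (cong κ (evaluates b)) ⟩
      κ (int (ℤ.- + 2) *ₑ sign (ζ ⊗ (b ⊗ b ↑ 2)))                             ≈⟨ H.*-homo _ _ ⟩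
      ♯ (ℤ.- + 2) * ψ (ζ ⊗ (b ⊗ b ↑ 2))                                       ∎
      where
      total : 𝔽₄ → ℚω
      total b = sign (local 𝟘 b) +ₑ (sign (local 𝟙 b) +ₑ (sign (local ζ b) +ₑ sign (local ζ² b)))
      evaluates : ∀ b → total b ≡ int (ℤ.- + 2) *ₑ sign (ζ ⊗ (b ⊗ b ↑ 2))
      evaluates = from-yes (∀? λ b → total b ≟ₑ (int (ℤ.- + 2) *ₑ sign (ζ ⊗ (b ⊗ b ↑ 2))))

  ∑-vectors : ∀ {n} (f : 𝔽₄^ n → C) w → (∀ v → v ≢ w → f v ≈ 0#) → ∑ (vectors n) f ≈ f w
  ∑-vectors {zero}  f []      eq = +-identityʳ (f [])
  ∑-vectors {suc n} f (b ∷ w) eq = begin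
    ∑ (vectors (suc n)) f                                     ≈⟨ ∑-cartesianProductWith _∷_ 𝔽₄-elements (vectors n) f ⟩
    ∑ 𝔽₄-elements (λ a → ∑ (vectors n) (λ v → f (a ∷ v)))
      ≈⟨ ∑𝔽₄-single (λ a → ∑ (vectors n) (λ v → f (a ∷ v))) b (λ a a≢b →
                                                                   ≈-trans (∑-cong (vectors n) λ v → eq (a ∷ v) (a≢b ∘ cong Vec.head)) (∑-zero (vectors n))) ⟩
    ∑ (vectors n) (λ v → f (b ∷ v))
      ≈⟨ ∑-vectors (λ v → f (b ∷ v)) w (λ v v≢w → eq (b ∷ v) (v≢w ∘ cong Vec.tail)) ⟩
    f (b ∷ w)                                                 ∎
    where
    ∑𝔽₄-single : ∀ (g : 𝔽₄ → C) b → (∀ a → a ≢ b → g a ≈ 0#) → ∑ 𝔽₄-elements g ≈ g b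
    ∑𝔽₄-single g b eq = ≈-trans (∑-tabulate 4 element g (position b) λ l l≢ → eq (element l) λ el≡b →
        l≢ (trans (sym (position-element l)) (cong position el≡b))) (≈-reflexive (cong g (element-position b)))
      where
      element : Fin 4 → 𝔽₄
      element = lookup (𝟘 ∷ 𝟙 ∷ ζ ∷ ζ² ∷ [])
      position : 𝔽₄ → Fin 4
      position 𝟘  = 0F
      position 𝟙  = 1F
      position ζ  = 2F
      position ζ² = 3F
      position-element : ∀ l → position (element l) ≡ l
      position-element = from-yes (Fin.all? λ l → position (element l) Fin.≟ l)
      element-position : ∀ b → element (position b) ≡ b
      element-position = from-yes (∀? λ b → element (position b) ≟ b)

  toΦ-vec : ∀ {n} (x : Φ n) → toΦ (vec x) ≡ just x
  toΦ-vec x with vec x ≟ᵛ 0⃗ | ⟨ vec x , vec x ⟩ ≟ 𝟘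
  ... | no _  | yes _   = refl
  ... | no _  | no xx≢0 = contradiction (isotropicᶲ x) xx≢0
  ... | yes x≡0 | _     = contradiction x≡0 (nonzeroᶲ x)

  toΦ-inverse : ∀ {n} (v : 𝔽₄^ n) x → toΦ v ≡ just x → v ≡ vec x
  toΦ-inverse v x eq with v ≟ᵛ 0⃗ | ⟨ v , v ⟩ ≟ 𝟘
  toΦ-inverse v x refl | no _ | yes _ = refl

  -- This is the form in which it is used that `Φ-elements` lists every point exactly once.
  ∑Φ-single : ∀ {n} (f : Φ n → C) x → (∀ z → z ≢ x → f z ≈ 0#) → ∑ (Φ-elements n) f ≈ f x
  ∑Φ-single {n} f x eq = begin
    ∑ (Φ-elements n) f                               ≈⟨ ∑-mapMaybe toΦ (vectors n) f ⟩
    ∑ (vectors n) (λ v → maybe f 0# (toΦ v))         ≈⟨ ∑-vectors _ (vec x) elsewhere ⟩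
    maybe f 0# (toΦ (vec x))                         ≈⟨ ≈-reflexive (cong (maybe f 0#) (toΦ-vec x)) ⟩
    f x                                              ∎
    where
    elsewhere : ∀ v → v ≢ vec x → maybe f 0# (toΦ v) ≈ 0#
    elsewhere v v≢x with toΦ v in eq′
    ... | nothing = ≈-refl
    ... | just z  = eq z λ z≡x → v≢x (trans (toΦ-inverse v z eq′) (cong vec z≡x))

  -- The indicator of isotropy also counts the zero vector, which Φ excludes; hence the final -1.
  ∑Φ-ψ : ∀ {n} (w : 𝔽₄^ n) → ∑ (Φ-elements n) (λ z → ψ ⟨ vec z , w ⟩) ≈
         κ (rat ½) * (linear-sum w + pow n * ψ (ζ ⊗ ⟨ w , w ⟩)) - ♯ (+ 1)
  ∑Φ-ψ {n} w = begin
    ∑ (Φ-elements n) (λ z → ψ ⟨ vec z , w ⟩)                              ≈⟨ ∑-mapMaybe toΦ (vectors n) _ ⟩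
    ∑ (vectors n) (λ v → maybe (λ z → ψ ⟨ vec z , w ⟩) 0# (toΦ v))        ≈⟨ ∑-cong (vectors n) indicator ⟩
    ∑ (vectors n) (λ v → κ (rat ½) * (L v + Q v) - origin v)              ≈⟨ ∑-+ (vectors n) _ _ ⟩
    ∑ (vectors n) (λ v → κ (rat ½) * (L v + Q v)) + ∑ (vectors n) (λ v → - origin v)
      ≈⟨ +-cong (≈-trans (∑-*ˡ (vectors n) (κ (rat ½)) _) (*-congˡ (≈-trans (∑-+ (vectors n) L Q) (+-congˡ (quadratic-sum w)))))
                (≈-trans (∑-neg (vectors n) origin) (-‿cong (≈-trans (∑-vectors origin 0⃗ origin-elsewhere) origin-0))) ⟩
    κ (rat ½) * (linear-sum w + pow n * ψ (ζ ⊗ ⟨ w , w ⟩)) - ♯ (+ 1)      ∎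
    where
    L Q origin : 𝔽₄^ n → C
    L v = ψ ⟨ v , w ⟩
    Q v = ψ (ζ ⊗ ⟨ v , v ⟩ ⊕ ⟨ v , w ⟩)
    origin v = if does (v ≟ᵛ 0⃗) then ♯ (+ 1) else 0#
    origin-elsewhere : ∀ v → v ≢ 0⃗ → origin v ≈ 0#
    origin-elsewhere v v≢0 = ≈-reflexive (cong (if_then ♯ (+ 1) else 0#) (dec-false (v ≟ᵛ 0⃗) v≢0))
    origin-0 : origin 0⃗ ≈ ♯ (+ 1)
    origin-0 = ≈-reflexive (cong (if_then ♯ (+ 1) else 0#) (dec-true (0⃗ {n} ≟ᵛ 0⃗) refl))
    subtract-0 : ∀ x → x ≈ x - 0#
    subtract-0 x = ≈-sym (≈-trans (+-congˡ (≈-trans (-‿cong (≈-sym H.0#-homo)) (≈-trans (solve 0 (:- con 0ₑ := con 0ₑ) ≈-refl) H.0#-homo))) (+-identityʳ x))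
    indicator : ∀ v → maybe (λ z → ψ ⟨ vec z , w ⟩) 0# (toΦ v) ≈ κ (rat ½) * (L v + Q v) - origin v
    indicator v with v ≟ᵛ 0⃗ | ⟨ v , v ⟩ ≟ 𝟘
    ... | no _ | yes vv≡0 = ≈-trans (begin
        L v
          ≈⟨ solve 1 (λ l → l := con (rat ½) :* (l :+ l)) ≈-refl (L v) ⟩
        κ (rat ½) * (L v + L v)
          ≈⟨ *-congˡ (+-congˡ (≈-reflexive (cong (λ a → ψ (ζ ⊗ a ⊕ ⟨ v , w ⟩)) (sym vv≡0)))) ⟩
        κ (rat ½) * (L v + Q v)                                ∎) (subtract-0 _)
    ... | no _ | no vv≢0 = ≈-trans (begin
        0#                                                     ≈⟨ H.0#-homo ⟨
        κ 0ₑ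
          ≈⟨ solve 1 (λ l → con 0ₑ := con (rat ½) :* (l :+ con (int (ℤ.- + 1)) :* l)) ≈-refl (L v) ⟩
        κ (rat ½) * (L v + ψ ζ * L v)                          ≈⟨ *-congˡ (+-congˡ (ψ-⊕ ζ ⟨ v , w ⟩)) ⟨
        κ (rat ½) * (L v + ψ (ζ ⊕ ⟨ v , w ⟩))
          ≈⟨ *-congˡ (+-congˡ (≈-reflexive (cong (λ a → ψ (ζ ⊗ a ⊕ ⟨ v , w ⟩)) (sym (nonzero-norm (norm-cases v) vv≢0))))) ⟩
        κ (rat ½) * (L v + Q v)                                ∎) (subtract-0 _)
      where
      nonzero-norm : ⟨ v , v ⟩ ≡ 𝟘 ⊎ ⟨ v , v ⟩ ≡ 𝟙 → ⟨ v , v ⟩ ≢ 𝟘 → ⟨ v , v ⟩ ≡ 𝟙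
      nonzero-norm (inj₁ vv≡0) vv≢0 = contradiction vv≡0 vv≢0
      nonzero-norm (inj₂ vv≡1) _    = vv≡1
    ... | yes refl | _ = begin
        0#                                                     ≈⟨ H.0#-homo ⟨
        κ 0ₑ
          ≈⟨ solve 0 (con 0ₑ := con (rat ½) :* (con 1ₑ :+ con 1ₑ) :- con 1ₑ) ≈-refl ⟩
        κ (rat ½) * (♯ (+ 1) + ♯ (+ 1)) - ♯ (+ 1)
          ≈⟨ +-congʳ (*-congˡ (+-cong (≈-reflexive (cong ψ (sym (⟨⟩-zeroˡ w))))
                                                                    (≈-reflexive (cong₂ (λ a b → ψ (ζ ⊗ a ⊕ b)) (sym (⟨⟩-zeroˡ (0⃗ {n}))) (sym (⟨⟩-zeroˡ w)))))) ⟩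
        κ (rat ½) * (L 0⃗ + Q 0⃗) - ♯ (+ 1)                      ∎

-- Spectral decomposition

-- The rows E₁, …, E₆: eigenvalue t of the scalar α, eigenvalues φc and φ′c of F on and off the row (c = (-2)ⁿ⁻³),
-- normalising factor ν/c = 1/(3(φ-φ′)c), and ρ = 1/(2(t² + t)).
t φ φ′ ν ρ : Fin 6 → ℚω
t  = lookup (ωₑ ∷ ω̄ₑ ∷ 1ₑ ∷ ωₑ ∷ ω̄ₑ ∷ 1ₑ ∷ [])
φ  = lookup (int (ℤ.- + 8) ∷ int (ℤ.- + 8) ∷ int (ℤ.- + 8) ∷ int (+ 4) ∷ int (+ 4) ∷ int (+ 4) ∷ [])
φ′ = lookup (int (+ 4) ∷ int (+ 4) ∷ int (+ 4) ∷ int (ℤ.- + 8) ∷ int (ℤ.- + 8) ∷ int (ℤ.- + 8) ∷ [])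
ν  = lookup (rat -1/36 ∷ rat -1/36 ∷ rat -1/36 ∷ rat 1/36 ∷ rat 1/36 ∷ rat 1/36 ∷ [])
  where
  1/36 -1/36 : ℚ
  1/36  = + 1 ℚ./ 36
  -1/36 = ℚ.- 1/36
ρ  = lookup (rat (ℚ.- ½) ∷ rat (ℚ.- ½) ∷ rat ¼ ∷ rat (ℚ.- ½) ∷ rat (ℚ.- ½) ∷ rat ¼ ∷ [])

-- Coordinates of Aⱼ in the basis I, T, T², F, TF, T²F, J.
adjacency-coordinates : Fin 7 → Fin 7 → ℚω
adjacency-coordinates j = lookup (lookup rows j)
  where
  o p q s : ℚω
  o = 0ₑ
  p = 1ₑ
  q = rat ¼
  s = rat (ℚ.- ¼)
  rows : Vec (Vec ℚω 7) 7
  rows = (p ∷ o ∷ o ∷ o ∷ o ∷ o ∷ o ∷ []) ∷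
         (o ∷ p ∷ o ∷ o ∷ o ∷ o ∷ o ∷ []) ∷
         (o ∷ o ∷ p ∷ o ∷ o ∷ o ∷ o ∷ []) ∷
         (o ∷ o ∷ o ∷ q ∷ s ∷ s ∷ q ∷ []) ∷
         (o ∷ o ∷ o ∷ s ∷ s ∷ q ∷ q ∷ []) ∷
         (o ∷ o ∷ o ∷ s ∷ q ∷ s ∷ q ∷ []) ∷
         (-ₑ p ∷ -ₑ p ∷ -ₑ p ∷ q ∷ q ∷ q ∷ q ∷ []) ∷ []

t-cube : ∀ k → t k *ₑ t k *ₑ t k ≡ 1ₑ
t-cube = from-yes (Fin.all? λ k → (t k *ₑ t k *ₑ t k) ≟ₑ 1ₑ)

φ-sum : ∀ k → φ k +ₑ φ′ k ≡ int (ℤ.- + 4)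
φ-sum = from-yes (Fin.all? λ k → (φ k +ₑ φ′ k) ≟ₑ int (ℤ.- + 4))

φ-product : ∀ k → φ k *ₑ φ′ k ≡ int (ℤ.- + 32)
φ-product = from-yes (Fin.all? λ k → (φ k *ₑ φ′ k) ≟ₑ int (ℤ.- + 32))

δₑ : ∀ {m} → Fin m → Fin m → ℚω
δₑ k l = if does (k Fin.≟ l) then 1ₑ else 0ₑ

-- Since t has cube 1, the middle factor sums the powers of t l / t k: it is 3 if they agree and 0
-- otherwise. The last factor vanishes when φ l is the other eigenvalue of F. All 36 cases are
-- evaluated.
row-orthogonality : ∀ k l → ν k *ₑ ((1ₑ +ₑ (t k *ₑ t k *ₑ t l +ₑ t k *ₑ (t l *ₑ t l))) *ₑ (φ l +ₑ -ₑ φ′ k)) ≡ δₑ k l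
row-orthogonality = from-yes (Fin.all? λ k → Fin.all? λ l →
  (ν k *ₑ ((1ₑ +ₑ (t k *ₑ t k *ₑ t l +ₑ t k *ₑ (t l *ₑ t l))) *ₑ (φ l +ₑ -ₑ φ′ k))) ≟ₑ δₑ k l)

ρ-inverse : ∀ k → ρ k *ₑ (int (+ 2) *ₑ (t k *ₑ t k +ₑ t k)) ≡ 1ₑ
ρ-inverse = from-yes (Fin.all? λ k → (ρ k *ₑ (int (+ 2) *ₑ (t k *ₑ t k +ₑ t k))) ≟ₑ 1ₑ)

ν-inverse : ∀ k → ν k *ₑ (int (+ 3) *ₑ (φ k +ₑ -ₑ φ′ k)) ≡ 1ₑ
ν-inverse = from-yes (Fin.all? λ k → (ν k *ₑ (int (+ 3) *ₑ (φ k +ₑ -ₑ φ′ k))) ≟ₑ 1ₑ)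

-- The length stays a variable tied to 4 + m by an equation, so Φ n and its list of elements do not
-- unfold; the equation enters through `pow-n`.
module Scheme
  (K : CommutativeRing 0ℓ 0ℓ) (κ : ℚω → CommutativeRing.Carrier K)
  (κ-homo : IsRingHomomorphism ℚω-rawRing (CommutativeRing.rawRing K) κ)
  {n m : ℕ} (n≡4+m : n ≡ 4 ℕ.+ m) {α : 𝔽₄} (α-cases : α ≡ ζ ⊎ α ≡ ζ²)
  where

  open CommutativeRing K hiding (zero) renaming (Carrier to C; refl to ≈-refl; sym to ≈-sym; trans to ≈-trans; reflexive to ≈-reflexive)
  open EisensteinSolver K κ κ-homo
  open Matrices K
  open Characters K κ κ-homo
  open SetoidReasoning setoid
  private module H = IsRingHomomorphism κ-homo

  elems : List (Φ n)
  elems = Φ-elements n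

  α≢0 : α ≢ 𝟘
  α≢0 α≡0 = cases α-cases α≡0
    where
    cases : α ≡ ζ ⊎ α ≡ ζ² → α ≢ 𝟘
    cases (inj₁ refl) ()
    cases (inj₂ refl) ()

  τ : Φ n → Φ n
  τ = scale α α≢0

  τ³ : ∀ x → τ (τ (τ x)) ≡ x
  τ³ x = vec-injective (τ (τ (τ x))) x (trans (cong (α •_) (sym (•-assoc α α (vec x))))
    (trans (sym (•-assoc α (α ⊗ α) (vec x))) (trans (cong (_• vec x) (cube α-cases)) (•-identity (vec x)))))
    where
    cube : α ≡ ζ ⊎ α ≡ ζ² → α ⊗ (α ⊗ α) ≡ 𝟙
    cube (inj₁ refl) = refl
    cube (inj₂ refl) = refl

  I F J : Matrix (Φ n)
  I x y = if does (vec y ≟ᵛ vec x) then 1# else 0#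
  F x y = ψ ⟨ vec x , vec y ⟩
  J _ _ = 1#

  -- Left multiplication by T replaces the row x by the row τ x, so products with powers of T are
  -- written as a change of the row index.
  basis : Fin 7 → Matrix (Φ n)
  basis 0F x y = I x y
  basis 1F x y = I (τ x) y
  basis 2F x y = I (τ (τ x)) y
  basis 3F x y = F x y
  basis 4F x y = F (τ x) y
  basis 5F x y = F (τ (τ x)) y
  basis 6F x y = J x y

  infixl 7 _⊠_
  infix  4 _≐_

  _⊠_ : Matrix (Φ n) → Matrix (Φ n) → Matrix (Φ n)
  _⊠_ = _⊡_ elems

  _≐_ : Matrix (Φ n) → Matrix (Φ n) → Set
  _≐_ = _≋_ elems

  I-diag : ∀ {x y} → vec y ≡ vec x → I x y ≈ 1#
  I-diag {x} {y} eq = ≈-reflexive (cong (if_then 1# else 0#) (dec-true (vec y ≟ᵛ vec x) eq))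

  I-off : ∀ {x y} → vec y ≢ vec x → I x y ≈ 0#
  I-off {x} {y} neq = ≈-reflexive (cong (if_then 1# else 0#) (dec-false (vec y ≟ᵛ vec x) neq))

  I-⊠ : ∀ M → I ⊠ M ≐ M
  I-⊠ M x y = ≈-trans (∑Φ-single (λ z → I x z * M z y) x λ z z≢x →
      ≈-trans (*-congʳ (I-off {x} {z} (z≢x ∘ vec-injective z x))) (zeroˡ _))
    (≈-trans (*-congʳ (I-diag {x} {x} refl)) (*-identityˡ _))

  ⊠-I : ∀ M → M ⊠ I ≐ M
  ⊠-I M x y = ≈-trans (∑Φ-single (λ z → M x z * I z y) y λ z z≢y →
      ≈-trans (*-congˡ (I-off {z} {y} λ y≡z → z≢y (vec-injective z y (sym y≡z)))) (zeroʳ _))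
    (≈-trans (*-congˡ (I-diag {y} {y} refl)) (*-identityʳ _))

  I-τ : ∀ x y → I (τ x) y ≡ I x (τ (τ y))
  I-τ x y = cong (if_then 1# else 0#) (does-⇔ (mk⇔
    (λ y≡αx → trans (cong (λ v → α • (α • v)) y≡αx) (cong vec (τ³ x)))
    (λ ααy≡x → trans (cong vec (sym (τ³ y))) (cong (α •_) ααy≡x))) (vec y ≟ᵛ (α • vec x)) ((α • (α • vec y)) ≟ᵛ vec x))

  -- The conjugate of α² is α, so the adjoint of the scalar α is its inverse α²; this says that T
  -- commutes with F.
  F-τ : ∀ x y → F (τ x) y ≡ F x (τ (τ y))
  F-τ x y = cong ψ (trans (⟨⟩-•ˡ α (vec x) (vec y)) (sym (trans (⟨⟩-•ʳ α (vec x) (α • vec y))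
    (trans (cong (α ↑ 2 ⊗_) (⟨⟩-•ʳ α (vec x) (vec y))) (fourth α ⟨ vec x , vec y ⟩)))))
    where
    fourth : ∀ a b → a ↑ 2 ⊗ (a ↑ 2 ⊗ b) ≡ a ⊗ b
    fourth = from-yes (∀? λ a → ∀? λ b → (a ↑ 2 ⊗ (a ↑ 2 ⊗ b)) ≟ (a ⊗ b))

  inverse-pow : ℕ → C
  inverse-pow zero    = κ 1ₑ
  inverse-pow (suc k) = κ (rat (ℚ.- ½)) * inverse-pow k

  pow-inverse : ∀ k → pow k * inverse-pow k ≈ κ 1ₑ
  pow-inverse zero    = solve 0 (con 1ₑ :* con 1ₑ := con 1ₑ) ≈-refl
  pow-inverse (suc k) = ≈-trans (solve 2 (λ p q → (con (int (ℤ.- + 2)) :* p) :* (con (rat (ℚ.- ½)) :* q) := p :* q) ≈-refl _ _)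
    (pow-inverse k)

  -- With a = (-2)ⁿ⁻¹ as in the character table, c = (-2)ⁿ⁻³ = a/4.
  c d h g f₀ N : C
  c  = pow (suc m)
  d  = inverse-pow (suc m)
  h  = ♯ (+ 32) * (c * c)
  g  = ♯ (ℤ.- + 4) * c
  f₀ = ♯ (ℤ.- + 4) * c - κ 1ₑ
  N  = ♯ (+ 32) * (c * c) + ♯ (ℤ.- + 4) * c - κ 1ₑ

  cd≈1 : c * d ≈ κ 1ₑ
  cd≈1 = pow-inverse (suc m)

  pow-n : pow n ≈ ♯ (ℤ.- + 8) * c
  pow-n = ≈-trans (≈-reflexive (cong pow n≡4+m))
    (solve 1 (λ c → con (int (ℤ.- + 2)) :* (con (int (ℤ.- + 2)) :* (con (int (ℤ.- + 2)) :* c)) := con (int (ℤ.- + 8)) :* c) ≈-refl c)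

  linear-sum-⊹ : ∀ x y → linear-sum (vec x ⊹ vec y) ≈ (pow n * pow n) * I x y
  linear-sum-⊹ x y with vec y ≟ᵛ vec x
  ... | yes y≡x = ≈-trans (≈-reflexive (cong linear-sum (trans (cong (vec x ⊹_) y≡x) (⊹-self (vec x)))))
                    (≈-trans (linear-sum-zero n) (≈-sym (*-identityʳ _)))
  ... | no y≢x  = ≈-trans (linear-sum-nonzero (vec x ⊹ vec y) λ x+y≡0 → y≢x (sym (⊹≡0⇒≡ (vec x) (vec y) x+y≡0)))
                    (≈-sym (zeroʳ _))

  -- For isotropic x and y the norm of x + y is the trace of ⟨x,y⟩, so the phase of the quadratic
  -- sum at x + y is F x y again. This is what closes the algebra.
  F-⊠-F : ∀ x y → (F ⊠ F) x y ≈ (h * I x y + g * F x y) - κ 1ₑ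
  F-⊠-F x y = begin
    ∑ elems (λ z → ψ ⟨ vec x , vec z ⟩ * ψ ⟨ vec z , vec y ⟩)       ≈⟨ ∑-cong elems combine ⟩
    ∑ elems (λ z → ψ ⟨ vec z , w ⟩)                                ≈⟨ ∑Φ-ψ w ⟩
    κ (rat ½) * (linear-sum w + pow n * ψ (ζ ⊗ ⟨ w , w ⟩)) - ♯ (+ 1)
      ≈⟨ +-congʳ (*-congˡ (+-cong (linear-sum-⊹ x y) (*-congˡ (≈-reflexive (cong κ phase))))) ⟩
    κ (rat ½) * ((pow n * pow n) * I x y + pow n * F x y) - ♯ (+ 1)
      ≈⟨ +-congʳ (*-congˡ (+-cong (*-congʳ (*-cong pow-n pow-n)) (*-congʳ pow-n))) ⟩
    κ (rat ½) * (((♯ (ℤ.- + 8) * c) * (♯ (ℤ.- + 8) * c)) * I x y + (♯ (ℤ.- + 8) * c) * F x y) - ♯ (+ 1)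
      ≈⟨ solve 3 (λ c i f → let p = con (int (ℤ.- + 8)) :* c in
           con (rat ½) :* ((p :* p) :* i :+ p :* f) :- con 1ₑ
             := ((con (int (+ 32)) :* (c :* c)) :* i :+ (con (int (ℤ.- + 4)) :* c) :* f) :- con 1ₑ) ≈-refl c (I x y) (F x y) ⟩
    (h * I x y + g * F x y) - κ 1ₑ                                 ∎
    where
    w : 𝔽₄^ n
    w = vec x ⊹ vec y
    combine : ∀ z → ψ ⟨ vec x , vec z ⟩ * ψ ⟨ vec z , vec y ⟩ ≈ ψ ⟨ vec z , w ⟩
    combine z = ≈-trans (*-congʳ (≈-reflexive (ψ-swap (vec x) (vec z))))
      (≈-trans (≈-sym (ψ-⊕ ⟨ vec z , vec x ⟩ ⟨ vec z , vec y ⟩)) (≈-reflexive (cong ψ (sym (⟨⟩-⊹ʳ (vec z) (vec x) (vec y))))))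
    trace : ∀ b → sign (ζ ⊗ ((𝟘 ⊕ 𝟘) ⊕ (b ⊕ b ↑ 2))) ≡ sign b
    trace = from-yes (∀? λ b → sign (ζ ⊗ ((𝟘 ⊕ 𝟘) ⊕ (b ⊕ b ↑ 2))) ≟ₑ sign b)
    phase : sign (ζ ⊗ ⟨ w , w ⟩) ≡ sign ⟨ vec x , vec y ⟩
    phase = trans (cong (λ a → sign (ζ ⊗ a)) (norm-⊹ (vec x) (vec y)))
      (trans (cong₂ (λ a b → sign (ζ ⊗ ((a ⊕ b) ⊕ (⟨ vec x , vec y ⟩ ⊕ ⟨ vec x , vec y ⟩ ↑ 2)))) (isotropicᶲ x) (isotropicᶲ y))
             (trace ⟨ vec x , vec y ⟩))

  ∑-F : ∀ y → ∑ elems (λ z → F z y) ≈ f₀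
  ∑-F y = begin
    ∑ elems (λ z → ψ ⟨ vec z , vec y ⟩)                             ≈⟨ ∑Φ-ψ (vec y) ⟩
    κ (rat ½) * (linear-sum (vec y) + pow n * ψ (ζ ⊗ ⟨ vec y , vec y ⟩)) - ♯ (+ 1)
      ≈⟨ +-congʳ (*-congˡ (+-cong (≈-trans (linear-sum-nonzero (vec y) (nonzeroᶲ y)) (≈-sym H.0#-homo))
           (*-cong pow-n (≈-reflexive (cong (λ a → ψ (ζ ⊗ a)) (isotropicᶲ y)))))) ⟩
    κ (rat ½) * (κ 0ₑ + (♯ (ℤ.- + 8) * c) * κ 1ₑ) - ♯ (+ 1)
      ≈⟨ solve 1 (λ c → con (rat ½) :* (con 0ₑ :+ (con (int (ℤ.- + 8)) :* c) :* con 1ₑ) :- con 1ₑ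
                    := con (int (ℤ.- + 4)) :* c :- con 1ₑ) ≈-refl c ⟩
    f₀                                                              ∎

  ∑-1 : ∑ elems (λ _ → 1#) ≈ N
  ∑-1 = begin
    ∑ elems (λ _ → 1#)
      ≈⟨ ∑-cong elems (λ z → ≈-trans (≈-sym H.1#-homo) (≈-reflexive (cong ψ (sym (⟨⟩-zeroʳ (vec z)))))) ⟩
    ∑ elems (λ z → ψ ⟨ vec z , 0⃗ ⟩)                                 ≈⟨ ∑Φ-ψ (0⃗ {n}) ⟩
    κ (rat ½) * (linear-sum (0⃗ {n}) + pow n * ψ (ζ ⊗ ⟨ 0⃗ {n} , 0⃗ ⟩)) - ♯ (+ 1)
      ≈⟨ +-congʳ (*-congˡ (+-cong (≈-trans (linear-sum-zero n) (*-cong pow-n pow-n))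
           (*-cong pow-n (≈-reflexive (cong (λ a → ψ (ζ ⊗ a)) (⟨⟩-zeroˡ (0⃗ {n}))))))) ⟩
    κ (rat ½) * ((♯ (ℤ.- + 8) * c) * (♯ (ℤ.- + 8) * c) + (♯ (ℤ.- + 8) * c) * κ 1ₑ) - ♯ (+ 1)
      ≈⟨ solve 1 (λ c → let p = con (int (ℤ.- + 8)) :* c in
           con (rat ½) :* (p :* p :+ p :* con 1ₑ) :- con 1ₑ
             := con (int (+ 32)) :* (c :* c) :+ con (int (ℤ.- + 4)) :* c :- con 1ₑ) ≈-refl c ⟩
    N                                                               ∎

  -- Every column of M is a common eigenvector of T, F and J, so any combination of the basis acts
  -- on M from the left as a scalar.
  record Eigen (M : Matrix (Φ n)) (s f j : C) : Set where
    field
      τ-eigen : ∀ x y → M (τ x) y ≈ s * M x y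
      F-eigen : ∀ x y → (F ⊠ M) x y ≈ f * M x y
      J-eigen : ∀ x y → (J ⊠ M) x y ≈ j * M x y

  sum₇ : (Fin 7 → C) → C
  sum₇ u = u 0F + (u 1F + (u 2F + (u 3F + (u 4F + (u 5F + u 6F)))))

  ∑-sum₇ : ∀ u → ∑ (allFin 7) u ≈ sum₇ u
  ∑-sum₇ u = +-congˡ (+-congˡ (+-congˡ (+-congˡ (+-congˡ (+-congˡ (+-identityʳ (u 6F)))))))

  -- The combination of basis matrices with coefficients u, after T, F and J are replaced by s, f
  -- and j.
  eigenvalue : (s f j : C) → (Fin 7 → C) → C
  eigenvalue s f j u = (u 0F + (u 1F * s + u 2F * (s * s))) + ((u 3F + (u 4F * s + u 5F * (s * s))) * f + u 6F * j)

  linComb-eigen : ∀ u {M s f j} → Eigen M s f j → linComb elems u basis ⊠ M ≐ λ x y → eigenvalue s f j u * M x y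
  linComb-eigen u {M} {s} {f} {j} eigen x y = begin
    (linComb elems u basis ⊠ M) x y                  ≈⟨ linComb-⊡ elems u basis M x y ⟩
    ∑ (allFin 7) (λ k → u k * (basis k ⊠ M) x y)
      ≈⟨ ∑-cong (allFin 7) {λ k → u k * (basis k ⊠ M) x y} {λ k → u k * (value k * M x y)} (λ k → *-congˡ (act k)) ⟩
    ∑ (allFin 7) (λ k → u k * (value k * M x y))     ≈⟨ ∑-sum₇ (λ k → u k * (value k * M x y)) ⟩
    sum₇ (λ k → u k * (value k * M x y))
      ≈⟨ +-congʳ (*-congˡ (*-congʳ (≈-sym H.1#-homo))) ⟩
    u 0F * (κ 1ₑ * M x y) + (u 1F * (s * M x y) + (u 2F * ((s * s) * M x y) + (u 3F * (f * M x y) +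
      (u 4F * ((s * f) * M x y) + (u 5F * ((s * s * f) * M x y) + u 6F * (j * M x y))))))
      ≈⟨ solve 11 (λ u₀ u₁ u₂ u₃ u₄ u₅ u₆ s f j v →
           u₀ :* (con 1ₑ :* v) :+ (u₁ :* (s :* v) :+ (u₂ :* ((s :* s) :* v) :+ (u₃ :* (f :* v) :+
             (u₄ :* ((s :* f) :* v) :+ (u₅ :* ((s :* s :* f) :* v) :+ u₆ :* (j :* v))))))
           := ((u₀ :+ (u₁ :* s :+ u₂ :* (s :* s))) :+ ((u₃ :+ (u₄ :* s :+ u₅ :* (s :* s))) :* f :+ u₆ :* j)) :* v)
           ≈-refl (u 0F) (u 1F) (u 2F) (u 3F) (u 4F) (u 5F) (u 6F) s f j (M x y) ⟩
    eigenvalue s f j u * M x y                       ∎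
    where
    open Eigen eigen
    value : Fin 7 → C
    value = lookup (1# ∷ s ∷ s * s ∷ f ∷ s * f ∷ s * s * f ∷ j ∷ [])
    twice : ∀ x → M (τ (τ x)) y ≈ s * s * M x y
    twice x = ≈-trans (τ-eigen (τ x) y) (≈-trans (*-congˡ (τ-eigen x y)) (≈-sym (*-assoc s s (M x y))))
    pull : ∀ p q → (F ⊠ M) p y ≈ f * (q * M x y) → (F ⊠ M) p y ≈ (q * f) * M x y
    pull p q eq = ≈-trans eq (≈-trans (≈-sym (*-assoc f q _)) (*-congʳ (*-comm f q)))
    act : ∀ k → (basis k ⊠ M) x y ≈ value k * M x y
    act 0F = ≈-trans (I-⊠ M x y) (≈-sym (*-identityˡ _))
    act 1F = ≈-trans (I-⊠ M (τ x) y) (τ-eigen x y)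
    act 2F = ≈-trans (I-⊠ M (τ (τ x)) y) (twice x)
    act 3F = F-eigen x y
    act 4F = pull (τ x) s (≈-trans (F-eigen (τ x) y) (*-congˡ (τ-eigen x y)))
    act 5F = pull (τ (τ x)) (s * s) (≈-trans (F-eigen (τ (τ x)) y) (*-congˡ (twice x)))
    act 6F = J-eigen x y

  I-τ² : ∀ x y → I (τ (τ x)) y ≡ I x (τ y)
  I-τ² x y = trans (I-τ (τ x) y) (trans (I-τ x (τ (τ y))) (cong (I x) (cong τ (τ³ y))))

  F-τ² : ∀ x y → F (τ (τ x)) y ≡ F x (τ y)
  F-τ² x y = trans (F-τ (τ x) y) (trans (F-τ x (τ (τ y))) (cong (F x) (cong τ (τ³ y))))

  -- The product of M with a basis matrix, the scalar having been moved from the summation index to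
  -- the column index; only products with I, F and J remain to be evaluated.
  ⊠-basis : ∀ M → Fin 7 → Matrix (Φ n)
  ⊠-basis M 0F x y = (M ⊠ I) x y
  ⊠-basis M 1F x y = (M ⊠ I) x (τ (τ y))
  ⊠-basis M 2F x y = (M ⊠ I) x (τ y)
  ⊠-basis M 3F x y = (M ⊠ F) x y
  ⊠-basis M 4F x y = (M ⊠ F) x (τ (τ y))
  ⊠-basis M 5F x y = (M ⊠ F) x (τ y)
  ⊠-basis M 6F x y = (M ⊠ J) x y

  ⊠-basis-≈ : ∀ M k → M ⊠ basis k ≐ ⊠-basis M k
  ⊠-basis-≈ M 0F x y = ≈-refl
  ⊠-basis-≈ M 1F x y = ∑-cong elems λ z → *-congˡ (≈-reflexive (I-τ z y))
  ⊠-basis-≈ M 2F x y = ∑-cong elems λ z → *-congˡ (≈-reflexive (I-τ² z y))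
  ⊠-basis-≈ M 3F x y = ≈-refl
  ⊠-basis-≈ M 4F x y = ∑-cong elems λ z → *-congˡ (≈-reflexive (F-τ z y))
  ⊠-basis-≈ M 5F x y = ∑-cong elems λ z → *-congˡ (≈-reflexive (F-τ² z y))
  ⊠-basis-≈ M 6F x y = ≈-refl

  ⊠-linComb-basis : ∀ M u x y → (M ⊠ linComb elems u basis) x y ≈ sum₇ (λ k → u k * ⊠-basis M k x y)
  ⊠-linComb-basis M u x y = ≈-trans (⊡-linComb elems u basis M x y)
    (≈-trans (∑-cong (allFin 7) {λ k → u k * (M ⊠ basis k) x y} {λ k → u k * ⊠-basis M k x y} (λ k → *-congˡ (⊠-basis-≈ M k x y)))
             (∑-sum₇ (λ k → u k * ⊠-basis M k x y)))

  F-⊠-J : ∀ x y → (F ⊠ J) x y ≈ f₀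
  F-⊠-J x y = ≈-trans (∑-cong elems λ z → ≈-trans (*-identityʳ (F x z)) (≈-reflexive (ψ-swap (vec x) (vec z)))) (∑-F x)

  J-⊠-F : ∀ x y → (J ⊠ F) x y ≈ f₀
  J-⊠-F x y = ≈-trans (∑-cong elems λ z → *-identityˡ (F z y)) (∑-F y)

  J-⊠-J : ∀ x y → (J ⊠ J) x y ≈ N
  J-⊠-J x y = ≈-trans (∑-cong elems λ z → *-identityˡ 1#) ∑-1

  +-cong₇ : ∀ {a₀ a₁ a₂ a₃ a₄ a₅ a₆ b₀ b₁ b₂ b₃ b₄ b₅ b₆} →
    a₀ ≈ b₀ → a₁ ≈ b₁ → a₂ ≈ b₂ → a₃ ≈ b₃ → a₄ ≈ b₄ → a₅ ≈ b₅ → a₆ ≈ b₆ →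
    a₀ + (a₁ + (a₂ + (a₃ + (a₄ + (a₅ + a₆))))) ≈ b₀ + (b₁ + (b₂ + (b₃ + (b₄ + (b₅ + b₆)))))
  +-cong₇ p₀ p₁ p₂ p₃ p₄ p₅ p₆ = +-cong p₀ (+-cong p₁ (+-cong p₂ (+-cong p₃ (+-cong p₄ (+-cong p₅ p₆)))))

  Eigen-scale : ∀ μ {M s f j} → Eigen M s f j → Eigen (λ x y → μ * M x y) s f j
  Eigen-scale μ {M} {s} {f} {j} eigen = record
    { τ-eigen = λ x y → swap s x y (τ-eigen x y)
    ; F-eigen = λ x y → ≈-trans (pull F x y) (swap f x y (F-eigen x y))
    ; J-eigen = λ x y → ≈-trans (pull J x y) (swap j x y (J-eigen x y))
    }
    where
    open Eigen eigen
    exchange : ∀ a b v → a * (b * v) ≈ b * (a * v)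
    exchange = solve 3 (λ a b v → a :* (b :* v) := b :* (a :* v)) ≈-refl
    swap : ∀ e {v} x y → v ≈ e * M x y → μ * v ≈ e * (μ * M x y)
    swap e x y eq = ≈-trans (*-congˡ eq) (exchange μ e (M x y))
    pull : ∀ P x y → (P ⊠ (λ x y → μ * M x y)) x y ≈ μ * (P ⊠ M) x y
    pull P x y = ≈-trans (∑-cong elems λ z → exchange (P x z) μ (M z y)) (∑-*ˡ elems μ _)

  A : Fin 7 → Matrix (Φ n)
  A l x y = if does (ℛ? α l x y) then 1# else 0#

  A-value : ∀ k l x y → ℛ {n} α l x y → A k x y ≈ κ (δₑ k l)
  A-value k l x y r with k Fin.≟ l
  ... | yes refl = ≈-trans (≈-reflexive (cong (if_then 1# else 0#) (dec-true (ℛ? α k x y) r))) (≈-sym H.1#-homo)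
  ... | no k≢l   = ≈-trans (≈-reflexive (cong (if_then 1# else 0#) (dec-false (ℛ? α k x y) λ r′ →
                     k≢l (ℛ-unique α-cases k l x y r′ r)))) (≈-sym H.0#-homo)

  pairing : Fin 7 → 𝔽₄
  pairing = lookup (𝟘 ∷ 𝟘 ∷ 𝟘 ∷ α ↑ 3 ∷ α ↑ 4 ∷ α ↑ 5 ∷ 𝟘 ∷ [])

  ℛ-pairing : ∀ l x y → ℛ {n} α l x y → ⟨ vec x , vec y ⟩ ≡ pairing l
  ℛ-pairing 0F x y r = Rel-pairing (α ↑ 0) x y r
  ℛ-pairing 1F x y r = Rel-pairing (α ↑ 1) x y r
  ℛ-pairing 2F x y r = Rel-pairing (α ↑ 2) x y r
  ℛ-pairing 3F x y r = r
  ℛ-pairing 4F x y r = r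
  ℛ-pairing 5F x y r = r
  ℛ-pairing 6F x y r = proj₁ r

  -- Each basis matrix is constant on each relation. Its values, collected in the decidable ℚω, turn
  -- linear identities between matrices into identities between 7 × 7 arrays.
  entry : Fin 7 → Fin 7 → ℚω
  entry 0F l = δₑ {7} 0F l
  entry 1F l = δₑ {7} 1F l
  entry 2F l = δₑ {7} 2F l
  entry 3F l = sign (pairing l)
  entry 4F l = sign (α ⊗ pairing l)
  entry 5F l = sign (α ⊗ (α ⊗ pairing l))
  entry 6F l = 1ₑ

  basis-value : ∀ k l x y → ℛ {n} α l x y → basis k x y ≈ κ (entry k l)
  basis-value 0F l x y r = ≈-trans (≈-reflexive (cong (λ v → if does (vec y ≟ᵛ v) then 1# else 0#) (sym (•-identity (vec x)))))
                                   (A-value 0F l x y r)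
  basis-value 1F l x y r = ≈-trans (≈-reflexive (cong (λ c → if does (vec y ≟ᵛ (c • vec x)) then 1# else 0#) (⊗-comm 𝟙 α)))
                                   (A-value 1F l x y r)
  basis-value 2F l x y r = ≈-trans (≈-reflexive (cong (λ v → if does (vec y ≟ᵛ v) then 1# else 0#)
                                     (trans (sym (•-assoc α α (vec x))) (cong (λ c → (α ⊗ c) • vec x) (⊗-comm 𝟙 α)))))
                                   (A-value 2F l x y r)
  basis-value 3F l x y r = ≈-reflexive (cong ψ (ℛ-pairing l x y r))
  basis-value 4F l x y r = ≈-reflexive (cong ψ (trans (⟨⟩-•ˡ α (vec x) (vec y)) (cong (α ⊗_) (ℛ-pairing l x y r))))
  basis-value 5F l x y r = ≈-reflexive (cong ψ (trans (⟨⟩-•ˡ α (α • vec x) (vec y))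
                             (cong (α ⊗_) (trans (⟨⟩-•ˡ α (vec x) (vec y)) (cong (α ⊗_) (ℛ-pairing l x y r))))))
  basis-value 6F l x y r = ≈-sym H.1#-homo

  linComb-value : ∀ u l x y → ℛ {n} α l x y → linComb elems u basis x y ≈ ∑ (allFin 7) (λ k → u k * κ (entry k l))
  linComb-value u l x y r = ∑-cong (allFin 7) {λ k → u k * basis k x y} {λ k → u k * κ (entry k l)}
    (λ k → *-congˡ (basis-value k l x y r))

  ∑ₑ : (Fin 7 → ℚω) → ℚω
  ∑ₑ f = List.foldr (λ k s → f k +ₑ s) 0ₑ (allFin 7)

  κ-∑ : ∀ f → κ (∑ₑ f) ≈ ∑ (allFin 7) (κ ∘ f)
  κ-∑ f = go (allFin 7)
    where
    go : ∀ ks → κ (List.foldr (λ k s → f k +ₑ s) 0ₑ ks) ≈ ∑ ks (κ ∘ f)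
    go []       = H.0#-homo
    go (k ∷ ks) = ≈-trans (H.+-homo (f k) _) (+-congˡ (go ks))

  -- The array `adjacency-coordinates` is inverse to `entry`, by evaluation for both choices of α.
  A-coordinates : ∀ j → A j ≐ linComb elems (κ ∘ adjacency-coordinates j) basis
  A-coordinates j x y with ℛ-total α-cases x y
  ... | l , r = begin
    A j x y                                                              ≈⟨ A-value j l x y r ⟩
    κ (δₑ j l)
      ≈⟨ ≈-reflexive (cong κ (sym (closed α-cases j l))) ⟩
    κ (∑ₑ (λ k → adjacency-coordinates j k *ₑ entry k l))
      ≈⟨ κ-∑ (λ k → adjacency-coordinates j k *ₑ entry k l) ⟩
    ∑ (allFin 7) (λ k → κ (adjacency-coordinates j k *ₑ entry k l))
      ≈⟨ ∑-cong (allFin 7) (λ k → H.*-homo (adjacency-coordinates j k) (entry k l)) ⟩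
    ∑ (allFin 7) (λ k → κ (adjacency-coordinates j k) * κ (entry k l))
      ≈⟨ linComb-value (κ ∘ adjacency-coordinates j) l x y r ⟨
    linComb elems (κ ∘ adjacency-coordinates j) basis x y                ∎
    where
    closed : α ≡ ζ ⊎ α ≡ ζ² → ∀ j l → ∑ₑ (λ k → adjacency-coordinates j k *ₑ entry k l) ≡ δₑ j l
    closed (inj₁ refl) = from-yes (Fin.all? λ j → Fin.all? λ l → ∑ₑ (λ k → adjacency-coordinates j k *ₑ entry k l) ≟ₑ δₑ j l)
    closed (inj₂ refl) = from-yes (Fin.all? λ j → Fin.all? λ l → ∑ₑ (λ k → adjacency-coordinates j k *ₑ entry k l) ≟ₑ δₑ j l)

  constant⇒linComb-A : ∀ M (v : Fin 7 → C) → (∀ l x y → ℛ {n} α l x y → M x y ≈ v l) → M ≐ linComb elems v A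
  constant⇒linComb-A M v constant x y with ℛ-total α-cases x y
  ... | l , r = ≈-trans (constant l x y r) (≈-sym (begin
    ∑ (allFin 7) (λ k → v k * A k x y)
      ≈⟨ ∑-allFin (λ k → v k * A k x y) l (λ k k≢l → ≈-trans (*-congˡ (≈-trans (A-value k l x y r) (off k k≢l))) (zeroʳ (v k))) ⟩
    v l * A l x y                          ≈⟨ *-congˡ (≈-trans (A-value l l x y r) diag) ⟩
    v l * 1#                               ≈⟨ *-identityʳ (v l) ⟩
    v l                                    ∎))
    where
    off : ∀ k → k ≢ l → κ (δₑ k l) ≈ 0#
    off k k≢l = ≈-trans (≈-reflexive (cong (λ b → κ (if b then 1ₑ else 0ₑ)) (dec-false (k Fin.≟ l) k≢l))) H.0#-homo
    diag : κ (δₑ l l) ≈ 1#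
    diag = ≈-trans (≈-reflexive (cong (λ b → κ (if b then 1ₑ else 0ₑ)) (dec-true (l Fin.≟ l) refl))) H.1#-homo

  -- An arbitrary ring need not contain the inverse of |Φ|, so it is supplied together with its
  -- defining equation.
  module Normalised (N⁻¹ : C) (N⁻¹-inverse : N⁻¹ * ∑ elems (λ _ → 1#) ≈ 1#) where

    NN⁻¹≈1 : N * N⁻¹ ≈ κ 1ₑ
    NN⁻¹≈1 = ≈-trans (*-comm N N⁻¹) (≈-trans (*-congˡ (≈-sym ∑-1)) (≈-trans N⁻¹-inverse (≈-sym H.1#-homo)))

    σ : C → C
    σ s = κ 1ₑ + (s * s + s)

    -- Coordinates of (I + s²T + sT²)(F - f′) with a multiple of J subtracted. The product has value
    -- σ(s)(f₀ - f′) on the all-one vector, where J has value N; the last coordinate makes the total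
    -- vanish there.
    row-coordinates : (s f′ : C) → Fin 7 → C
    row-coordinates s f′ = lookup
      (- f′ ∷ - f′ * (s * s) ∷ - f′ * s ∷ κ 1ₑ ∷ s * s ∷ s ∷ - (σ s * ((f₀ - f′) * N⁻¹)) ∷ [])

    row : (s f′ : C) → Matrix (Φ n)
    row s f′ = linComb elems (row-coordinates s f′) basis

    -- The hypotheses make f and f′ the roots of X² - gX - h, the polynomial that F satisfies up to
    -- J.
    row-eigen : ∀ s f f′ → s * s * s ≈ κ 1ₑ → f + f′ ≈ g → - (f * f′) ≈ h → Eigen (row s f′) s f (κ 0ₑ)
    row-eigen s f f′ s³≈1 f+f′≈g -ff′≈h = record { τ-eigen = τ-eigen ; F-eigen = F-eigen ; J-eigen = J-eigen }
      where
      q : C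
      q = (f₀ - f′) * N⁻¹

      τ-eigen : ∀ x y → row s f′ (τ x) y ≈ s * row s f′ x y
      τ-eigen x y = begin
        row s f′ (τ x) y
          ≈⟨ ∑-sum₇ (λ k → row-coordinates s f′ k * basis k (τ x) y) ⟩
        sum₇ (λ k → row-coordinates s f′ k * basis k (τ x) y)
          ≈⟨ +-cong₇ ≈-refl ≈-refl (*-congˡ (≈-reflexive (cong (λ x → I x y) (τ³ x))))
                     ≈-refl ≈-refl (*-congˡ (≈-reflexive (cong (λ x → F x y) (τ³ x)))) ≈-refl ⟩
        - f′ * I (τ x) y + (- f′ * (s * s) * I (τ (τ x)) y + (- f′ * s * I x y + (κ 1ₑ * F (τ x) y
          + (s * s * F (τ (τ x)) y + (s * F x y + - ((κ 1ₑ + (s * s + s)) * q) * 1#)))))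
          -- The shift by τ permutes the matrices cyclically, which agrees with multiplication by s
          -- up to a multiple of s³ - 1.
          ≈⟨ solve 10 (λ s f′ q b₀ b₁ b₂ b₃ b₄ b₅ o →
               :- f′ :* b₁ :+ (:- f′ :* (s :* s) :* b₂ :+ (:- f′ :* s :* b₀ :+ (con 1ₑ :* b₄
                 :+ (s :* s :* b₅ :+ (s :* b₃ :+ :- ((con 1ₑ :+ (s :* s :+ s)) :* q) :* o)))))
               := s :* (:- f′ :* b₀ :+ (:- f′ :* (s :* s) :* b₁ :+ (:- f′ :* s :* b₂ :+ (con 1ₑ :* b₃
                 :+ (s :* s :* b₄ :+ (s :* b₅ :+ :- ((con 1ₑ :+ (s :* s :+ s)) :* q) :* o))))))
                 :+ (s :* s :* s :- con 1ₑ) :* (f′ :* b₁ :- b₄ :+ q :* o))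
               ≈-refl s f′ q (I x y) (I (τ x) y) (I (τ (τ x)) y) (F x y) (F (τ x) y) (F (τ (τ x)) y) 1# ⟩
        s * sum₇ (λ k → row-coordinates s f′ k * basis k x y) + (s * s * s - κ 1ₑ) * (f′ * I (τ x) y - F (τ x) y + q * 1#)
          ≈⟨ +-cong (*-congˡ (≈-sym (∑-sum₇ (λ k → row-coordinates s f′ k * basis k x y)))) (*-congʳ (+-congʳ s³≈1)) ⟩
        s * row s f′ x y + (κ 1ₑ - κ 1ₑ) * (f′ * I (τ x) y - F (τ x) y + q * 1#)
          ≈⟨ solve 2 (λ e v → e :+ (con 1ₑ :- con 1ₑ) :* v := e) ≈-refl (s * row s f′ x y) _ ⟩
        s * row s f′ x y                                               ∎

      -- (f₀ - f)(f₀ - f′) = -N, i.e. the J-component of F² - gF - h evaluated at the row sum f₀.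
      key : κ 1ₑ + (f₀ - f) * q ≈ κ 0ₑ
      key = begin
        κ 1ₑ + (f₀ - f) * ((f₀ - f′) * N⁻¹)
          ≈⟨ solve 4 (λ f₀ f f′ v → con 1ₑ :+ (f₀ :- f) :* ((f₀ :- f′) :* v)
                                 := con 1ₑ :+ (f₀ :* f₀ :- (f :+ f′) :* f₀ :- :- (f :* f′)) :* v) ≈-refl f₀ f f′ N⁻¹ ⟩
        κ 1ₑ + (f₀ * f₀ - (f + f′) * f₀ - - (f * f′)) * N⁻¹
          ≈⟨ +-congˡ (*-congʳ (+-cong (+-congˡ (-‿cong (*-congʳ f+f′≈g))) (-‿cong -ff′≈h))) ⟩
        κ 1ₑ + (f₀ * f₀ - g * f₀ - h) * N⁻¹
          ≈⟨ solve 2 (λ c v → let g = con (int (ℤ.- + 4)) :* c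
                                  h = con (int (+ 32)) :* (c :* c)
                                  f₀ = g :- con 1ₑ in
               con 1ₑ :+ (f₀ :* f₀ :- g :* f₀ :- h) :* v := con 1ₑ :- (h :+ g :- con 1ₑ) :* v) ≈-refl c N⁻¹ ⟩
        κ 1ₑ - N * N⁻¹      ≈⟨ +-congˡ (-‿cong NN⁻¹≈1) ⟩
        κ 1ₑ - κ 1ₑ         ≈⟨ solve 0 (con 1ₑ :- con 1ₑ := con 0ₑ) ≈-refl ⟩
        κ 0ₑ                ∎

      FF : ∀ x y → (F ⊠ F) x y ≈ (- (f * f′) * I x y + (f + f′) * F x y) - κ 1ₑ
      FF x y = ≈-trans (F-⊠-F x y) (+-congʳ (+-cong (*-congʳ (≈-sym -ff′≈h)) (*-congʳ (≈-sym f+f′≈g))))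

      FF-at : ∀ x y b₀ b₃ → I x y ≡ b₀ → F x y ≡ b₃ → (F ⊠ F) x y ≈ (- (f * f′) * b₀ + (f + f′) * b₃) - κ 1ₑ
      FF-at x y _ _ refl refl = FF x y

      F-eigen : ∀ x y → (F ⊠ row s f′) x y ≈ f * row s f′ x y
      F-eigen x y = begin
        (F ⊠ row s f′) x y                                             ≈⟨ ⊠-linComb-basis F (row-coordinates s f′) x y ⟩
        sum₇ (λ k → row-coordinates s f′ k * ⊠-basis F k x y)
          ≈⟨ +-cong₇
               (*-congˡ (⊠-I F x y))
               (*-congˡ (≈-trans (⊠-I F x (τ (τ y))) (≈-reflexive (sym (F-τ x y)))))
               (*-congˡ (≈-trans (⊠-I F x (τ y)) (≈-reflexive (sym (F-τ² x y)))))
               (*-congˡ (FF x y))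
               (*-congˡ (FF-at x (τ (τ y)) _ _ (sym (I-τ x y)) (sym (F-τ x y))))
               (*-congˡ (FF-at x (τ y) _ _ (sym (I-τ² x y)) (sym (F-τ² x y))))
               (*-congˡ (F-⊠-J x y)) ⟩
        - f′ * F x y + (- f′ * (s * s) * F (τ x) y + (- f′ * s * F (τ (τ x)) y
          + (κ 1ₑ * ((- (f * f′) * I x y + (f + f′) * F x y) - κ 1ₑ)
          + (s * s * ((- (f * f′) * I (τ x) y + (f + f′) * F (τ x) y) - κ 1ₑ)
          + (s * ((- (f * f′) * I (τ (τ x)) y + (f + f′) * F (τ (τ x)) y) - κ 1ₑ)
          + - ((κ 1ₑ + (s * s + s)) * q) * f₀)))))
          -- The terms in I and F match by the quadratic relation; the constant terms leave σ(s)(1 +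
          -- (f₀ - f)q), which `key` makes zero.
          ≈⟨ solve 11 (λ s f f′ q f₀ b₀ b₁ b₂ b₃ b₄ b₅ →
               :- f′ :* b₃ :+ (:- f′ :* (s :* s) :* b₄ :+ (:- f′ :* s :* b₅
                 :+ (con 1ₑ :* ((:- (f :* f′) :* b₀ :+ (f :+ f′) :* b₃) :- con 1ₑ)
                 :+ (s :* s :* ((:- (f :* f′) :* b₁ :+ (f :+ f′) :* b₄) :- con 1ₑ)
                 :+ (s :* ((:- (f :* f′) :* b₂ :+ (f :+ f′) :* b₅) :- con 1ₑ)
                 :+ :- ((con 1ₑ :+ (s :* s :+ s)) :* q) :* f₀)))))
               := f :* (:- f′ :* b₀ :+ (:- f′ :* (s :* s) :* b₁ :+ (:- f′ :* s :* b₂ :+ (con 1ₑ :* b₃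
                 :+ (s :* s :* b₄ :+ (s :* b₅ :+ :- ((con 1ₑ :+ (s :* s :+ s)) :* q) :* con 1ₑ))))))
                 :- (con 1ₑ :+ (s :* s :+ s)) :* (con 1ₑ :+ (f₀ :- f) :* q))
               ≈-refl s f f′ q f₀ (I x y) (I (τ x) y) (I (τ (τ x)) y) (F x y) (F (τ x) y) (F (τ (τ x)) y) ⟩
        f * (- f′ * I x y + (- f′ * (s * s) * I (τ x) y + (- f′ * s * I (τ (τ x)) y + (κ 1ₑ * F x y
          + (s * s * F (τ x) y + (s * F (τ (τ x)) y + - ((κ 1ₑ + (s * s + s)) * q) * κ 1ₑ))))))
          - σ s * (κ 1ₑ + (f₀ - f) * q)
          ≈⟨ +-cong (*-congˡ (≈-trans (+-congˡ (+-congˡ (+-congˡ (+-congˡ (+-congˡ (+-congˡ (*-congˡ H.1#-homo)))))))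
                                      (≈-sym (∑-sum₇ (λ k → row-coordinates s f′ k * basis k x y)))))
                    (-‿cong (*-congˡ key)) ⟩
        f * row s f′ x y - σ s * κ 0ₑ
          ≈⟨ solve 2 (λ e v → e :- v :* con 0ₑ := e) ≈-refl (f * row s f′ x y) (σ s) ⟩
        f * row s f′ x y                                               ∎

      J-eigen : ∀ x y → (J ⊠ row s f′) x y ≈ κ 0ₑ * row s f′ x y
      J-eigen x y = begin
        (J ⊠ row s f′) x y                                             ≈⟨ ⊠-linComb-basis J (row-coordinates s f′) x y ⟩
        sum₇ (λ k → row-coordinates s f′ k * ⊠-basis J k x y)
          ≈⟨ +-cong₇
               (*-congˡ (J-⊠-I y))
               (*-congˡ (J-⊠-I (τ (τ y))))
               (*-congˡ (J-⊠-I (τ y)))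
               (*-congˡ (J-⊠-F x y))
               (*-congˡ (J-⊠-F x (τ (τ y))))
               (*-congˡ (J-⊠-F x (τ y)))
               (*-congˡ (J-⊠-J x y)) ⟩
        - f′ * κ 1ₑ + (- f′ * (s * s) * κ 1ₑ + (- f′ * s * κ 1ₑ + (κ 1ₑ * f₀ + (s * s * f₀ + (s * f₀
          + - ((κ 1ₑ + (s * s + s)) * ((f₀ - f′) * N⁻¹)) * N)))))
          ≈⟨ solve 5 (λ s f′ f₀ v N →
               :- f′ :* con 1ₑ :+ (:- f′ :* (s :* s) :* con 1ₑ :+ (:- f′ :* s :* con 1ₑ :+ (con 1ₑ :* f₀ :+ (s :* s :* f₀ :+ (s :* f₀
                 :+ :- ((con 1ₑ :+ (s :* s :+ s)) :* ((f₀ :- f′) :* v)) :* N)))))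
               := (con 1ₑ :- N :* v) :* ((con 1ₑ :+ (s :* s :+ s)) :* (f₀ :- f′))) ≈-refl s f′ f₀ N⁻¹ N ⟩
        (κ 1ₑ - N * N⁻¹) * (σ s * (f₀ - f′))                           ≈⟨ *-congʳ (+-congˡ (-‿cong NN⁻¹≈1)) ⟩
        (κ 1ₑ - κ 1ₑ) * (σ s * (f₀ - f′))
          ≈⟨ solve 2 (λ v e → (con 1ₑ :- con 1ₑ) :* v := con 0ₑ :* e) ≈-refl _ (row s f′ x y) ⟩
        κ 0ₑ * row s f′ x y                                            ∎
        where
        J-⊠-I : ∀ y → (J ⊠ I) x y ≈ κ 1ₑ
        J-⊠-I y = ≈-trans (⊠-I J x y) (≈-sym H.1#-homo)

    scalar-eigenvalue F-eigenvalue J-eigenvalue : Fin 7 → C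
    scalar-eigenvalue zero    = κ 1ₑ
    scalar-eigenvalue (suc k) = κ (t k)
    F-eigenvalue zero         = f₀
    F-eigenvalue (suc k)      = κ (φ k) * c
    J-eigenvalue zero         = N
    J-eigenvalue (suc k)      = κ 0ₑ

    E : Fin 7 → Matrix (Φ n)
    E zero    x y = N⁻¹
    E (suc k) x y = (κ (ν k) * d) * row (κ (t k)) (κ (φ′ k) * c) x y

    E-eigen : ∀ k → Eigen (E k) (scalar-eigenvalue k) (F-eigenvalue k) (J-eigenvalue k)
    E-eigen zero = record
      { τ-eigen = λ x y → solve 1 (λ v → v := con 1ₑ :* v) ≈-refl N⁻¹
      ; F-eigen = λ x y → ≈-trans (∑-*ʳ elems N⁻¹ (F x)) (*-congʳ (≈-trans
          (∑-cong elems λ z → ≈-reflexive (ψ-swap (vec x) (vec z))) (∑-F x)))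
      ; J-eigen = λ x y → ≈-trans (∑-*ʳ elems N⁻¹ (J x)) (*-congʳ ∑-1)
      }
    E-eigen (suc k) = Eigen-scale (κ (ν k) * d) (row-eigen (κ (t k)) (κ (φ k) * c) (κ (φ′ k) * c) cube sum product′)
      where
      cube : κ (t k) * κ (t k) * κ (t k) ≈ κ 1ₑ
      cube = ≈-trans (≈-sym (≈-trans (H.*-homo _ _) (*-congʳ (H.*-homo _ _)))) (≈-reflexive (cong κ (t-cube k)))
      sum : κ (φ k) * c + κ (φ′ k) * c ≈ g
      sum = ≈-trans (≈-sym (distribʳ c _ _)) (*-congʳ (≈-trans (≈-sym (H.+-homo _ _)) (≈-reflexive (cong κ (φ-sum k)))))
      product′ : - ((κ (φ k) * c) * (κ (φ′ k) * c)) ≈ h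
      product′ = begin
        - ((κ (φ k) * c) * (κ (φ′ k) * c))
          ≈⟨ solve 3 (λ p q c → :- ((p :* c) :* (q :* c)) := :- (p :* q) :* (c :* c)) ≈-refl (κ (φ k)) (κ (φ′ k)) c ⟩
        - (κ (φ k) * κ (φ′ k)) * (c * c)
          ≈⟨ *-congʳ (-‿cong (≈-trans (≈-sym (H.*-homo _ _)) (≈-reflexive (cong κ (φ-product k))))) ⟩
        - ♯ (ℤ.- + 32) * (c * c)
          ≈⟨ solve 1 (λ c → :- con (int (ℤ.- + 32)) :* (c :* c) := con (int (+ 32)) :* (c :* c)) ≈-refl c ⟩
        h                                      ∎

    -- Expanding only E k in the basis, its product with E l is governed by the eigenvalues of E l.
    -- Idempotence and orthogonality thus become scalar identities, the ones between proper rows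
    -- being `row-orthogonality`.
    E-⊠-E : ∀ k l → E k ⊠ E l ≐ λ x y → κ (δₑ k l) * E l x y
    E-⊠-E zero l x y = begin
      ∑ elems (λ z → N⁻¹ * E l z y)
        ≈⟨ ∑-cong elems (λ z → *-congˡ (≈-sym (*-identityˡ (E l z y)))) ⟩
      ∑ elems (λ z → N⁻¹ * (J x z * E l z y))             ≈⟨ ∑-*ˡ elems N⁻¹ (λ z → J x z * E l z y) ⟩
      N⁻¹ * (J ⊠ E l) x y                                 ≈⟨ *-congˡ (Eigen.J-eigen (E-eigen l) x y) ⟩
      N⁻¹ * (J-eigenvalue l * E l x y)                    ≈⟨ *-assoc N⁻¹ (J-eigenvalue l) (E l x y) ⟨
      (N⁻¹ * J-eigenvalue l) * E l x y                    ≈⟨ *-congʳ (factor l) ⟩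
      κ (δₑ zero l) * E l x y                             ∎
      where
      factor : ∀ l → N⁻¹ * J-eigenvalue l ≈ κ (δₑ zero l)
      factor zero    = ≈-trans (*-comm N⁻¹ N) NN⁻¹≈1
      factor (suc l) = solve 1 (λ v → v :* con 0ₑ := con 0ₑ) ≈-refl N⁻¹
    E-⊠-E (suc k) l x y = begin
      ∑ elems (λ z → (μ * R x z) * E l z y)      ≈⟨ ∑-cong elems (λ z → *-assoc μ (R x z) (E l z y)) ⟩
      ∑ elems (λ z → μ * (R x z * E l z y))      ≈⟨ ∑-*ˡ elems μ _ ⟩
      μ * (R ⊠ E l) x y                          ≈⟨ *-congˡ (linComb-eigen (row-coordinates s f′) (E-eigen l) x y) ⟩
      μ * (eigenvalue (scalar-eigenvalue l) (F-eigenvalue l) (J-eigenvalue l) (row-coordinates s f′) * E l x y)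
        ≈⟨ *-assoc μ _ (E l x y) ⟨
      (μ * eigenvalue (scalar-eigenvalue l) (F-eigenvalue l) (J-eigenvalue l) (row-coordinates s f′)) * E l x y
        ≈⟨ *-congʳ (factor l) ⟩
      κ (δₑ (suc k) l) * E l x y                 ∎
      where
      μ s f′ : C
      μ  = κ (ν k) * d
      s  = κ (t k)
      f′ = κ (φ′ k) * c
      R : Matrix (Φ n)
      R = row s f′
      factor : ∀ l → μ * eigenvalue (scalar-eigenvalue l) (F-eigenvalue l) (J-eigenvalue l) (row-coordinates s f′) ≈ κ (δₑ (suc k) l)
      -- The J-coordinate was chosen so that the eigenvalue on the constant vector is a multiple of
      -- 1 - N N⁻¹.
      factor zero = begin
        μ * eigenvalue (κ 1ₑ) f₀ N (row-coordinates s f′)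
          ≈⟨ solve 6 (λ μ s f′ f₀ N v →
               μ :* ((:- f′ :+ (:- f′ :* (s :* s) :* con 1ₑ :+ :- f′ :* s :* (con 1ₑ :* con 1ₑ)))
                 :+ ((con 1ₑ :+ (s :* s :* con 1ₑ :+ s :* (con 1ₑ :* con 1ₑ))) :* f₀ :+ :- ((con 1ₑ :+ (s :* s :+ s)) :* ((f₀ :- f′) :* v)) :* N))
               := (con 1ₑ :- N :* v) :* (μ :* ((con 1ₑ :+ (s :* s :+ s)) :* (f₀ :- f′)))) ≈-refl μ s f′ f₀ N N⁻¹ ⟩
        (κ 1ₑ - N * N⁻¹) * (μ * (σ s * (f₀ - f′)))     ≈⟨ *-congʳ (+-congˡ (-‿cong NN⁻¹≈1)) ⟩
        (κ 1ₑ - κ 1ₑ) * (μ * (σ s * (f₀ - f′)))        ≈⟨ solve 1 (λ v → (con 1ₑ :- con 1ₑ) :* v := con 0ₑ) ≈-refl _ ⟩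
        κ 0ₑ                                           ∎
      factor (suc l) = begin
        μ * eigenvalue (κ (t l)) (κ (φ l) * c) (κ 0ₑ) (row-coordinates s f′)
          ≈⟨ solve 8 (λ ν d s s′ p p′ c v → let f = p :* c
                                                f′ = p′ :* c in
               (ν :* d) :* ((:- f′ :+ (:- f′ :* (s :* s) :* s′ :+ :- f′ :* s :* (s′ :* s′)))
                 :+ ((con 1ₑ :+ (s :* s :* s′ :+ s :* (s′ :* s′))) :* f :+ v :* con 0ₑ))
               := (ν :* ((con 1ₑ :+ (s :* s :* s′ :+ s :* (s′ :* s′))) :* (p :+ :- p′))) :* (c :* d))
               ≈-refl (κ (ν k)) d s (κ (t l)) (κ (φ l)) (κ (φ′ k)) c _ ⟩
        (κ (ν k) * ((κ 1ₑ + (s * s * κ (t l) + s * (κ (t l) * κ (t l)))) * (κ (φ l) + - κ (φ′ k)))) * (c * d)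
          ≈⟨ *-cong (≈-sym (≈-trans (H.*-homo _ _) (*-congˡ (≈-trans (H.*-homo _ _) (*-cong
               (≈-trans (H.+-homo _ _) (+-congˡ (≈-trans (H.+-homo _ _) (+-cong (≈-trans (H.*-homo _ _) (*-congʳ (H.*-homo _ _)))
                 (≈-trans (H.*-homo _ _) (*-congˡ (H.*-homo _ _)))))))
               (≈-trans (H.+-homo _ _) (+-congˡ (H.-‿homo _)))))))) cd≈1 ⟩
        κ (ν k *ₑ ((1ₑ +ₑ (t k *ₑ t k *ₑ t l +ₑ t k *ₑ (t l *ₑ t l))) *ₑ (φ l +ₑ -ₑ φ′ k))) * κ 1ₑ
          ≈⟨ *-congʳ (≈-reflexive (cong κ (row-orthogonality k l))) ⟩
        κ (δₑ k l) * κ 1ₑ                              ≈⟨ ≈-trans (*-congˡ H.1#-homo) (*-identityʳ _) ⟩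
        κ (δₑ k l)                                     ∎

    E-idempotent : ∀ k → E k ⊠ E k ≐ E k
    E-idempotent k x y = ≈-trans (E-⊠-E k k x y) (≈-trans (*-congʳ (≈-trans
      (≈-reflexive (cong (λ b → κ (if b then 1ₑ else 0ₑ)) (dec-true (k Fin.≟ k) refl))) H.1#-homo)) (*-identityˡ _))

    E-orthogonal : ∀ k l → k ≢ l → E k ⊠ E l ≐ λ _ _ → 0#
    E-orthogonal k l k≢l x y = ≈-trans (E-⊠-E k l x y) (≈-trans (*-congʳ (≈-trans
      (≈-reflexive (cong (λ b → κ (if b then 1ₑ else 0ₑ)) (dec-false (k Fin.≟ l) k≢l))) H.0#-homo)) (zeroˡ _))

    -- Puts a row into the exact shape to which the solver's polynomial evaluates, with κ 1ₑ in
    -- place of `1#`.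
    row-expand : ∀ k x y → row (κ (t k)) (κ (φ′ k) * c) x y ≈
      (let s = κ (t k) ; f′ = κ (φ′ k) * c in
      - f′ * I x y + (- f′ * (s * s) * I (τ x) y + (- f′ * s * I (τ (τ x)) y + (κ 1ₑ * F x y
          + (s * s * F (τ x) y + (s * F (τ (τ x)) y + - (σ s * ((f₀ - f′) * N⁻¹)) * κ 1ₑ))))))
    row-expand k x y = ≈-trans (∑-sum₇ (λ j → row-coordinates (κ (t k)) (κ (φ′ k) * c) j * basis j x y))
      (+-congˡ (+-congˡ (+-congˡ (+-congˡ (+-congˡ (+-congˡ (*-congˡ (≈-sym H.1#-homo))))))))

    -- With ν, t and φ′ entered as literal coefficients, everything cancels except cd I + (1 -
    -- cd)N⁻¹, and cd = 1.
    E-complete : ∀ x y → linComb elems (λ _ → 1#) E x y ≈ I x y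
    E-complete x y = begin
      ∑ (allFin 7) (λ k → 1# * E k x y)
        ≈⟨ ∑-cong (allFin 7) {λ k → 1# * E k x y} {λ k → E k x y} (λ k → *-identityˡ (E k x y)) ⟩
      ∑ (allFin 7) (λ k → E k x y)                 ≈⟨ ∑-sum₇ (λ k → E k x y) ⟩
      sum₇ (λ k → E k x y)
        ≈⟨ +-cong₇ ≈-refl (expand 0F) (expand 1F) (expand 2F) (expand 3F) (expand 4F) (expand 5F) ⟩
      _                                            ≈⟨ solve 9 (λ c d v b₀ b₁ b₂ b₃ b₄ b₅ → let
            f₀ = con (int (ℤ.- + 4)) :* c :- con 1ₑ
            term = λ k → let s = con (t k) ; f′ = con (φ′ k) :* c in
              (con (ν k) :* d) :* (:- f′ :* b₀ :+ (:- f′ :* (s :* s) :* b₁ :+ (:- f′ :* s :* b₂ :+ (con 1ₑ :* b₃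
                :+ (s :* s :* b₄ :+ (s :* b₅ :+ :- ((con 1ₑ :+ (s :* s :+ s)) :* ((f₀ :- f′) :* v)) :* con 1ₑ))))))
          in v :+ (term 0F :+ (term 1F :+ (term 2F :+ (term 3F :+ (term 4F :+ term 5F)))))
             := (c :* d) :* b₀ :+ (con 1ₑ :- c :* d) :* v)
          ≈-refl c d N⁻¹ (I x y) (I (τ x) y) (I (τ (τ x)) y) (F x y) (F (τ x) y) (F (τ (τ x)) y) ⟩
      (c * d) * I x y + (κ 1ₑ - c * d) * N⁻¹       ≈⟨ +-cong (*-congʳ cd≈1) (*-congʳ (+-congˡ (-‿cong cd≈1))) ⟩
      κ 1ₑ * I x y + (κ 1ₑ - κ 1ₑ) * N⁻¹
        ≈⟨ solve 2 (λ b v → con 1ₑ :* b :+ (con 1ₑ :- con 1ₑ) :* v := b) ≈-refl (I x y) N⁻¹ ⟩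
      I x y                                        ∎
      where
      expand : ∀ k → E (suc k) x y ≈ _
      expand k = *-congˡ (row-expand k x y)

    -- Membership is read off from the entries: each E k is a combination of matrices that are
    -- constant on every relation.
    E∈linComb-A : ∀ k → ∃ λ v → E k ≐ linComb elems v A
    E∈linComb-A zero    = (λ _ → N⁻¹) , constant⇒linComb-A (E zero) (λ _ → N⁻¹) λ _ _ _ _ → ≈-refl
    E∈linComb-A (suc k) = v , constant⇒linComb-A (E (suc k)) v λ l x y r →
        *-congˡ (linComb-value (row-coordinates (κ (t k)) (κ (φ′ k) * c)) l x y r)
      where
      v : Fin 7 → C
      v l = (κ (ν k) * d) * ∑ (allFin 7) (λ j → row-coordinates (κ (t k)) (κ (φ′ k) * c) j * κ (entry j l))

    P : Fin 7 → Fin 7 → C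
    P k j = eigenvalue (scalar-eigenvalue k) (F-eigenvalue k) (J-eigenvalue k) (κ ∘ adjacency-coordinates j)

    -- The idempotents sum to I, so A j is the sum of its products with them, and each product is an
    -- eigenvalue times E k.
    expansion : ∀ j → A j ≐ linComb elems (λ k → P k j) E
    expansion j x y = begin
      A j x y                                              ≈⟨ ⊠-I (A j) x y ⟨
      (A j ⊠ I) x y
        ≈⟨ ⊡-cong elems {A j} {A j} {I} {linComb elems (λ _ → 1#) E} (λ _ _ → ≈-refl) (λ x y → ≈-sym (E-complete x y)) x y ⟩
      (A j ⊠ linComb elems (λ _ → 1#) E) x y               ≈⟨ ⊡-linComb elems (λ _ → 1#) E (A j) x y ⟩
      ∑ (allFin 7) (λ k → 1# * (A j ⊠ E k) x y)
        ≈⟨ ∑-cong (allFin 7) {λ k → 1# * (A j ⊠ E k) x y} {λ k → P k j * E k x y} (λ k → ≈-trans (*-identityˡ _) (act k)) ⟩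
      ∑ (allFin 7) (λ k → P k j * E k x y)                 ∎
      where
      act : ∀ k → (A j ⊠ E k) x y ≈ P k j * E k x y
      act k = ≈-trans (⊡-cong elems {A j} {linComb elems (κ ∘ adjacency-coordinates j) basis} {E k} {E k} (A-coordinates j) (λ _ _ → ≈-refl) x y)
        (linComb-eigen (κ ∘ adjacency-coordinates j) (E-eigen k) x y)

    -- Comparing the entries on ℛ₆ and ℛ₃ isolates the F-part of a row.
    E-cancel : (∀ l → ∃₂ λ x y → ℛ {n} α l x y) → ∀ k v → (∀ x y → v * E k x y ≈ 0#) → v ≈ 0#
    E-cancel inhabited zero v vE≈0 = begin
      v                    ≈⟨ *-identityʳ v ⟨
      v * 1#               ≈⟨ *-congˡ H.1#-homo ⟨
      v * κ 1ₑ             ≈⟨ *-congˡ NN⁻¹≈1 ⟨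
      v * (N * N⁻¹)        ≈⟨ solve 3 (λ v a b → v :* (a :* b) := (v :* b) :* a) ≈-refl v N N⁻¹ ⟩
      (v * N⁻¹) * N        ≈⟨ *-congʳ (vE≈0 (proj₁ (inhabited 0F)) (proj₁ (inhabited 0F))) ⟩
      0# * N               ≈⟨ zeroˡ N ⟩
      0#                   ∎
    E-cancel inhabited (suc k) v vE≈0 = begin
      v                                                    ≈⟨ ≈-trans (*-congˡ H.1#-homo) (*-identityʳ v) ⟨
      v * κ 1ₑ                                             ≈⟨ *-congˡ unit-product ⟨
      v * ((κ (ρ k) * (♯ (+ 2) * (s * s + s))) * ((κ (ν k) * (♯ (+ 3) * (κ (φ k) + - κ (φ′ k)))) * (c * d)))
        -- The I-terms vanish on both relations and the J-term cancels in the difference, leaving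
        -- 2(s² + s). The remaining factors complete each of ρ, ν and d to a product equal to 1.
        ≈⟨ solve 9 (λ v ρ s ν p c d f′ r → let
              R₆ = :- f′ :* con 0ₑ :+ (:- f′ :* (s :* s) :* con 0ₑ :+ (:- f′ :* s :* con 0ₑ :+ (con 1ₑ :* con 1ₑ
                     :+ (s :* s :* con 1ₑ :+ (s :* con 1ₑ :+ r :* con 1ₑ)))))
              R₃ = :- f′ :* con 0ₑ :+ (:- f′ :* (s :* s) :* con 0ₑ :+ (:- f′ :* s :* con 0ₑ :+ (con 1ₑ :* con 1ₑ
                     :+ (s :* s :* con (int (ℤ.- + 1)) :+ (s :* con (int (ℤ.- + 1)) :+ r :* con 1ₑ)))))
              in v :* ((ρ :* (con (int (+ 2)) :* (s :* s :+ s))) :* ((ν :* (con (int (+ 3)) :* p)) :* (c :* d)))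
                 := (v :* ((ν :* d) :* R₆) :- v :* ((ν :* d) :* R₃)) :* (ρ :* ((con (int (+ 3)) :* p) :* c)))
             ≈-refl v (κ (ρ k)) s (κ (ν k)) (κ (φ k) + - κ (φ′ k)) c d f′ r ⟩
      (v * ((κ (ν k) * d) * sum₇ (λ j → u j * κ (value₆ j))) - v * ((κ (ν k) * d) * sum₇ (λ j → u j * κ (value₃ j))))
        * (κ (ρ k) * ((♯ (+ 3) * (κ (φ k) + - κ (φ′ k))) * c))
        ≈⟨ *-congʳ (+-cong (vanish 6F value₆ (value₆≡ α-cases)) (-‿cong (vanish 3F value₃ (value₃≡ α-cases)))) ⟩
      (κ 0ₑ - κ 0ₑ) * (κ (ρ k) * ((♯ (+ 3) * (κ (φ k) + - κ (φ′ k))) * c))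
        ≈⟨ solve 1 (λ v → (con 0ₑ :- con 0ₑ) :* v := con 0ₑ) ≈-refl _ ⟩
      κ 0ₑ                                                 ≈⟨ H.0#-homo ⟩
      0#                                                   ∎
      where
      s f′ r : C
      s  = κ (t k)
      f′ = κ (φ′ k) * c
      r  = - (σ s * ((f₀ - f′) * N⁻¹))
      u : Fin 7 → C
      u = row-coordinates s f′
      value₆ value₃ : Fin 7 → ℚω
      value₆ = lookup (0ₑ ∷ 0ₑ ∷ 0ₑ ∷ 1ₑ ∷ 1ₑ ∷ 1ₑ ∷ 1ₑ ∷ [])
      value₃ = lookup (0ₑ ∷ 0ₑ ∷ 0ₑ ∷ 1ₑ ∷ int (ℤ.- + 1) ∷ int (ℤ.- + 1) ∷ 1ₑ ∷ [])
      value₆≡ : α ≡ ζ ⊎ α ≡ ζ² → ∀ j → entry j 6F ≡ value₆ j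
      value₆≡ (inj₁ refl) = from-yes (Fin.all? λ j → entry j 6F ≟ₑ value₆ j)
      value₆≡ (inj₂ refl) = from-yes (Fin.all? λ j → entry j 6F ≟ₑ value₆ j)
      value₃≡ : α ≡ ζ ⊎ α ≡ ζ² → ∀ j → entry j 3F ≡ value₃ j
      value₃≡ (inj₁ refl) = from-yes (Fin.all? λ j → entry j 3F ≟ₑ value₃ j)
      value₃≡ (inj₂ refl) = from-yes (Fin.all? λ j → entry j 3F ≟ₑ value₃ j)
      vanish : ∀ l (w : Fin 7 → ℚω) → (∀ j → entry j l ≡ w j) → v * ((κ (ν k) * d) * sum₇ (λ j → u j * κ (w j))) ≈ κ 0ₑ
      vanish l w eq with inhabited l
      ... | x , y , rel = ≈-trans (*-congˡ (*-congˡ (≈-sym (≈-trans (linComb-value u l x y rel) (≈-trans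
              (∑-cong (allFin 7) {λ j → u j * κ (entry j l)} {λ j → u j * κ (w j)} (λ j → *-congˡ (≈-reflexive (cong κ (eq j)))))
              (∑-sum₇ (λ j → u j * κ (w j))))))))
            (≈-trans (vE≈0 x y) (≈-sym H.0#-homo))
      unit-product : (κ (ρ k) * (♯ (+ 2) * (s * s + s))) * ((κ (ν k) * (♯ (+ 3) * (κ (φ k) + - κ (φ′ k)))) * (c * d)) ≈ κ 1ₑ
      unit-product = begin
        (κ (ρ k) * (♯ (+ 2) * (s * s + s))) * ((κ (ν k) * (♯ (+ 3) * (κ (φ k) + - κ (φ′ k)))) * (c * d))
          ≈⟨ *-cong (≈-sym (≈-trans (H.*-homo _ _) (*-congˡ (≈-trans (H.*-homo _ _) (*-congˡ (≈-trans (H.+-homo _ _) (+-congʳ (H.*-homo _ _))))))))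
                    (*-cong (≈-sym (≈-trans (H.*-homo _ _) (*-congˡ (≈-trans (H.*-homo _ _) (*-congˡ (≈-trans (H.+-homo _ _) (+-congˡ (H.-‿homo _)))))))) cd≈1) ⟩
        κ (ρ k *ₑ (int (+ 2) *ₑ (t k *ₑ t k +ₑ t k))) * (κ (ν k *ₑ (int (+ 3) *ₑ (φ k +ₑ -ₑ φ′ k))) * κ 1ₑ)
          ≈⟨ *-cong (≈-reflexive (cong κ (ρ-inverse k))) (*-congʳ (≈-reflexive (cong κ (ν-inverse k)))) ⟩
        κ 1ₑ * (κ 1ₑ * κ 1ₑ)     ≈⟨ solve 0 (con 1ₑ :* (con 1ₑ :* con 1ₑ) := con 1ₑ) ≈-refl ⟩
        κ 1ₑ                     ∎

    -- Eigenvalues and the character table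

    eigenvalueₚ : ∀ {m} → Polynomial m → Polynomial m → Polynomial m → Fin 7 → Polynomial m
    eigenvalueₚ s f j k =
      (u 0F :+ (u 1F :* s :+ u 2F :* (s :* s))) :+ ((u 3F :+ (u 4F :* s :+ u 5F :* (s :* s))) :* f :+ u 6F :* j)
      where
      u : Fin 7 → Polynomial _
      u i = con (adjacency-coordinates k i)

    -- The entries are opaque elements of K with known values in terms of c, so the table over `ℂ`
    -- can be inserted exactly as it is stated.
    module Table
      (w w̄ q q₆ a₃ b₃ b₆ c₃ c₆ : C) (w≈ : w ≈ κ ωₑ) (w̄≈ : w̄ ≈ κ ω̄ₑ)
      (q≈ : q ≈ ♯ (+ 8) * (c * c)) (q₆≈ : q₆ ≈ ♯ (+ 8) * (c * c) - ♯ (+ 4) * c - ♯ (+ 4))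
      (a₃≈ : a₃ ≈ ♯ (ℤ.- + 4) * c) (b₃≈ : b₃ ≈ ♯ (+ 2) * c) (b₆≈ : b₆ ≈ ♯ (ℤ.- + 6) * c - ♯ (+ 3))
      (c₃≈ : c₃ ≈ ♯ (ℤ.- + 1) * c) (c₆≈ : c₆ ≈ ♯ (+ 3) * c - ♯ (+ 3))
      where

      trivial-row : C → C → Vec C 7
      trivial-row e e₆ = 1# ∷ 1# ∷ 1# ∷ e ∷ e ∷ e ∷ e₆ ∷ []

      twisted-row : C → C → C → Vec C 7
      twisted-row s s̄ e = 1# ∷ s ∷ s̄ ∷ e ∷ e * s̄ ∷ e * s ∷ 0# ∷ []

      K-table : Fin 7 → Fin 7 → C
      K-table k j = lookup (lookup rows k) j
        where
        rows : Vec (Vec C 7) 7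
        rows = trivial-row q q₆ ∷ twisted-row w w̄ a₃ ∷ twisted-row w̄ w a₃ ∷ trivial-row b₃ b₆ ∷
               twisted-row w w̄ b₃ ∷ twisted-row w̄ w b₃ ∷ trivial-row c₃ c₆ ∷ []

      coordinates : Fin 7 → Fin 7 → C
      coordinates j = κ ∘ adjacency-coordinates j

      -- Off the all-one vector J acts as 0 and A₃ as ¼(1 - s - s²)f. This is -f/4 at s = 1 and f/2
      -- at a primitive cube root of unity. At s = 1 the relation ℛ₆ contributes ¾f - 3; at the
      -- primitive roots its value vanishes because 1 + s + s² = 0.
      trivial-values : ∀ f e e₆ → e ≈ κ (rat (ℚ.- ¼)) * f → e₆ ≈ κ (rat (+ 3 ℚ./ 4)) * f - ♯ (+ 3) →
        ∀ j → eigenvalue (κ 1ₑ) f (κ 0ₑ) (coordinates j) ≈ lookup (trivial-row e e₆) j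
      trivial-values f e e₆ e≈ e₆≈ = λ
        { 0F → ≈-trans (solve 1 (λ f → eigenvalueₚ (con 1ₑ) f (con 0ₑ) 0F := con 1ₑ) ≈-refl f) H.1#-homo
        ; 1F → ≈-trans (solve 1 (λ f → eigenvalueₚ (con 1ₑ) f (con 0ₑ) 1F := con 1ₑ) ≈-refl f) H.1#-homo
        ; 2F → ≈-trans (solve 1 (λ f → eigenvalueₚ (con 1ₑ) f (con 0ₑ) 2F := con 1ₑ) ≈-refl f) H.1#-homo
        ; 3F → ≈-trans (solve 1 (λ f → eigenvalueₚ (con 1ₑ) f (con 0ₑ) 3F := con (rat (ℚ.- ¼)) :* f) ≈-refl f) (≈-sym e≈)
        ; 4F → ≈-trans (solve 1 (λ f → eigenvalueₚ (con 1ₑ) f (con 0ₑ) 4F := con (rat (ℚ.- ¼)) :* f) ≈-refl f) (≈-sym e≈)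
        ; 5F → ≈-trans (solve 1 (λ f → eigenvalueₚ (con 1ₑ) f (con 0ₑ) 5F := con (rat (ℚ.- ¼)) :* f) ≈-refl f) (≈-sym e≈)
        ; 6F → ≈-trans (solve 1 (λ f → eigenvalueₚ (con 1ₑ) f (con 0ₑ) 6F := con (rat (+ 3 ℚ./ 4)) :* f :- con (int (+ 3))) ≈-refl f) (≈-sym e₆≈)
        }

      ω-values : ∀ f e → e ≈ κ (rat ½) * f → ∀ j → eigenvalue (κ ωₑ) f (κ 0ₑ) (coordinates j) ≈ lookup (twisted-row w w̄ e) j
      ω-values f e e≈ = λ
        { 0F → ≈-trans (solve 1 (λ f → eigenvalueₚ (con ωₑ) f (con 0ₑ) 0F := con 1ₑ) ≈-refl f) H.1#-homo
        ; 1F → ≈-trans (solve 1 (λ f → eigenvalueₚ (con ωₑ) f (con 0ₑ) 1F := con ωₑ) ≈-refl f) (≈-sym w≈)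
        ; 2F → ≈-trans (solve 1 (λ f → eigenvalueₚ (con ωₑ) f (con 0ₑ) 2F := con ω̄ₑ) ≈-refl f) (≈-sym w̄≈)
        ; 3F → ≈-trans (solve 1 (λ f → eigenvalueₚ (con ωₑ) f (con 0ₑ) 3F := con (rat ½) :* f) ≈-refl f) (≈-sym e≈)
        ; 4F → ≈-trans (solve 1 (λ f → eigenvalueₚ (con ωₑ) f (con 0ₑ) 4F := con (rat ½) :* f :* con ω̄ₑ) ≈-refl f) (≈-sym (*-cong e≈ w̄≈))
        ; 5F → ≈-trans (solve 1 (λ f → eigenvalueₚ (con ωₑ) f (con 0ₑ) 5F := con (rat ½) :* f :* con ωₑ) ≈-refl f) (≈-sym (*-cong e≈ w≈))
        ; 6F → ≈-trans (solve 1 (λ f → eigenvalueₚ (con ωₑ) f (con 0ₑ) 6F := con 0ₑ) ≈-refl f) H.0#-homo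
        }

      ω̄-values : ∀ f e → e ≈ κ (rat ½) * f → ∀ j → eigenvalue (κ ω̄ₑ) f (κ 0ₑ) (coordinates j) ≈ lookup (twisted-row w̄ w e) j
      ω̄-values f e e≈ = λ
        { 0F → ≈-trans (solve 1 (λ f → eigenvalueₚ (con ω̄ₑ) f (con 0ₑ) 0F := con 1ₑ) ≈-refl f) H.1#-homo
        ; 1F → ≈-trans (solve 1 (λ f → eigenvalueₚ (con ω̄ₑ) f (con 0ₑ) 1F := con ω̄ₑ) ≈-refl f) (≈-sym w̄≈)
        ; 2F → ≈-trans (solve 1 (λ f → eigenvalueₚ (con ω̄ₑ) f (con 0ₑ) 2F := con ωₑ) ≈-refl f) (≈-sym w≈)
        ; 3F → ≈-trans (solve 1 (λ f → eigenvalueₚ (con ω̄ₑ) f (con 0ₑ) 3F := con (rat ½) :* f) ≈-refl f) (≈-sym e≈)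
        ; 4F → ≈-trans (solve 1 (λ f → eigenvalueₚ (con ω̄ₑ) f (con 0ₑ) 4F := con (rat ½) :* f :* con ωₑ) ≈-refl f) (≈-sym (*-cong e≈ w≈))
        ; 5F → ≈-trans (solve 1 (λ f → eigenvalueₚ (con ω̄ₑ) f (con 0ₑ) 5F := con (rat ½) :* f :* con ω̄ₑ) ≈-refl f) (≈-sym (*-cong e≈ w̄≈))
        ; 6F → ≈-trans (solve 1 (λ f → eigenvalueₚ (con ω̄ₑ) f (con 0ₑ) 6F := con 0ₑ) ≈-refl f) H.0#-homo
        }

      valencies : ∀ j → P 0F j ≈ lookup (trivial-row q q₆) j
      valencies = λ
        { 0F → ≈-trans (solve 1 (λ c → value c 0F := con 1ₑ) ≈-refl c) H.1#-homo
        ; 1F → ≈-trans (solve 1 (λ c → value c 1F := con 1ₑ) ≈-refl c) H.1#-homo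
        ; 2F → ≈-trans (solve 1 (λ c → value c 2F := con 1ₑ) ≈-refl c) H.1#-homo
        ; 3F → ≈-trans (solve 1 (λ c → value c 3F := con (int (+ 8)) :* (c :* c)) ≈-refl c) (≈-sym q≈)
        ; 4F → ≈-trans (solve 1 (λ c → value c 4F := con (int (+ 8)) :* (c :* c)) ≈-refl c) (≈-sym q≈)
        ; 5F → ≈-trans (solve 1 (λ c → value c 5F := con (int (+ 8)) :* (c :* c)) ≈-refl c) (≈-sym q≈)
        ; 6F → ≈-trans (solve 1 (λ c → value c 6F := con (int (+ 8)) :* (c :* c) :- con (int (+ 4)) :* c :- con (int (+ 4))) ≈-refl c) (≈-sym q₆≈)
        }
        where
        value : ∀ {m} → Polynomial m → Fin 7 → Polynomial m
        value c = eigenvalueₚ (con 1ₑ) (con (int (ℤ.- + 4)) :* c :- con 1ₑ)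
                    (con (int (+ 32)) :* (c :* c) :+ con (int (ℤ.- + 4)) :* c :- con 1ₑ)

      P≈K-table : ∀ k j → P k j ≈ K-table k j
      P≈K-table 0F = valencies
      P≈K-table 1F = ω-values _ a₃ (≈-trans a₃≈ (solve 1 (λ c → con (int (ℤ.- + 4)) :* c := con (rat ½) :* (con (φ 0F) :* c)) ≈-refl c))
      P≈K-table 2F = ω̄-values _ a₃ (≈-trans a₃≈ (solve 1 (λ c → con (int (ℤ.- + 4)) :* c := con (rat ½) :* (con (φ 1F) :* c)) ≈-refl c))
      P≈K-table 3F = trivial-values _ b₃ b₆
        (≈-trans b₃≈ (solve 1 (λ c → con (int (+ 2)) :* c := con (rat (ℚ.- ¼)) :* (con (φ 2F) :* c)) ≈-refl c))
        (≈-trans b₆≈ (solve 1 (λ c → con (int (ℤ.- + 6)) :* c :- con (int (+ 3)) := con (rat (+ 3 ℚ./ 4)) :* (con (φ 2F) :* c) :- con (int (+ 3))) ≈-refl c))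
      P≈K-table 4F = ω-values _ b₃ (≈-trans b₃≈ (solve 1 (λ c → con (int (+ 2)) :* c := con (rat ½) :* (con (φ 3F) :* c)) ≈-refl c))
      P≈K-table 5F = ω̄-values _ b₃ (≈-trans b₃≈ (solve 1 (λ c → con (int (+ 2)) :* c := con (rat ½) :* (con (φ 4F) :* c)) ≈-refl c))
      P≈K-table 6F = trivial-values _ c₃ c₆
        (≈-trans c₃≈ (solve 1 (λ c → con (int (ℤ.- + 1)) :* c := con (rat (ℚ.- ¼)) :* (con (φ 5F) :* c)) ≈-refl c))
        (≈-trans c₆≈ (solve 1 (λ c → con (int (+ 3)) :* c :- con (int (+ 3)) := con (rat (+ 3 ℚ./ 4)) :* (con (φ 5F) :* c) :- con (int (+ 3))) ≈-refl c))

      table-expansion : ∀ j → A j ≐ linComb elems (λ k → K-table k j) E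
      table-expansion j x y = ≈-trans (expansion j x y)
        (∑-cong (allFin 7) {λ k → P k j * E k x y} {λ k → K-table k j * E k x y} (λ k → *-congʳ (P≈K-table k j)))

      module Primitivity
        (inhabited : ∀ l → ∃₂ λ x y → ℛ {n} α l x y) (1≉0 : ¬ (1# ≈ 0#)) (dichotomy : ∀ z → z * z ≈ z → z ≈ 0# ⊎ z ≈ 1#)
        where

        open OrthogonalIdempotents elems E E-idempotent E-orthogonal (E-cancel inhabited) 1≉0 dichotomy
          using (Span; IndecomposableIn; nonzero; distinct; indecomposable; exhaustive) public

        BoseMesnerᴷ : Matrix (Φ n) → Set
        BoseMesnerᴷ M = ∃ λ v → M ≐ linComb elems v A

        -- With the converse inclusion this identifies the Bose-Mesner algebra with the span of the
        -- idempotents, to which the results on orthogonal idempotents apply.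
        BoseMesner⇒Span : ∀ M → BoseMesnerᴷ M → Span M
        BoseMesner⇒Span M (v , M≐) = (λ k → ∑ (allFin 7) (λ j → v j * K-table k j)) , λ x y → ≈-trans (M≐ x y)
          (linComb-substitute elems v A (λ j k → K-table k j) E table-expansion x y)

        Span⇒BoseMesner : ∀ M → Span M → BoseMesnerᴷ M
        Span⇒BoseMesner M (f , M≐) = (λ j → ∑ (allFin 7) (λ k → f k * proj₁ (E∈linComb-A k) j)) , λ x y → ≈-trans (M≐ x y)
          (linComb-substitute elems f E (λ k → proj₁ (E∈linComb-A k)) A (λ k → proj₂ (E∈linComb-A k)) x y)

        E-indecomposable : ∀ k → IndecomposableIn BoseMesnerᴷ (E k)
        E-indecomposable k F G F∈ G∈ FF GG FG _ =
          indecomposable k F G (BoseMesner⇒Span F F∈) (BoseMesner⇒Span G G∈) FF GG FG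

        E-exhaustive : ∀ F → BoseMesnerᴷ F → F ⊠ F ≐ F → ¬ (F ≐ λ _ _ → 0#) → IndecomposableIn BoseMesnerᴷ F → ∃ λ k → F ≐ E k
        E-exhaustive F F∈ FF F≉0 indec = exhaustive F (BoseMesner⇒Span F F∈) FF F≉0 λ G H G∈ H∈ →
          indec G H (Span⇒BoseMesner G G∈) (Span⇒BoseMesner H H∈)

-- Specialisation to the complex numbers

module ℂR = CommutativeRing ℂ-commutativeRing
module ℂω = EisensteinMorphism ℂ-commutativeRing rational rational-isRingHomomorphism

κᶜ : ℚω → ℂ
κᶜ = ℂω.evaluate ω ω-minimal

κᶜ-homo : IsRingHomomorphism ℚω-rawRing ℂR.rawRing κᶜ
κᶜ-homo = ℂω.evaluate-homo ω ω-minimal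

module ℂM = Matrices ℂ-commutativeRing
module ℂΧ = Characters ℂ-commutativeRing κᶜ κᶜ-homo
module ℚι = IsRingHomomorphism rational-isRingHomomorphism

-- The relation `ℂ.≈` unfolds to statements about sequences from which its two sides cannot be
-- inferred; hence the explicit arguments here and below.
∑-1-length : ∀ {A : Set} (as : List A) → ℂM.∑ as (λ _ → 1ᶜ) ℂ.≈ integer (+ length as)
∑-1-length []       = ℂR.refl {0ᶜ}
∑-1-length (a ∷ as) = ℂR.trans {1ᶜ ℂ.+ ℂM.∑ as (λ _ → 1ᶜ)} {1ᶜ ℂ.+ integer (+ length as)} {integer (+ suc (length as))}
  (ℂR.+-congˡ {1ᶜ} {ℂM.∑ as (λ _ → 1ᶜ)} {integer (+ length as)} (∑-1-length as))
  (ℂR.trans {1ᶜ ℂ.+ integer (+ length as)} {rational (1ℚ ℚ.+ + length as ℚ./ 1)} {integer (+ suc (length as))}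
    (ℂR.sym {rational (1ℚ ℚ.+ + length as ℚ./ 1)} {1ᶜ ℂ.+ integer (+ length as)} (ℚι.+-homo 1ℚ (+ length as ℚ./ 1)))
    (ℂR.reflexive (cong rational (sym (/1-+ (+ 1) (+ length as))))))

reciprocal-inverse : ∀ {A : Set} (as : List A) → length as ≢ 0 → reciprocal (length as) ℂ.* ℂM.∑ as (λ _ → 1ᶜ) ℂ.≈ 1ᶜ
reciprocal-inverse as as≢[] = ℂR.trans {reciprocal (length as) ℂ.* ℂM.∑ as (λ _ → 1ᶜ)} {reciprocal (length as) ℂ.* integer (+ length as)} {1ᶜ}
  (ℂR.*-congˡ {reciprocal (length as)} {ℂM.∑ as (λ _ → 1ᶜ)} {integer (+ length as)} (∑-1-length as)) (inverse (length as) as≢[])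
  where
  inverse : ∀ k → k ≢ 0 → reciprocal k ℂ.* integer (+ k) ℂ.≈ 1ᶜ
  inverse zero    0≢0 = contradiction refl 0≢0
  inverse (suc k) _   = ℂR.trans {rational (+ 1 ℚ./ suc k) ℂ.* integer (+ suc k)} {rational ((+ 1 ℚ./ suc k) ℚ.* (+ suc k ℚ./ 1))} {1ᶜ}
    (ℂR.sym {rational ((+ 1 ℚ./ suc k) ℚ.* (+ suc k ℚ./ 1))} {rational (+ 1 ℚ./ suc k) ℂ.* integer (+ suc k)}
      (ℚι.*-homo (+ 1 ℚ./ suc k) (+ suc k ℚ./ 1)))
    (ℂR.reflexive (cong rational (trans (ℚₚ.*-comm (+ 1 ℚ./ suc k) (+ suc k ℚ./ 1)) (/-self k))))

-- Over an empty list the sum of the indicator of x would be 0, whereas `∑Φ-single` evaluates it to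
-- 1.
Φ-nonempty : ∀ {n} → Φ n → length (Φ-elements n) ≢ 0
Φ-nonempty {n} x empty = ℂ-1≉0 (ℂR.trans {1ᶜ} {ℂM.∑ (Φ-elements n) at-x} {0ᶜ}
  (ℂR.sym {ℂM.∑ (Φ-elements n) at-x} {1ᶜ} (ℂR.trans {ℂM.∑ (Φ-elements n) at-x} {at-x x} {1ᶜ}
    (ℂΧ.∑Φ-single at-x x λ z z≢x → ℂR.reflexive (cong (if_then 1ᶜ else 0ᶜ) (dec-false (vec z ≟ᵛ vec x) (z≢x ∘ vec-injective z x))))
    (ℂR.reflexive (cong (if_then 1ᶜ else 0ᶜ) (dec-true (vec x ≟ᵛ vec x) refl)))))
  (ℂM.∑-empty (Φ-elements n) at-x empty))
  where
  at-x : Φ n → ℂ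
  at-x z = if does (vec z ≟ᵛ vec x) then 1ᶜ else 0ᶜ

integer-+ : ∀ k l → integer (k ℤ.+ l) ℂ.≈ integer k ℂ.+ integer l
integer-+ k l = ℂR.trans {integer (k ℤ.+ l)} {rational (k ℚ./ 1 ℚ.+ l ℚ./ 1)} {integer k ℂ.+ integer l}
  (ℂR.reflexive (cong rational (/1-+ k l))) (ℚι.+-homo (k ℚ./ 1) (l ℚ./ 1))

integer-* : ∀ k l → integer (k ℤ.* l) ℂ.≈ integer k ℂ.* integer l
integer-* k l = ℂR.trans {integer (k ℤ.* l)} {rational ((k ℚ./ 1) ℚ.* (l ℚ./ 1))} {integer k ℂ.* integer l}
  (ℂR.reflexive (cong rational (/1-* k l))) (ℚι.*-homo (k ℚ./ 1) (l ℚ./ 1))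

integer-neg : ∀ k → integer (ℤ.- k) ℂ.≈ ℂ.- integer k
integer-neg k = ℂR.trans {integer (ℤ.- k)} {rational (ℚ.- (k ℚ./ 1))} {ℂ.- integer k}
  (ℂR.reflexive (cong rational (/1-neg k))) (ℚι.-‿homo (k ℚ./ 1))

infix 4 _≈ᶻ_

-- Wrapped in a record so that unification can recover z and k from the type.
record _≈ᶻ_ (z : ℂ) (k : ℤ) : Set where
  constructor value
  field
    equality : integer k ℂ.≈ z

open _≈ᶻ_

≈ᶻ-resp : ∀ {z k l} → k ≡ l → z ≈ᶻ l → z ≈ᶻ k
≈ᶻ-resp refl p = p

♯-≈ᶻ : ∀ k → ℂΧ.♯ k ≈ᶻ k
♯-≈ᶻ k = value (ℂR.sym {ℂΧ.♯ k} {integer k} (ℂω.evaluate-rat ω ω-minimal (k ℚ./ 1)))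

*-≈ᶻ : ∀ {z w k l} → z ≈ᶻ k → w ≈ᶻ l → z ℂ.* w ≈ᶻ k ℤ.* l
*-≈ᶻ {z} {w} {k} {l} (value p) (value q) = value (ℂR.trans {integer (k ℤ.* l)} {integer k ℂ.* integer l} {z ℂ.* w} (integer-* k l)
  (ℂR.*-cong {integer k} {z} {integer l} {w} p q))

-‿≈ᶻ : ∀ {z w k l} → z ≈ᶻ k → w ≈ᶻ l → z ℂR.- w ≈ᶻ k ℤ.- l
-‿≈ᶻ {z} {w} {k} {l} (value p) (value q) = value
  (ℂR.trans {integer (k ℤ.- l)} {integer k ℂ.+ integer (ℤ.- l)} {z ℂR.- w} (integer-+ k (ℤ.- l))
  (ℂR.+-cong {integer k} {z} {integer (ℤ.- l)} {ℂ.- w} p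
    (ℂR.trans {integer (ℤ.- l)} {ℂ.- integer l} {ℂ.- w} (integer-neg l) (ℂR.-‿cong {integer l} {w} q))))

pow-≈ᶻ : ∀ k → ℂΧ.pow k ≈ᶻ -2^ k
pow-≈ᶻ zero    = ♯-≈ᶻ (+ 1)
pow-≈ᶻ (suc k) = *-≈ᶻ (♯-≈ᶻ (ℤ.- + 2)) (pow-≈ᶻ k)

-- Squaring removes the sign; at k = n - 3 the exponent is 2n - 3, which expresses the valency as
-- 8c².
2^-square : ∀ k → + (2 ℕ.^ (3 ℕ.+ (k ℕ.+ k))) ≡ + 8 ℤ.* (-2^ k ℤ.* -2^ k)
2^-square zero    = refl
2^-square (suc k) = begin
  + (2 ℕ.^ (3 ℕ.+ (suc k ℕ.+ suc k)))                  ≡⟨ cong (λ e → + (2 ℕ.^ (4 ℕ.+ e))) (ℕₚ.+-suc k k) ⟩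
  + (2 ℕ.* (2 ℕ.* 2 ℕ.^ (3 ℕ.+ (k ℕ.+ k))))            ≡⟨ quadruple (2 ℕ.^ (3 ℕ.+ (k ℕ.+ k))) ⟩
  + 2 ℤ.* (+ 2 ℤ.* + (2 ℕ.^ (3 ℕ.+ (k ℕ.+ k))))        ≡⟨ cong (λ p → + 2 ℤ.* (+ 2 ℤ.* p)) (2^-square k) ⟩
  + 2 ℤ.* (+ 2 ℤ.* (+ 8 ℤ.* (-2^ k ℤ.* -2^ k)))        ≡⟨ regroup (-2^ k) ⟩
  + 8 ℤ.* (-2^ suc k ℤ.* -2^ suc k)                    ∎
  where
  open ≡-Reasoning
  quadruple : ∀ p → + (2 ℕ.* (2 ℕ.* p)) ≡ + 2 ℤ.* (+ 2 ℤ.* + p)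
  quadruple p = trans (ℤₚ.pos-* 2 (2 ℕ.* p)) (cong (+ 2 ℤ.*_) (ℤₚ.pos-* 2 p))
  regroup : ∀ p → + 2 ℤ.* (+ 2 ℤ.* (+ 8 ℤ.* (p ℤ.* p))) ≡ + 8 ℤ.* (((ℤ.- + 2) ℤ.* p) ℤ.* ((ℤ.- + 2) ℤ.* p))
  regroup = ℤ-solve-∀

ℛ-inhabited : ∀ {n m α} → n ≡ 4 ℕ.+ m → α ≡ ζ ⊎ α ≡ ζ² → ∀ l → ∃₂ λ x y → ℛ {n} α l x y
ℛ-inhabited {m = m} refl α-cases l =
  let x , y , h = AreTheOrbitals.orbital (ℛ-orbitals α-cases {m}) l
  in x , y , Equivalence.from (h x y) (identity-orbital x y)

module _ (m : ℕ) where

  private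
    k : ℤ
    k = -2^ (suc m)

    c : ℂ
    c = ℂΧ.pow (suc m)

    scaled : ∀ l → ℂΧ.♯ l ℂ.* c ≈ᶻ l ℤ.* k
    scaled l = *-≈ᶻ {ℂΧ.♯ l} {c} {l} {k} (♯-≈ᶻ l) (pow-≈ᶻ (suc m))

    scaled-square : ℂΧ.♯ (+ 8) ℂ.* (c ℂ.* c) ≈ᶻ + 8 ℤ.* (k ℤ.* k)
    scaled-square = *-≈ᶻ {ℂΧ.♯ (+ 8)} {c ℂ.* c} {+ 8} {k ℤ.* k} (♯-≈ᶻ (+ 8))
      (*-≈ᶻ {c} {c} {k} {k} (pow-≈ᶻ (suc m)) (pow-≈ᶻ (suc m)))

  2^[2n-3] : ∀ {n} → n ≡ 4 ℕ.+ m → + (2 ℕ.^ (2 ℕ.* n ℕ.∸ 3)) ≡ + 8 ℤ.* (k ℤ.* k)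
  2^[2n-3] refl = trans (cong (λ e → + (2 ℕ.^ (e ℕ.∸ 3))) (double m)) (2^-square (suc m))
    where
    double : ∀ m → 2 ℕ.* (4 ℕ.+ m) ≡ 6 ℕ.+ (suc m ℕ.+ suc m)
    double = solve-∀

  q-value : ∀ {n} → n ≡ 4 ℕ.+ m → ℂΧ.♯ (+ 8) ℂ.* (c ℂ.* c) ≈ᶻ + (2 ℕ.^ (2 ℕ.* n ℕ.∸ 3))
  q-value n≡ = ≈ᶻ-resp (2^[2n-3] n≡) scaled-square

  q₆-value : ∀ {n} → n ≡ 4 ℕ.+ m → (ℂΧ.♯ (+ 8) ℂ.* (c ℂ.* c) ℂR.- ℂΧ.♯ (+ 4) ℂ.* c) ℂR.- ℂΧ.♯ (+ 4) ≈ᶻ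
             + (2 ℕ.^ (2 ℕ.* n ℕ.∸ 3)) ℤ.- -2^ (n ℕ.∸ 1) ℤ.- + 4
  q₆-value refl = ≈ᶻ-resp (cong₂ (λ p r → p ℤ.- r ℤ.- + 4) (2^[2n-3] refl) (quadruple k))
    (-‿≈ᶻ (-‿≈ᶻ scaled-square (scaled (+ 4))) (♯-≈ᶻ (+ 4)))
    where
    quadruple : ∀ k → (ℤ.- + 2) ℤ.* ((ℤ.- + 2) ℤ.* k) ≡ + 4 ℤ.* k
    quadruple = ℤ-solve-∀

  a-value : ∀ {n} → n ≡ 4 ℕ.+ m → ℂΧ.♯ (ℤ.- + 4) ℂ.* c ≈ᶻ ℤ.- -2^ (n ℕ.∸ 1)
  a-value refl = ≈ᶻ-resp (eq k) (scaled (ℤ.- + 4))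
    where
    eq : ∀ k → ℤ.- ((ℤ.- + 2) ℤ.* ((ℤ.- + 2) ℤ.* k)) ≡ (ℤ.- + 4) ℤ.* k
    eq = ℤ-solve-∀

  b-value : ∀ {n} → n ≡ 4 ℕ.+ m → ℂΧ.♯ (+ 2) ℂ.* c ≈ᶻ ℤ.- -2^ (n ℕ.∸ 2)
  b-value refl = ≈ᶻ-resp (eq k) (scaled (+ 2))
    where
    eq : ∀ k → ℤ.- ((ℤ.- + 2) ℤ.* k) ≡ + 2 ℤ.* k
    eq = ℤ-solve-∀

  b₆-value : ∀ {n} → n ≡ 4 ℕ.+ m → ℂΧ.♯ (ℤ.- + 6) ℂ.* c ℂR.- ℂΧ.♯ (+ 3) ≈ᶻ + 3 ℤ.* -2^ (n ℕ.∸ 2) ℤ.- + 3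
  b₆-value refl = ≈ᶻ-resp (eq k) (-‿≈ᶻ (scaled (ℤ.- + 6)) (♯-≈ᶻ (+ 3)))
    where
    eq : ∀ k → + 3 ℤ.* ((ℤ.- + 2) ℤ.* k) ℤ.- + 3 ≡ (ℤ.- + 6) ℤ.* k ℤ.- + 3
    eq = ℤ-solve-∀

  c-value : ∀ {n} → n ≡ 4 ℕ.+ m → ℂΧ.♯ (ℤ.- + 1) ℂ.* c ≈ᶻ ℤ.- -2^ (n ℕ.∸ 3)
  c-value refl = ≈ᶻ-resp (eq k) (scaled (ℤ.- + 1))
    where
    eq : ∀ k → ℤ.- k ≡ (ℤ.- + 1) ℤ.* k
    eq = ℤ-solve-∀

  c₆-value : ∀ {n} → n ≡ 4 ℕ.+ m → ℂΧ.♯ (+ 3) ℂ.* c ℂR.- ℂΧ.♯ (+ 3) ≈ᶻ + 3 ℤ.* -2^ (n ℕ.∸ 3) ℤ.- + 3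
  c₆-value refl = -‿≈ᶻ (scaled (+ 3)) (♯-≈ᶻ (+ 3))

module _ {n m : ℕ} (n≡4+m : n ≡ 4 ℕ.+ m) {α : 𝔽₄} (α-cases : α ≡ ζ ⊎ α ≡ ζ²) where

  private
    inhabited : ∀ l → ∃₂ λ x y → ℛ {n} α l x y
    inhabited = ℛ-inhabited n≡4+m α-cases

    N⁻¹-inverse : reciprocal (length (Φ-elements n)) ℂ.* ℂM.∑ (Φ-elements n) (λ _ → 1ᶜ) ℂ.≈ 1ᶜ
    N⁻¹-inverse = reciprocal-inverse (Φ-elements n) (Φ-nonempty (proj₁ (inhabited 0F)))

    ω≈ : ω ℂ.≈ κᶜ ωₑ
    ω≈ = ℂR.sym {κᶜ ωₑ} {ω} (ℂω.evaluate-ω ω ω-minimal)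

    ω̄≈ : ω̄ ℂ.≈ κᶜ ω̄ₑ
    ω̄≈ = ℂR.sym {κᶜ ω̄ₑ} {ω̄} (ℂω.evaluate-ω̄ ω ω-minimal ω̄ ω̄-ω)

  module 𝒮 = Scheme ℂ-commutativeRing κᶜ κᶜ-homo n≡4+m α-cases
  module 𝒩 = 𝒮.Normalised (reciprocal (length (Φ-elements n))) N⁻¹-inverse
  module 𝒯 = 𝒩.Table ω ω̄ (integer (+ (2 ℕ.^ (2 ℕ.* n ℕ.∸ 3)))) (integer (+ (2 ℕ.^ (2 ℕ.* n ℕ.∸ 3)) ℤ.- -2^ (n ℕ.∸ 1) ℤ.- + 4))
    (integer (ℤ.- -2^ (n ℕ.∸ 1))) (integer (ℤ.- -2^ (n ℕ.∸ 2))) (integer (+ 3 ℤ.* -2^ (n ℕ.∸ 2) ℤ.- + 3))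
    (integer (ℤ.- -2^ (n ℕ.∸ 3))) (integer (+ 3 ℤ.* -2^ (n ℕ.∸ 3) ℤ.- + 3)) ω≈ ω̄≈
    (equality (q-value m n≡4+m)) (equality (q₆-value m n≡4+m)) (equality (a-value m n≡4+m)) (equality (b-value m n≡4+m)) (equality (b₆-value m n≡4+m)) (equality (c-value m n≡4+m)) (equality (c₆-value m n≡4+m))
  module 𝒫 = 𝒯.Primitivity inhabited ℂ-1≉0 ℂ-idempotent

  ℛ-characterTable : IsCharacterTable (Φ-elements n) (ℛ? α) (table n)
  ℛ-characterTable = record
    { E          = 𝒩.E
    ; primitives = λ k → record
      { member         = 𝒩.E∈linComb-A k
      ; idempotent     = 𝒩.E-idempotent k
      ; nonzero        = 𝒫.nonzero k
      ; indecomposable = 𝒫.E-indecomposable k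
      }
    ; distinct   = 𝒫.distinct
    ; exhaustive = λ F prim → let open IsPrimitiveIdempotent prim in
        𝒫.E-exhaustive F member idempotent nonzero indecomposable
    ; E₀         = λ x y → ℂR.refl {reciprocal (length (Φ-elements n))}
    ; expansion  = 𝒯.table-expansion
    }

theorem5p1 : (n : ℕ) → 4 ≤ n → (α : 𝔽₄) → IsPrimitive α →
    AreTheOrbitals {n} (ℛ α) × IsCharacterTable (Φ-elements n) (ℛ? α) (table n)
theorem5p1 n 4≤n α prim = orbitals (sym (ℕₚ.m+[n∸m]≡n 4≤n)) , ℛ-characterTable (sym (ℕₚ.m+[n∸m]≡n 4≤n)) α-cases
  where
  α-cases : α ≡ ζ ⊎ α ≡ ζ²
  α-cases = primitive-cases α prim
  orbitals : n ≡ 4 ℕ.+ (n ℕ.∸ 4) → AreTheOrbitals {n} (ℛ α)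
  orbitals n≡ = subst (λ n → AreTheOrbitals {n} (ℛ α)) (sym n≡) (ℛ-orbitals α-cases)
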